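{- There is an algorithm that, given a finite, simple, unweighted, undirected, connected graph $G$ on $n$ vertices, a set $S\subseteq V(G)$ with $|S|=k$ such that $G-S$ is a forest, and an integer $\ell$, decides in time $\mathcal{O}(2^{\mathcal{O}(k\log k)}\,\ell^k\, n^{\mathcal{O}(1)})$ whether there exists a shortest path $P$ in $G$ such that $d_G(v,P)\le \ell$ for every $v\in V(G)$.
   Context: $d_G(u,w)$ denotes the distance between $u$ and $w$ in $G$, and for a path $P$, $d_G(v,P)=\min\{d_G(v,w): w\in V(P)\}$. A shortest path is a path between its two endpoints whose length equals their distance in $G$. This decision problem (Eccentricity Shortest Path, parameterized by the size $k$ of the given feedback vertex set $S$ plus $\ell$) is denoted ESP/fvs+ecc. -}

module Defs where

open import Data.Bool using (Bool; true; false; T)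
open import Data.Fin using (Fin)
open import Data.Fin.Subset using (Subset; ∁) renaming (_∈_ to _∈ₛ_)
open import Data.Integer using (ℤ; +_; -[1+_]) renaming (_≤_ to _≤ᶻ_)
open import Data.List using (List; []; _∷_; map; tabulate)
open import Data.List.Membership.Propositional using (_∈_)
open import Data.List.Relation.Unary.Unique.Propositional using (Unique)
open import Data.Nat using (ℕ; zero; suc; _+_; _≤_)
open import Data.Product using (∃; ∃-syntax; _×_; proj₁)
open import Data.Vec using (Vec; lookup; replicate; _∷_; _[_]≔_; toList)
open import Relation.Binary.Construct.Closure.ReflexiveTransitive using (Star; ε; _◅_)
open import Relation.Binary.PropositionalEquality using (_≡_; _≢_)
open import Relation.Nullary using (¬_; Reflects)

------------------------------------------------------------------------
-- Graphs

record Graph (V : Set) : Set where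
  field
    adj      : V → V → Bool
    adj-sym  : ∀ u v → adj u v ≡ adj v u
    loopless : ∀ v → adj v v ≡ false

  Adj : V → V → Set
  Adj u v = T (adj u v)

  Walk : V → V → Set
  Walk = Star Adj

open Graph public

module _ {V : Set} {G : Graph V} where

  walkVertices : ∀ {u w} → Walk G u w → List V
  walkVertices {u} ε       = u ∷ []
  walkVertices {u} (_ ◅ p) = u ∷ walkVertices p

  walkLength : ∀ {u w} → Walk G u w → ℕ
  walkLength ε       = 0
  walkLength (_ ◅ p) = suc (walkLength p)

record Path {V : Set} (G : Graph V) (u w : V) : Set where
  field
    walk   : Walk G u w
    simple : Unique (walkVertices {G = G} walk)

  vertices : List V
  vertices = walkVertices {G = G} walk

  length : ℕ
  length = walkLength {G = G} walk

open Path public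

record Cycle {V : Set} (G : Graph V) : Set where
  field
    {start end} : V
    path        : Path G start end
    long        : 2 ≤ length path
    closing     : Adj G end start

Connected : ∀ {V} → Graph V → Set
Connected G = ∀ u w → Path G u w

Forest : ∀ {V} → Graph V → Set
Forest G = ¬ Cycle G

-- Membership in the complement is used rather than v ∉ S because it is a
-- proposition without function extensionality, so that each vertex outside S
-- occurs only once in G − S.
_−_ : ∀ {n} → Graph (Fin n) → (S : Subset n) → Graph (∃[ v ] v ∈ₛ ∁ S)
G − S = record
  { adj      = λ u v → adj G (proj₁ u) (proj₁ v)
  ; adj-sym  = λ u v → adj-sym G (proj₁ u) (proj₁ v)
  ; loopless = λ v → loopless G (proj₁ v)
  }

------------------------------------------------------------------------
-- Distances and eccentricity of paths

IsMin : (ℕ → Set) → ℕ → Set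
IsMin Q m = Q m × (∀ {j} → Q j → m ≤ j)

-- Dist G u w d reads  d_G(u,w) = d.
Dist : ∀ {V} → Graph V → V → V → ℕ → Set
Dist G u w = IsMin λ d → ∃[ p ] length {G = G} {u} {w} p ≡ d

-- DistToPath G v P d reads  d_G(v,P) = d.
DistToPath : ∀ {V} (G : Graph V) → V → ∀ {a b} → Path G a b → ℕ → Set
DistToPath G v P = IsMin λ d → ∃[ w ] (w ∈ vertices P × Dist G v w d)

IsShortest : ∀ {V} {G : Graph V} {u w} → Path G u w → Set
IsShortest {G = G} {u} {w} P = Dist G u w (length P)

HasEccentricityShortestPath : ∀ {V} → Graph V → ℤ → Set
HasEccentricityShortestPath G ℓ =
  ∃[ a ] ∃[ b ] ∃[ P ] (IsShortest {G = G} {a} {b} P ×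
    (∀ v → ∃[ d ] (DistToPath G v P d × + d ≤ᶻ ℓ)))

------------------------------------------------------------------------
-- Algorithms and running time
--
-- Time is measured in the language WHILE of N. D. Jones, "Computability and
-- Complexity: From a Programming Perspective" (here without tree equality):
-- a Turing-complete imperative language over binary trees.  Every operation
-- is O(1) on a pointer machine, so the time is that of a unit-cost machine
-- model up to the usual simulation overheads.

infixr 5 _∙_

data Tree : Set where
  nil : Tree
  _∙_ : Tree → Tree → Tree

left right : Tree → Tree
left nil      = nil
left (s ∙ t)  = s
right nil     = nil
right (s ∙ t) = t

data Expr (m : ℕ) : Set where
  var   : Fin m → Expr m
  nil   : Expr m
  cons  : Expr m → Expr m → Expr m
  hd tl : Expr m → Expr m

infixr 4 _⨾_
infix  5 _:=_

data Cmd (m : ℕ) : Set where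
  _:=_          : Fin m → Expr m → Cmd m
  _⨾_           : Cmd m → Cmd m → Cmd m
  if_then_else_ : Expr m → Cmd m → Cmd m → Cmd m
  while_loop_   : Expr m → Cmd m → Cmd m

Store : ℕ → Set
Store = Vec Tree

eval : ∀ {m} → Store m → Expr m → Tree
eval σ (var x)    = lookup σ x
eval σ nil        = nil
eval σ (cons e f) = eval σ e ∙ eval σ f
eval σ (hd e)     = left (eval σ e)
eval σ (tl e)     = right (eval σ e)

cost : ∀ {m} → Expr m → ℕ
cost (var x)    = 1
cost nil        = 1
cost (cons e f) = 1 + cost e + cost f
cost (hd e)     = 1 + cost e
cost (tl e)     = 1 + cost e

-- σ ⊢ C ⇓ τ steps t :  started in σ, C halts in τ after exactly t steps.
-- In tests, nil is false and every other tree is true.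
infix 3 _⊢_⇓_steps_

data _⊢_⇓_steps_ {m : ℕ} (σ : Store m) : Cmd m → Store m → ℕ → Set where

  assign : ∀ {x e} →
           σ ⊢ x := e ⇓ σ [ x ]≔ eval σ e steps 1 + cost e

  seq : ∀ {C D τ υ s t} →
        σ ⊢ C ⇓ τ steps s →
        τ ⊢ D ⇓ υ steps t →
        σ ⊢ C ⨾ D ⇓ υ steps 1 + s + t

  if-true : ∀ {e C D τ t} →
            eval σ e ≢ nil →
            σ ⊢ C ⇓ τ steps t →
            σ ⊢ if e then C else D ⇓ τ steps 1 + cost e + t

  if-false : ∀ {e C D τ t} →
             eval σ e ≡ nil →
             σ ⊢ D ⇓ τ steps t →
             σ ⊢ if e then C else D ⇓ τ steps 1 + cost e + t

  while-true : ∀ {e C τ υ s t} →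
               eval σ e ≢ nil →
               σ ⊢ C ⇓ τ steps s →
               τ ⊢ while e loop C ⇓ υ steps t →
               σ ⊢ while e loop C ⇓ υ steps 1 + cost e + s + t

  while-false : ∀ {e C} →
                eval σ e ≡ nil →
                σ ⊢ while e loop C ⇓ σ steps 1 + cost e

-- The input is passed in variable 0, where the output is also returned; the
-- other variables are initially nil.
record Program : Set where
  field
    extraVars : ℕ
    body      : Cmd (suc extraVars)

Runs : Program → Tree → Tree → ℕ → Set
Runs p input output t =
  ∃[ τ ] ((input ∷ replicate extraVars nil) ⊢ body ⇓ output ∷ τ steps t)
  where open Program p

------------------------------------------------------------------------
-- Encodings

encodeBool : Bool → Tree
encodeBool false = nil
encodeBool true  = nil ∙ nil

encodeList : List Tree → Tree
encodeList []       = nil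
encodeList (t ∷ ts) = t ∙ encodeList ts

-- Unary numerals, as in Jones.  The running times of interest are bounded in
-- terms of numerical parameters, not of the size of this encoding.
encodeℕ : ℕ → Tree
encodeℕ zero    = nil
encodeℕ (suc n) = nil ∙ encodeℕ n

encodeℤ : ℤ → Tree
encodeℤ (+ n)    = encodeBool false ∙ encodeℕ n
encodeℤ -[1+ n ] = encodeBool true  ∙ encodeℕ n

encodeGraph : ∀ {n} → Graph (Fin n) → Tree
encodeGraph G =
  encodeList (tabulate λ u → encodeList (tabulate λ v → encodeBool (adj G u v)))

encodeSubset : ∀ {n} → Subset n → Tree
encodeSubset S = encodeList (map encodeBool (toList S))

encodeInput : ∀ {n} → Graph (Fin n) → Subset n → ℤ → Tree
encodeInput G S ℓ = encodeGraph G ∙ encodeSubset S ∙ encodeℤ ℓ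

------------------------------------------------------------------------

DecidesInTime : Program → Tree → Set → ℕ → Set
DecidesInTime p input A bound =
  ∃[ answer ] ∃[ t ]
    (Runs p input (encodeBool answer) t × Reflects A answer × t ≤ bound)

{-# OPTIONS --safe #-}
module Submission where

-- A shortest path P from a to b of eccentricity at most ℓ amounts to a labelling
-- of the vertices by numbers up to ℓ (the distances to P) with the following
-- properties.  Every vertex v ≠ a is supported by a neighbour u: either the label
-- of u is smaller, or both are labelled 0 and u is nearer to a.  Both a and b are
-- labelled 0, and at most d(a,b) vertices other than a are.  Following supports
-- from b back to a gives a shortest path, which the last condition forces to
-- contain all vertices labelled 0.
--
-- Support is local.  So, once a, b and the labels on S are guessed, the labels on
-- the forest G − S are found by eliminating leaves: the state of a vertex consists
-- of its label, whether it is supported, which vertices of S are supported by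
-- eliminated vertices, and the number of zeros among these, and the table of a leaf
-- is merged into the table of its only remaining neighbour.  There are n²(ℓ+1)^k
-- guesses, and the tables have 2^k n^O(1) states.
--
-- The algorithm is a term of a typed functional language compiled to WHILE.  The
-- types bound sizes by Q^q M^e, where Q = (ℓ+1)^k and M = 2^k 2n, and the running
-- time of a term has a bound of the same form whose exponents are computed from
-- the term.  For the algorithm, q = 1.

open import Data.Bool using (Bool; true; false; T; T?; _∧_) renaming (if_then_else_ to choice)
open import Data.Empty using (⊥; ⊥-elim)
open import Data.Fin using (Fin; zero; suc; toℕ; fromℕ<) renaming (_≟_ to _≟ᶠ_)
open import Data.Fin.Properties using (any?; toℕ<n; toℕ-fromℕ<; toℕ-injective)
open import Data.Fin.Subset using (Subset; ∣_∣; ∁; inside; outside) renaming (_∈_ to _∈ₛ_)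
open import Data.Fin.Subset.Properties using (x∉p⇒x∈∁p)
open import Data.Integer as ℤ using (ℤ; 1ℤ; -[1+_]) renaming (_≤_ to _≤ᶻ_; _⊔_ to _⊔ᶻ_; ∣_∣ to abs)
open import Data.List using (List; []; _∷_; [_]; _++_; length; map; filter; tabulate; downFrom; replicate; foldl; concatMap; _ʳ++_)
open import Data.List.Membership.Propositional using (_∈_; find; lose)
open import Data.List.Membership.Propositional.Properties using (∈-∃++; ∈-++⁺ˡ; ∈-++⁺ʳ; ∈-++⁻; ∈-map⁺; ∈-map⁻; ∈-filter⁺; ∈-filter⁻; ∈-allFin; ∈-downFrom⁺; ∈-downFrom⁻; ∈-upTo⁺)
import Data.List.Membership.DecPropositional as DecMembership
open import Data.List.Properties using (++-identityʳ; length-++; length-ʳ++; length-map; length-replicate; length-tabulate; length-downFrom; length-upTo; map-tabulate; tabulate-cong)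
open import Data.List.Relation.Binary.Permutation.Propositional using (_↭_; prep; swap; ↭-sym; ↭-trans) renaming (refl to ↭-id; trans to ↭-comp)
open import Data.List.Relation.Binary.Permutation.Propositional.Properties using (∈-resp-↭; shift; ↭-length; All-resp-↭) renaming (map⁺ to ↭-map⁺; ++⁺ˡ to ↭-++⁺ˡ)
open import Data.List.Relation.Binary.Subset.Propositional using (_⊆_)
open import Data.List.Relation.Unary.All as All using (All; []; _∷_)
import Data.List.Relation.Unary.All.Properties as All
open import Data.List.Relation.Unary.AllPairs as AllPairs using ([]; _∷_)
open import Data.List.Relation.Unary.Any as Any using (here; there)
open import Data.List.Relation.Unary.Unique.Propositional using (Unique)
import Data.List.Relation.Unary.Unique.Propositional.Properties as Unique
open import Data.Maybe using (Maybe; just; nothing)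
open import Data.Nat using (ℕ; zero; suc; pred; _+_; _*_; _∸_; _^_; _⊔_; _≤_; _<_; _<ᵇ_; z≤n; s≤s; _≟_; _<?_; NonZero; >-nonZero; >-nonZero⁻¹)
open import Data.Nat.Induction using (<-rec)
open import Data.Nat.ListAction using (sum)
open import Data.Nat.ListAction.Properties using (sum-↭)
open import Data.Nat.Logarithm using (⌈log₂_⌉; ⌈log₂⌉-mono-≤)
open import Data.Nat.Properties hiding (_≟_; _<?_)
open import Data.Nat.Tactic.RingSolver using (solve-∀)
open import Data.Product using (∃; ∃-syntax; _×_; _,_; proj₁; proj₂)
open import Data.Sum using (_⊎_; inj₁; inj₂)
open import Data.Unit using (⊤; tt)
open import Data.Vec using ([]; _∷_; lookup; toList; _[_]≔_)
open import Data.Vec.Properties using ([]=⇒lookup)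
open import Data.Vec.Properties.WithK using ([]=-irrelevant)
open import Function using (_⇔_; mk⇔; Equivalence; _∘_)
open import Relation.Binary.Construct.Closure.ReflexiveTransitive using (ε; _◅_; _◅◅_)
open import Relation.Binary.Definitions using (DecidableEquality)
open import Relation.Binary.PropositionalEquality using (_≡_; _≢_; refl; sym; trans; cong; cong₂; subst)
open import Relation.Nullary using (¬_; Dec; yes; no; does; proof; Reflects; ofʸ; ofⁿ; _because_)
open import Relation.Nullary.Decidable using (_×-dec_; _⊎-dec_; ¬?; map′)
open import Relation.Nullary.Reflects using (T-reflects)
open import Defs renaming (length to lengthᴾ; vertices to verticesᴾ)

open Equivalence using (to; from)

-- Walks and distances

-- The factor ℓ^k tolerates no constant in its exponent, while powers of 2^k and of n are absorbed,
-- as k ≤ 1 + k log k. So bounds carry two exponents, and that of `Q` has to stay 1: guesses are the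
-- only objects counted by `Q`, and no loop over them is nested in another. Labels are also kept
-- below n, which frees the tables from ℓ. Tables are selected from one fixed universe of states
-- instead of being built from pairs of states. Merging therefore never enlarges them, and their
-- bound comes from typing alone. Support by itself cannot keep the zeros on one path: they could
-- form a whole tree of shortest paths from `a`. A shortest path from `a` to `b` already has d(a,b)
-- zeros besides `a`, so the bound on their number leaves no room for another. Labels are only upper
-- bounds of distances: a positive label always has a smaller one next to it, down to a zero.

unique⇒length≤ : ∀ {A : Set} {xs ys : List A} → Unique xs → xs ⊆ ys → length xs ≤ length ys
unique⇒length≤ [] s = z≤n
unique⇒length≤ {xs = x ∷ xs} (n ∷ u) s with ∈-∃++ (s (here refl))
... | as , bs , refl = begin
  suc (length xs)           ≤⟨ s≤s (unique⇒length≤ u avoid) ⟩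
  suc (length (as ++ bs))   ≡⟨ cong suc (length-++ as) ⟩
  suc (length as + length bs) ≡⟨ sym (+-suc (length as) (length bs)) ⟩
  length as + length (x ∷ bs) ≡⟨ sym (length-++ as) ⟩
  length (as ++ x ∷ bs)     ∎
  where
  open ≤-Reasoning
  avoid : xs ⊆ as ++ bs
  avoid i with ∈-++⁻ as (s (there i))
  ... | inj₁ j            = ∈-++⁺ˡ j
  ... | inj₂ (there j)    = ∈-++⁺ʳ as j
  ... | inj₂ (here refl)  = ⊥-elim (All.lookup n i refl)

module _ {V : Set} {G : Graph V} where

  vs : ∀ {u w} → Walk G u w → List V
  vs = walkVertices {G = G}

  len : ∀ {u w} → Walk G u w → ℕ
  len = walkLength {G = G}

  followers : ∀ {u w} → Walk G u w → List V
  followers ε       = []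
  followers (_ ◅ p) = vs p

  vs-followers : ∀ {u w} (p : Walk G u w) → vs p ≡ u ∷ followers p
  vs-followers ε       = refl
  vs-followers (_ ◅ p) = refl

  length-vs : ∀ {u w} (p : Walk G u w) → length (vs p) ≡ suc (len p)
  length-vs ε       = refl
  length-vs (_ ◅ p) = cong suc (length-vs p)

  length-followers : ∀ {u w} (p : Walk G u w) → length (followers p) ≡ len p
  length-followers ε       = refl
  length-followers (_ ◅ p) = length-vs p

  start∈vs : ∀ {u w} (p : Walk G u w) → u ∈ vs p
  start∈vs ε       = here refl
  start∈vs (_ ◅ p) = here refl

  len-◅◅ : ∀ {u v w} (p : Walk G u v) (q : Walk G v w) → len (p ◅◅ q) ≡ len p + len q
  len-◅◅ ε       q = refl
  len-◅◅ (_ ◅ p) q = cong suc (len-◅◅ p q)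

  Adj-sym : ∀ {u v} → Adj G u v → Adj G v u
  Adj-sym {u} {v} = subst T (adj-sym G u v)

  Adj-irrefl : ∀ {u} → ¬ Adj G u u
  Adj-irrefl {u} = subst T (loopless G u)

  suffix : ∀ {u v w} (p : Walk G u w) → v ∈ vs p → Unique (vs p) →
           ∃[ q ] (len {v} {w} q ≤ len p × vs q ⊆ vs p × Unique (vs q))
  suffix ε         (here refl) u       = ε , z≤n , (λ i → i) , u
  suffix p@(_ ◅ _) (here refl) u       = p , ≤-refl , (λ i → i) , u
  suffix (e ◅ p)   (there i)   (_ ∷ u) =
    let (q , l , s , u′) = suffix p i u in q , m≤n⇒m≤1+n l , there ∘ s , u′

  prefix : ∀ {u v w} (p : Walk G u w) → v ∈ vs p → Unique (vs p) →
           ∃[ q ] (vs {u} {v} q ⊆ vs p × Unique (vs q))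
  prefix ε       (here refl) u       = ε , (λ i → i) , u
  prefix (_ ◅ p) (here refl) u       = ε , (λ { (here eq) → here eq }) , [] ∷ []
  prefix (e ◅ p) (there i)   (n ∷ u) =
    let (q , s , u′) = prefix p i u
    in e ◅ q , (λ { (here eq) → here eq ; (there j) → there (s j) }) ,
       All.tabulate (λ j → All.lookup n (s j)) ∷ u′

  module _ (_≟ⱽ_ : DecidableEquality V) where

    open DecMembership _≟ⱽ_ using (_∈?_)

    -- Loop erasure from the end: if `u` already lies on the path obtained from the rest, that path
    -- is restarted at `u`. Walks can be concatenated, but `Dist` ranges over paths.
    shortcut : ∀ {u w} (p : Walk G u w) →
               ∃[ P ] (lengthᴾ {G = G} {u} {w} P ≤ len p × verticesᴾ P ⊆ vs p)
    shortcut ε = record { walk = ε ; simple = [] ∷ [] } , z≤n , λ i → i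
    shortcut {u} (e ◅ p) with shortcut p
    ... | P , l , s with u ∈? verticesᴾ P
    ...   | yes i = let (q , l′ , s′ , u′) = suffix (walk P) i (simple P)
                    in record { walk = q ; simple = u′ } , m≤n⇒m≤1+n (≤-trans l′ l) ,
                       λ j → there (s (s′ j))
    ...   | no ¬i = record { walk = e ◅ walk P ; simple = All.¬Any⇒All¬ _ ¬i ∷ simple P } , s≤s l ,
                    λ { (here eq) → here eq ; (there j) → there (s j) }

    -- A longest path among such vertices can only be continued into a cycle.
    minDegree2⇒cycle : ∀ {bound} → (∀ {xs : List V} → Unique xs → length xs ≤ bound) →
      (P : V → Set) → ∃ P →
      (∀ {v} → P v → ∃[ u ] ∃[ w ] (u ≢ w × P u × P w × Adj G u v × Adj G w v)) →
      Cycle G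
    minDegree2⇒cycle {bound} small P (_ , Pv) twoNeighbours =
      grow (suc bound) Pv ε ([] ∷ []) (m≤m+n (suc bound) 1)
      where
      -- Fuel and length of the path together exceed `bound`, so running out of fuel contradicts
      -- `small`.
      grow : ∀ fuel {v z} → P v → (p : Walk G v z) → Unique (vs p) →
             suc bound ≤ fuel + length (vs p) → Cycle G

      continue : ∀ fuel {u v z} → P u → Adj G u v → (p : Walk G v z) → Unique (vs p) →
                 suc bound ≤ suc fuel + length (vs p) → (u ∈ vs p → Cycle G) → Cycle G
      continue fuel {u} Pu e p uniq b close with u ∈? vs p
      ... | yes i = close i
      ... | no ¬i = grow fuel Pu (e ◅ p) (All.¬Any⇒All¬ _ ¬i ∷ uniq)
                      (≤-trans b (≤-reflexive (sym (+-suc fuel _))))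

      closeWith : ∀ {u v y z} → Adj G u v → (e : Adj G v y) (q : Walk G y z) → u ≢ y →
                  Unique (vs (e ◅ q)) → u ∈ vs (e ◅ q) → Cycle G
      closeWith e′ e q u≢y uniq       (here refl) = ⊥-elim (Adj-irrefl e′)
      closeWith e′ e q u≢y (n ∷ uniq) (there i) with prefix q i uniq
      -- Since `u` differs from `y`, the prefix has an edge; together with `e` these are the two
      -- edges that `long` asks for.
      ... | ε , _ , _ = ⊥-elim (u≢y refl)
      ... | q′@(_ ◅ _) , s , uniq′ = record
        { path    = record { walk   = e ◅ q′
                           ; simple = All.tabulate (λ j → All.lookup n (s j)) ∷ uniq′ }
        ; long    = s≤s (s≤s z≤n)
        ; closing = e′ }

      closeTrivially : ∀ {u v} → Adj G u v → u ∈ v ∷ [] → Cycle G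
      closeTrivially e (here refl) = ⊥-elim (Adj-irrefl e)

      grow zero       Pv p uniq b = ⊥-elim (<-irrefl refl (≤-trans b (small uniq)))
      grow (suc fuel) Pv ε uniq b =
        let (u , _ , _ , Pu , _ , e , _) = twoNeighbours Pv
        in continue fuel Pu e ε uniq b (closeTrivially e)
      grow (suc fuel) Pv p@(_◅_ {j = y} e q) uniq b with twoNeighbours Pv
      -- At most one of two distinct neighbours is the next vertex `y` of the path; the other one
      -- extends the path or closes a cycle.
      ... | u , w , u≢w , Pu , Pw , eu , ew with u ≟ⱽ y
      ...   | no u≢y   = continue fuel Pu eu p uniq b (closeWith eu e q u≢y uniq)
      ...   | yes refl = continue fuel Pw ew p uniq b (closeWith ew e q (u≢w ∘ sym) uniq)

  -- The exact splitting of the length is what later makes `u` strictly nearer to `a` than `v` on a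
  -- shortest path.
  predecessor : ∀ {a b v} (p : Walk G a b) → v ∈ vs p → v ≢ a →
                ∃[ u ] (u ∈ vs p × Adj G u v ×
                  ∃[ q ] ∃[ r ] (len {a} {u} q + suc (len {v} {b} r) ≡ len p))
  predecessor ε       (here refl) v≢a = ⊥-elim (v≢a refl)
  predecessor (_ ◅ _) (here refl) v≢a = ⊥-elim (v≢a refl)
  predecessor (e ◅ p) (there i)   v≢a = go e p i
    where
    go : ∀ {a y b v} (e : Adj G a y) (p : Walk G y b) → v ∈ vs p →
         ∃[ u ] (u ∈ a ∷ vs p × Adj G u v ×
           ∃[ q ] ∃[ r ] (len {a} {u} q + suc (len {v} {b} r) ≡ suc (len p)))
    go e ε         (here refl) = _ , here refl , e , ε , ε , refl
    go e p@(_ ◅ _) (here refl) = _ , here refl , e , ε , p , refl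
    go e (e′ ◅ p)  (there i)   =
      let (u , j , e″ , q , r , l) = go e′ p i in u , there j , e″ , e ◅ q , r , cong suc l

  All-◅◅ : ∀ {P : V → Set} {u v w} (p : Walk G u v) {q : Walk G v w} →
           All P (vs p) → All P (vs q) → All P (vs (p ◅◅ q))
  All-◅◅ ε       _        ys = ys
  All-◅◅ (_ ◅ p) (x ∷ xs) ys = x ∷ All-◅◅ p xs ys

least : ∀ {P : ℕ → Set} → (∀ n → Dec (P n)) → ∀ n → P n → ∃[ m ] IsMin P m
least {P} P? = <-rec (λ n → P n → ∃[ m ] IsMin P m) λ n rec p → search n rec p
  where
  search : ∀ n → (∀ {m} → m < n → P m → ∃[ m ] IsMin P m) → P n → ∃[ m ] IsMin P m
  search n rec p with anyUpTo? P? n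
  ... | yes (m , m<n , q) = rec m<n q
  ... | no none = n , p , λ {j} q → ≮⇒≥ λ j<n → none (j , j<n , q)

argmin : ∀ {A : Set} (f : A → ℕ) x xs → ∃[ y ] (y ∈ x ∷ xs × (∀ {z} → z ∈ x ∷ xs → f y ≤ f z))
argmin f x [] = x , here refl , λ { (here refl) → ≤-refl }
argmin f x (y ∷ ys) with argmin f y ys
... | z , i , m with ≤-total (f x) (f z)
...   | inj₁ p = x , here refl , λ { (here refl) → ≤-refl ; (there j) → ≤-trans p (m j) }
...   | inj₂ p = z , there i , λ { (here refl) → p ; (there j) → m j }

module Distances {n} (G : Graph (Fin n)) (connected : Connected G) where

  unique-length : ∀ {xs : List (Fin n)} → Unique xs → length xs ≤ n
  unique-length u = ≤-trans (unique⇒length≤ u (λ {x} _ → ∈-allFin x)) (≤-reflexive (length-tabulate (λ i → i)))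

  -- Walks of bounded length are decidable by recursion on the bound, which yields a least length
  -- constructively; `shortcut` then turns it into the distance over paths.
  Reach : Fin n → ℕ → Fin n → Set
  Reach u t w = ∃[ p ] (len {G = G} {u} {w} p ≤ t)

  reach? : ∀ u t w → Dec (Reach u t w)
  reach? u zero w = map′ (λ { refl → ε , z≤n }) (λ { (ε , _) → refl }) (u ≟ᶠ w)
  reach? u (suc t) w = map′
    (λ { (inj₁ refl) → ε , z≤n ; (inj₂ (v , e , p , l)) → e ◅ p , s≤s l })
    (λ { (ε , _) → inj₁ refl ; (e ◅ p , s≤s l) → inj₂ (_ , e , p , l) })
    (u ≟ᶠ w ⊎-dec any? λ v → T? (adj G u v) ×-dec reach? v t w)

  private
    nearest : ∀ u w → ∃[ m ] IsMin (λ t → Reach u t w) m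
    nearest u w = least (λ t → reach? u t w) _ (walk (connected u w) , ≤-refl)

  dist : Fin n → Fin n → ℕ
  dist u w = proj₁ (nearest u w)

  dist≤ : ∀ {u w} (p : Walk G u w) → dist u w ≤ len p
  dist≤ {u} {w} p = proj₂ (proj₂ (nearest u w)) (p , ≤-refl)

  geodesic : ∀ u w → ∃[ P ] (lengthᴾ {G = G} {u} {w} P ≡ dist u w)
  geodesic u w =
    let (p , l)      = proj₁ (proj₂ (nearest u w))
        (P , l′ , _) = shortcut _≟ᶠ_ p
    in P , ≤-antisym (≤-trans l′ l) (dist≤ (walk P))

  Dist-dist : ∀ {u w} → Dist G u w (dist u w)
  Dist-dist {u} {w} = geodesic u w , λ { (P , refl) → dist≤ (walk P) }

  Dist-unique : ∀ {u w d} → Dist G u w d → d ≡ dist u w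
  Dist-unique ((P , refl) , m) = ≤-antisym (m (geodesic _ _)) (dist≤ (walk P))

  dist<n : ∀ u w → dist u w < n
  dist<n u w = let (P , eq) = geodesic u w in
    ≤-trans (s≤s (≤-reflexive (sym eq)))
      (≤-trans (≤-reflexive (sym (length-vs (walk P)))) (unique-length (simple P)))

  dist-refl : ∀ u → dist u u ≡ 0
  dist-refl u = n≤0⇒n≡0 (dist≤ ε)

  dist≡0 : ∀ {u w} → dist u w ≡ 0 → u ≡ w
  dist≡0 {u} {w} eq with geodesic u w
  ... | record { walk = ε } , _ = refl
  ... | record { walk = _ ◅ _ } , eq′ with trans eq′ eq
  ...   | ()

  -- `label<n` holds for distances and keeps the number of labels polynomial in n however large ℓ
  -- is. `budget` bounds a cardinality, expressed through duplicate-free lists.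
  record Labelling (ℓ : ℕ) (a b : Fin n) : Set where
    field
      label    : Fin n → ℕ
      label≤ℓ  : ∀ v → label v ≤ ℓ
      label<n  : ∀ v → label v < n
      label-a  : label a ≡ 0
      label-b  : label b ≡ 0
      support  : ∀ v → v ≢ a → ∃[ u ] (Adj G u v ×
                 (label u < label v ⊎ label u ≡ 0 × label v ≡ 0 × dist a u < dist a v))
      budget   : ∀ {xs} → Unique xs → All (λ v → label v ≡ 0 × v ≢ a) xs → length xs ≤ dist a b

  +≤⇔ : ∀ {m k} → (ℤ.+ m) ≤ᶻ (ℤ.+ k) ⇔ m ≤ k
  +≤⇔ = mk⇔ (λ { (ℤ.+≤+ p) → p }) ℤ.+≤+

  -- A zero is supported by its predecessor on `P`, any other vertex by the next vertex on the way
  -- to the nearest vertex of `P`. The zeros other than `a` are among the followers of `a` on `P`,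
  -- of which there are d(a,b).
  labelling : ∀ {ℓ} → HasEccentricityShortestPath G (ℤ.+ ℓ) → ∃[ a ] ∃[ b ] Labelling ℓ a b
  labelling {ℓ} (a , b , P , shortest , cover) = a , b , record
    { label   = f
    ; label≤ℓ = λ v → Equivalence.to +≤⇔ (proj₂ (proj₂ (cover v)))
    ; label<n = λ v → let (w , _ , D) = nearestOn v in
                      subst (_< n) (sym (Dist-unique D)) (dist<n v w)
    ; label-a = zeroOn (start∈vs (walk P))
    ; label-b = zeroOn (end∈vs (walk P))
    ; support = support
    ; budget  = λ {xs} u zs → ≤-trans (unique⇒length≤ u (λ i → follower (All.lookup zs i)))
        (≤-reflexive (trans (length-followers (walk P)) (Dist-unique shortest)))
    }
    where
    f : Fin n → ℕ
    f v = proj₁ (cover v)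
    nearestOn : ∀ v → ∃[ w ] (w ∈ verticesᴾ P × Dist G v w (f v))
    nearestOn v = proj₁ (proj₁ (proj₂ (cover v)))
    f≤ : ∀ {v w} → w ∈ verticesᴾ P → f v ≤ dist v w
    f≤ {v} {w} i = proj₂ (proj₁ (proj₂ (cover v))) (w , i , Dist-dist)
    zeroOn : ∀ {v} → v ∈ verticesᴾ P → f v ≡ 0
    zeroOn i = n≤0⇒n≡0 (≤-trans (f≤ i) (≤-reflexive (dist-refl _)))
    end∈vs : ∀ {u w} (p : Walk G u w) → w ∈ walkVertices {G = G} p
    end∈vs ε       = here refl
    end∈vs (_ ◅ p) = there (end∈vs p)
    onPath : ∀ {v} → f v ≡ 0 → v ∈ verticesᴾ P
    onPath {v} eq = let (w , i , D) = nearestOn v in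
      subst (_∈ verticesᴾ P) (sym (dist≡0 (trans (sym (Dist-unique D)) eq))) i
    follower : ∀ {v} → f v ≡ 0 × v ≢ a → v ∈ followers (walk P)
    follower (eq , v≢a) with subst (_ ∈_) (vs-followers (walk P)) (onPath eq)
    ... | here refl = ⊥-elim (v≢a refl)
    ... | there i   = i
    support : ∀ v → v ≢ a → ∃[ u ] (Adj G u v ×
              (f u < f v ⊎ f u ≡ 0 × f v ≡ 0 × dist a u < dist a v))
    support v v≢a with f v in eq
    ... | zero =
      -- `P` is shortest, so going to `v` along any path and continuing with `r` is no shorter;
      -- cancelling `r` compares `u` with `v`.
      let (u , i , e , q , r , l) = predecessor (walk P) (onPath eq) v≢a
          (Q , lQ)                = geodesic a v
      in u , e , inj₂ (zeroOn i , refl , +-cancelʳ-< (len {G = G} r) _ _ (begin-strict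
           dist a u + len {G = G} r        ≤⟨ +-monoˡ-≤ _ (dist≤ q) ⟩
           len {G = G} q + len {G = G} r   <⟨ +-monoʳ-< (len {G = G} q) ≤-refl ⟩
           len {G = G} q + suc (len {G = G} r) ≡⟨ l ⟩
           lengthᴾ P                       ≡⟨ Dist-unique shortest ⟩
           dist a b                        ≤⟨ dist≤ (walk Q ◅◅ r) ⟩
           len {G = G} (walk Q ◅◅ r)       ≡⟨ len-◅◅ (walk Q) r ⟩
           lengthᴾ Q + len {G = G} r       ≡⟨ cong (_+ len {G = G} r) lQ ⟩
           dist a v + len {G = G} r        ∎))
      where open ≤-Reasoning
    ... | suc m with nearestOn v
    ...   | w , i , D with geodesic v w
    ...     | record { walk = ε } , l = ⊥-elim (0≢1+n (trans l (trans (sym (Dist-unique D)) eq)))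
    ...     | record { walk = e ◅ p } , l = _ , Adj-sym {G = G} e , inj₁ (≤-trans (s≤s (≤-trans (f≤ i) (dist≤ p)))
                (≤-reflexive (trans l (trans (sym (Dist-unique D)) eq))))

  module _ {ℓ a b} (L : Labelling ℓ a b) where

    open Labelling L

    private
      Zero : Fin n → Set
      Zero v = label v ≡ 0

      -- Supports of zeros are zeros nearer to a.
      zeroWalk : ∀ m v → dist a v ≡ m → Zero v →
                 ∃[ p ] (len {G = G} {a} {v} p ≤ dist a v × All Zero (vs {G = G} p))
      zeroWalk = <-rec _ λ m rec v eq z → step rec eq z
        where
        step : ∀ {m v} → (∀ {k} → k < m → ∀ v → dist a v ≡ k → Zero v →
                 ∃[ p ] (len {G = G} {a} {v} p ≤ dist a v × All Zero (vs {G = G} p))) →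
               dist a v ≡ m → Zero v → ∃[ p ] (len {G = G} {a} {v} p ≤ dist a v × All Zero (vs {G = G} p))
        step {m} {v} rec eq z with v ≟ᶠ a
        ... | yes refl = ε , z≤n , z ∷ []
        ... | no v≢a with support v v≢a
        ...   | u , e , inj₁ l = ⊥-elim (n≮0 (subst (label u <_) z l))
        ...   | u , e , inj₂ (zu , _ , l) =
          let (p , lp , zs) = rec (subst (dist a u <_) eq l) u refl zu
          in p ◅◅ e ◅ ε ,
             ≤-trans (≤-reflexive (trans (len-◅◅ p (e ◅ ε)) (+-comm _ 1))) (≤-trans (s≤s lp) l) ,
             All-◅◅ p zs (zu ∷ z ∷ [])

      -- Every step goes to a smaller label, so there are at most `label v` of them. It stops at `a`
      -- or at a vertex whose support is of the second kind, and both are zeros.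
      toZero : ∀ m v → label v ≡ m → ∃[ w ] ∃[ p ] (Zero w × len {G = G} {v} {w} p ≤ label v)
      toZero = <-rec _ λ m rec v eq → step rec eq
        where
        step : ∀ {m v} → (∀ {k} → k < m → ∀ v → label v ≡ k →
                 ∃[ w ] ∃[ p ] (Zero w × len {G = G} {v} {w} p ≤ label v)) →
               label v ≡ m → ∃[ w ] ∃[ p ] (Zero w × len {G = G} {v} {w} p ≤ label v)
        step {m} {v} rec eq with v ≟ᶠ a
        ... | yes refl = v , ε , label-a , z≤n
        ... | no v≢a with support v v≢a
        ...   | u , e , inj₂ (_ , z , _) = v , ε , z , z≤n
        ...   | u , e , inj₁ l =
          let (w , p , z , lp) = rec (subst (label u <_) eq l) u refl
          in w , Adj-sym {G = G} e ◅ p , z , ≤-trans (s≤s lp) l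

    hasEccentricityShortestPath : HasEccentricityShortestPath G (ℤ.+ ℓ)
    hasEccentricityShortestPath =
      let (p , lp , zs)   = zeroWalk _ b refl label-b
          (P , lP , P⊆p)  = shortcut _≟ᶠ_ p
          lP′             = ≤-trans lP lp
      in a , b , P ,
         subst (Dist G a b) (≤-antisym (dist≤ (walk P)) lP′) Dist-dist ,
         covered P lP′ (λ i → All.lookup zs (P⊆p i))
      where
      open DecMembership _≟ᶠ_ using (_∈?_)
      covered : (P : Path G a b) → lengthᴾ P ≤ dist a b → (∀ {v} → v ∈ verticesᴾ P → Zero v) →
                ∀ v → ∃[ d ] (DistToPath G v P d × ℤ.+ d ≤ᶻ ℤ.+ ℓ)
      covered P lP zs v =
        let (x , xs , eq)  = nonempty (walk P)
            (w , i , min)  = argmin (dist v) x xs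
            (z , p , z0 , l) = toZero _ v refl
        in dist v w ,
           ((w , subst (w ∈_) (sym eq) i , Dist-dist) ,
            λ { (w′ , i′ , D) → subst (dist v w ≤_) (sym (Dist-unique D)) (min (subst (w′ ∈_) eq i′)) }) ,
           Equivalence.from +≤⇔ (≤-trans (min (subst (z ∈_) eq (onPath z0)))
             (≤-trans (dist≤ p) (≤-trans l (label≤ℓ v))))
        where
        nonempty : ∀ {u w} (p : Walk G u w) → ∃[ x ] ∃[ xs ] (vs {G = G} p ≡ x ∷ xs)
        nonempty p = _ , followers p , vs-followers p
        -- A zero off P would exceed the budget together with the followers of a on P.
        onPath : ∀ {z} → Zero z → z ∈ verticesᴾ P
        onPath {z} z0 with z ∈? verticesᴾ P
        ... | yes i = i
        ... | no ¬i with subst Unique (vs-followers (walk P)) (simple P)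
        ...   | a∉ ∷ uniq = ⊥-elim (<-irrefl refl (begin-strict
                dist a b                         ≤⟨ dist≤ (walk P) ⟩
                lengthᴾ P                        ≡⟨ sym (length-followers (walk P)) ⟩
                length (followers (walk P))      <⟨ budget (All.¬Any⇒All¬ _ (¬i ∘ follower) ∷ uniq)
                  ((z0 , λ { refl → ¬i (start∈vs (walk P)) }) ∷
                   All.tabulate (λ i → zs (follower i) , λ { refl → All.lookup a∉ i refl })) ⟩
                dist a b                         ∎))
          where
          open ≤-Reasoning
          follower : ∀ {v} → v ∈ followers (walk P) → v ∈ verticesᴾ P
          follower i = subst (_ ∈_) (sym (vs-followers (walk P))) (there i)

-- A typed functional language with size bounds

data Shape : Set where
  bool nat : Shape
  list     : Shape → Shape
  pair     : Shape → Shape → Shape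

⟦_⟧ : Shape → Set
⟦ bool ⟧     = Bool
⟦ nat ⟧      = ℕ
⟦ list s ⟧   = List ⟦ s ⟧
⟦ pair s t ⟧ = ⟦ s ⟧ × ⟦ t ⟧

encode : ∀ s → ⟦ s ⟧ → Tree
encode bool       b       = encodeBool b
encode nat        n       = encodeℕ n
encode (list s)   xs      = encodeList (map (encode s) xs)
encode (pair s t) (x , y) = encode s x ∙ encode t y

-- The degree (q , e) stands for the bound Q^q M^e.
Degree : Set
Degree = ℕ × ℕ

-- The sizes are bounds of numbers and of lengths; `nothing` is no bound.
data Ty : Shape → Set where
  bool : Ty bool
  nat  : Maybe Degree → Ty nat
  list : ∀ {s} → Maybe Degree → Ty s → Ty (list s)
  pair : ∀ {s t} → Ty s → Ty t → Ty (pair s t)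

infixr 5 _▸_

data Ctx : Set where
  ∅   : Ctx
  _▸_ : ∀ {s} → Ty s → Ctx → Ctx

infixr 5 _∷_

data Env : Ctx → Set where
  []  : Env ∅
  _∷_ : ∀ {s Γ} {τ : Ty s} → ⟦ s ⟧ → Env Γ → Env (τ ▸ Γ)

infix 4 _∋_

data _∋_ : Ctx → ∀ {s} → Ty s → Set where
  here  : ∀ {s Γ} {τ : Ty s} → τ ▸ Γ ∋ τ
  there : ∀ {s t Γ} {τ : Ty s} {σ : Ty t} → Γ ∋ τ → σ ▸ Γ ∋ τ

lookupVar : ∀ {Γ s} {τ : Ty s} → Γ ∋ τ → Env Γ → ⟦ s ⟧
lookupVar here      (x ∷ γ) = x
lookupVar (there v) (x ∷ γ) = lookupVar v γ

infixl 7 _⊗_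

_⊗_ : Degree → Degree → Degree
(q , e) ⊗ (q′ , e′) = q + q′ , e + e′

mutual

  -- Only data of bounded size can be looped over.  Bounds that do not follow
  -- from the types are claimed by `assume`.
  data Tm (Γ : Ctx) : ∀ {s} → Ty s → Set where
    var       : ∀ {s} {τ : Ty s} → Γ ∋ τ → Tm Γ τ
    true      : Tm Γ bool
    false     : Tm Γ bool
    ifte      : ∀ {s} {τ : Ty s} → Tm Γ bool → Tm Γ τ → Tm Γ τ → Tm Γ τ
    zero      : ∀ {z} → Tm Γ (nat z)
    -- `suc` and `_∷_` forget the bound, as otherwise a loop could grow its accumulator under an
    -- unchanged type. Long lists of bounded length come from `collect`.
    suc       : ∀ {z} → Tm Γ (nat z) → Tm Γ (nat nothing)
    dec       : ∀ {z} → Tm Γ (nat z) → Tm Γ (nat z)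
    positive  : ∀ {z} → Tm Γ (nat z) → Tm Γ bool
    []        : ∀ {s z} {τ : Ty s} → Tm Γ (list z τ)
    single    : ∀ {s} {τ : Ty s} → Tm Γ τ → Tm Γ (list (just (0 , 0)) τ)
    _∷_       : ∀ {s z} {τ : Ty s} → Tm Γ τ → Tm Γ (list z τ) → Tm Γ (list nothing τ)
    uncons    : ∀ {s t z} {τ : Ty s} {σ : Ty t} →
                Tm Γ (list z τ) → Tm Γ σ → Tm (τ ▸ list z τ ▸ Γ) σ → Tm Γ σ
    pair      : ∀ {s t} {τ : Ty s} {σ : Ty t} → Tm Γ τ → Tm Γ σ → Tm Γ (pair τ σ)
    fst       : ∀ {s t} {τ : Ty s} {σ : Ty t} → Tm Γ (pair τ σ) → Tm Γ τ
    snd       : ∀ {s t} {τ : Ty s} {σ : Ty t} → Tm Γ (pair τ σ) → Tm Γ σ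
    bind      : ∀ {s t} {τ : Ty s} {σ : Ty t} → Tm Γ τ → Tm (τ ▸ Γ) σ → Tm Γ σ
    call      : ∀ {s Δ} {τ : Ty s} → Tm Δ τ → Args Γ Δ → Tm Γ τ
    fold      : ∀ {s t d} {τ : Ty s} {σ : Ty t} →
                Tm Γ (list (just d) τ) → Tm Γ σ → Tm (τ ▸ σ ▸ Γ) σ → Tm Γ σ
    iterate   : ∀ {t d} {σ : Ty t} → Tm Γ (nat (just d)) → Tm Γ σ → Tm (σ ▸ Γ) σ → Tm Γ σ
    collect   : ∀ {s t d d′} {τ : Ty s} {σ : Ty t} →
                Tm Γ (list (just d) τ) → Tm (τ ▸ Γ) (list (just d′) σ) →
                Tm Γ (list (just (d ⊗ d′)) σ)
    assume    : ∀ {s} {σ : Ty s} (τ : Ty s) → Tm Γ σ → Tm Γ τ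

  data Args (Γ : Ctx) : Ctx → Set where
    []  : Args Γ ∅
    _∷_ : ∀ {s Δ} {τ : Ty s} → Tm Γ τ → Args Γ Δ → Args Γ (τ ▸ Δ)

iter : {A : Set} → (A → A) → A → ℕ → A
iter f z zero    = z
iter f z (suc n) = iter f (f z) n

-- Each element is put in front of the earlier ones, so the order is reversed.
collected : {A B : Set} → (A → List B) → List A → List B
collected f = foldl (λ acc x → f x ʳ++ acc) []

caseList : ∀ {b} {A : Set} {B : Set b} → B → (A → List A → B) → List A → B
caseList z f []       = z
caseList z f (x ∷ xs) = f x xs

isPositive : ℕ → Bool
isPositive zero    = false
isPositive (suc _) = true

mutual

  eval# : ∀ {Γ s} {τ : Ty s} → Tm Γ τ → Env Γ → ⟦ s ⟧
  eval# (var v)          γ = lookupVar v γ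
  eval# true             γ = true
  eval# false            γ = false
  eval# (ifte c t u)     γ = choice (eval# c γ) (eval# t γ) (eval# u γ)
  eval# zero             γ = zero
  eval# (suc t)          γ = suc (eval# t γ)
  eval# (dec t)          γ = pred (eval# t γ)
  eval# (positive t)     γ = isPositive (eval# t γ)
  eval# []               γ = []
  eval# (single t)       γ = [ eval# t γ ]
  eval# (t ∷ u)          γ = eval# t γ ∷ eval# u γ
  eval# (uncons t z u)   γ = caseList (eval# z γ) (λ x xs → eval# u (x ∷ xs ∷ γ)) (eval# t γ)
  eval# (pair t u)       γ = eval# t γ , eval# u γ
  eval# (fst t)          γ = proj₁ (eval# t γ)
  eval# (snd t)          γ = proj₂ (eval# t γ)
  eval# (bind t u)       γ = eval# u (eval# t γ ∷ γ)
  eval# (call f as)      γ = eval# f (evalArgs as γ)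
  eval# (fold l z b)     γ = foldl (λ acc x → eval# b (x ∷ acc ∷ γ)) (eval# z γ) (eval# l γ)
  eval# (iterate n z b)  γ = iter (λ acc → eval# b (acc ∷ γ)) (eval# z γ) (eval# n γ)
  eval# (collect l b)    γ = collected (λ x → eval# b (x ∷ γ)) (eval# l γ)
  eval# (assume τ t)     γ = eval# t γ

  evalArgs : ∀ {Γ Δ} → Args Γ Δ → Env Γ → Env Δ
  evalArgs []       γ = []
  evalArgs (t ∷ as) γ = eval# t γ ∷ evalArgs as γ

-- Compilation

pattern environment = zero
pattern result      = suc zero
pattern stack       = suc (suc zero)

access : ∀ {Γ s} {τ : Ty s} → Γ ∋ τ → Expr 3 → Expr 3
access here      e = hd e
access (there v) e = access v (tl e)

push pop : Cmd 3
push = stack := cons (var result) (var stack)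
pop  = stack := tl (var stack)

return : Expr 3 → Cmd 3
return e = result := e

top : Expr 3
top = hd (var stack)

-- In the bodies of loops, the rest of the list takes the place of the
-- accumulator on top of the stack, and is exchanged with the new one.
exchange : Cmd 3
exchange =
  result := top ⨾
  stack := cons (hd (var environment)) (tl (var stack)) ⨾
  environment := tl (var environment)

-- Repeated until `result` is empty this computes `_ʳ++_`: the accumulator lies just below the rest
-- of the outer list, which stays on top of the stack.
transfer : Cmd 3
transfer =
  stack := cons top (cons (cons (hd (var result)) (hd (tl (var stack)))) (tl (tl (var stack)))) ⨾
  result := tl (var result)

mutual

  -- Calling convention: the code leaves the value in `result` and restores `environment` and
  -- `stack`, whatever `result` contained before.
  compile : ∀ {Γ s} {τ : Ty s} → Tm Γ τ → Cmd 3
  compile (var v)         = return (access v (var environment))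
  compile true            = return (cons nil nil)
  compile false           = return nil
  compile (ifte c t u)    = compile c ⨾ if var result then compile t else compile u
  compile zero            = return nil
  compile (suc t)         = compile t ⨾ return (cons nil (var result))
  compile (dec t)         = compile t ⨾ return (tl (var result))
  compile (positive t)    =
    compile t ⨾ if var result then return (cons nil nil) else return nil
  compile []              = return nil
  compile (single t)      = compile t ⨾ return (cons (var result) nil)
  compile (t ∷ u)         = compilePair t u
  compile (uncons t z u)  =
    compile t ⨾
    if var result
    then (environment := cons (hd (var result)) (cons (tl (var result)) (var environment)) ⨾
          compile u ⨾
          environment := tl (tl (var environment)))
    else compile z
  compile (pair t u)      = compilePair t u
  compile (fst t)         = compile t ⨾ return (hd (var result))
  compile (snd t)         = compile t ⨾ return (tl (var result))
  compile (bind t u)      =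
    compile t ⨾
    environment := cons (var result) (var environment) ⨾
    compile u ⨾
    environment := tl (var environment)
  compile (call f as)     =
    compileArgs as ⨾
    stack := cons (var environment) (var stack) ⨾
    environment := var result ⨾
    compile f ⨾
    environment := top ⨾
    pop
  compile (fold l z b)    =
    compile z ⨾ push ⨾ compile l ⨾
    while var result loop
      (environment := cons (hd (var result)) (cons top (var environment)) ⨾
       stack := cons (tl (var result)) (tl (var stack)) ⨾
       compile b ⨾
       environment := cons (var result) (tl (tl (var environment))) ⨾
       exchange) ⨾
    return top ⨾ pop
  compile (iterate n z b) =
    compile z ⨾ push ⨾ compile n ⨾
    while var result loop
      (environment := cons top (var environment) ⨾
       stack := cons (tl (var result)) (tl (var stack)) ⨾
       compile b ⨾
       environment := cons (var result) (tl (var environment)) ⨾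
       exchange) ⨾
    return top ⨾ pop
  compile (collect l b)   =
    stack := cons nil (var stack) ⨾ compile l ⨾
    while var result loop
      (environment := cons (hd (var result)) (var environment) ⨾
       stack := cons (tl (var result)) (var stack) ⨾
       compile b ⨾
       while var result loop transfer ⨾
       environment := tl (var environment) ⨾
       return top ⨾ pop) ⨾
    return top ⨾ pop
  compile (assume τ t)    = compile t

  compilePair : ∀ {Γ s t} {τ : Ty s} {σ : Ty t} → Tm Γ τ → Tm Γ σ → Cmd 3
  compilePair t u =
    compile t ⨾ push ⨾ compile u ⨾ return (cons top (var result)) ⨾ pop

  compileArgs : ∀ {Γ Δ} → Args Γ Δ → Cmd 3
  compileArgs []       = return nil
  compileArgs (t ∷ as) =
    compileArgs as ⨾ push ⨾ compile t ⨾ return (cons (var result) top) ⨾ pop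

-- Degrees of running times

infixr 4 _⟫_

_⊕_ : Degree → Degree → Degree
(q , e) ⊕ (q′ , e′) = q ⊔ q′ , 2 + (e ⊔ e′)

data Timing : Set where
  steps  : ℕ → Timing
  _⟫_    : Timing → Timing → Timing
  branch : Timing → Timing → Timing
  repeat : Degree → Timing → Timing

-- Numerical factors are absorbed into the exponent of `M`, using `M ≥ 2`: a constant c is at most
-- M^c, the 2 in `_⊕_` stands for a factor 4, and the 3 of a loop for a factor 8.
degreeOf : Timing → Degree
degreeOf (steps c)    = 0 , c
degreeOf (s ⟫ t)      = degreeOf s ⊕ degreeOf t
degreeOf (branch s t) = degreeOf s ⊕ degreeOf t
degreeOf (repeat d t) = d ⊗ degreeOf t ⊗ (0 , 3)

-- An assignment takes one step more than the cost of its expression; this is the origin of all the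
-- constants here and in `time`.
pushᵗ popᵗ exchangeᵗ transferᵗ : Timing
pushᵗ     = steps 4
popᵗ      = steps 3
exchangeᵗ = steps 3 ⟫ steps 6 ⟫ steps 3
transferᵗ = steps 14 ⟫ steps 3

mutual

  time : ∀ {Γ s} {τ : Ty s} → Tm Γ τ → Timing
  time (var v)         = steps (suc (cost (access v (var environment))))
  time true            = steps 4
  time false           = steps 2
  time (ifte c t u)    = time c ⟫ branch (time t) (time u)
  time zero            = steps 2
  time (suc t)         = time t ⟫ steps 4
  time (dec t)         = time t ⟫ steps 3
  time (positive t)    = time t ⟫ branch (steps 4) (steps 2)
  time []              = steps 2
  time (single t)      = time t ⟫ steps 4
  time (t ∷ u)         = timePair t u
  time (uncons t z u)  = time t ⟫ branch (steps 8 ⟫ time u ⟫ steps 4) (time z)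
  time (pair t u)      = timePair t u
  time (fst t)         = time t ⟫ steps 3
  time (snd t)         = time t ⟫ steps 3
  time (bind t u)      = time t ⟫ steps 4 ⟫ time u ⟫ steps 3
  time (call f as)     = timeArgs as ⟫ steps 4 ⟫ steps 2 ⟫ time f ⟫ steps 3 ⟫ popᵗ
  time (fold {d = d} l z b) =
    time z ⟫ pushᵗ ⟫ time l ⟫
    repeat d (steps 8 ⟫ steps 6 ⟫ time b ⟫ steps 6 ⟫ exchangeᵗ) ⟫
    steps 3 ⟫ popᵗ
  time (iterate {d = d} n z b) =
    time z ⟫ pushᵗ ⟫ time n ⟫
    repeat d (steps 5 ⟫ steps 6 ⟫ time b ⟫ steps 5 ⟫ exchangeᵗ) ⟫
    steps 3 ⟫ popᵗ
  time (collect {d = d} {d′} l b) =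
    steps 4 ⟫ time l ⟫
    repeat d (steps 5 ⟫ steps 5 ⟫ time b ⟫ repeat d′ transferᵗ ⟫
                  steps 3 ⟫ steps 3 ⟫ popᵗ) ⟫
    steps 3 ⟫ popᵗ
  time (assume τ t)    = time t

  timePair : ∀ {Γ s t} {τ : Ty s} {σ : Ty t} → Tm Γ τ → Tm Γ σ → Timing
  timePair t u = time t ⟫ pushᵗ ⟫ time u ⟫ steps 5 ⟫ popᵗ

  timeArgs : ∀ {Γ Δ} → Args Γ Δ → Timing
  timeArgs []       = steps 2
  timeArgs (t ∷ as) = timeArgs as ⟫ pushᵗ ⟫ time t ⟫ steps 5 ⟫ popᵗ

encodeEnv : ∀ {Γ} → Env Γ → Tree
encodeEnv []                = nil
encodeEnv (_∷_ {s = s} x γ) = encode s x ∙ encodeEnv γ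

mutual

  -- Absence of `assume`, decided by computation. Pure terms are valid in every environment, so that
  -- size claims have to be argued only for the few terms that make them.
  pure : ∀ {Γ s} {τ : Ty s} → Tm Γ τ → Bool
  pure (var v)         = true
  pure true            = true
  pure false           = true
  pure (ifte c t u)    = pure c ∧ pure t ∧ pure u
  pure zero            = true
  pure (suc t)         = pure t
  pure (dec t)         = pure t
  pure (positive t)    = pure t
  pure []              = true
  pure (single t)      = pure t
  pure (t ∷ u)         = pure t ∧ pure u
  pure (uncons t z u)  = pure t ∧ pure z ∧ pure u
  pure (pair t u)      = pure t ∧ pure u
  pure (fst t)         = pure t
  pure (snd t)         = pure t
  pure (bind t u)      = pure t ∧ pure u
  pure (call f as)     = pureArgs as ∧ pure f
  pure (fold l z b)    = pure l ∧ pure z ∧ pure b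
  pure (iterate n z b) = pure n ∧ pure z ∧ pure b
  pure (collect l b)   = pure l ∧ pure b
  pure (assume τ t)    = false

  pureArgs : ∀ {Γ Δ} → Args Γ Δ → Bool
  pureArgs []       = true
  pureArgs (t ∷ as) = pure t ∧ pureArgs as

both : ∀ {a b} → T (a ∧ b) → T a × T b
both {true} p = tt , p

module _ {A B : Set} (f : A → List B) where

  length-collect : ∀ {c} xs → All (λ x → length (f x) ≤ c) xs → ∀ acc →
                   length (foldl (λ acc x → f x ʳ++ acc) acc xs) ≤ length xs * c + length acc
  length-collect []       []       acc = ≤-refl
  length-collect {c} (x ∷ xs) (p ∷ ps) acc = begin
    length (foldl _ (f x ʳ++ acc) xs)       ≤⟨ length-collect xs ps (f x ʳ++ acc) ⟩
    length xs * c + length (f x ʳ++ acc)    ≡⟨ cong (length xs * c +_) (length-ʳ++ (f x)) ⟩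
    length xs * c + (length (f x) + length acc) ≡⟨ sym (+-assoc (length xs * c) _ _) ⟩
    length xs * c + length (f x) + length acc ≤⟨ +-monoˡ-≤ (length acc) (+-monoʳ-≤ (length xs * c) p) ⟩
    length xs * c + c + length acc          ≡⟨ cong (_+ length acc) (+-comm (length xs * c) c) ⟩
    c + length xs * c + length acc          ∎
    where open ≤-Reasoning

  All-collect : ∀ {P : B → Set} xs → All (λ x → All P (f x)) xs → ∀ {acc} → All P acc →
                All P (foldl (λ acc x → f x ʳ++ acc) acc xs)
  All-collect []       []       o = o
  All-collect {P} (x ∷ xs) (p ∷ ps) o = All-collect xs ps (append p o)
    where
    append : ∀ {ys acc} → All P ys → All P acc → All P (ys ʳ++ acc)
    append []       o = o
    append (p ∷ ps) o = append ps (p ∷ o)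

-- Soundness of size bounds and of time bounds

module Bounds (Q M : ℕ) (1≤Q : 1 ≤ Q) (2≤M : 2 ≤ M) where

  bound : Degree → ℕ
  bound (q , e) = Q ^ q * M ^ e

  infix 4 _≤ˢ_

  _≤ˢ_ : ℕ → Maybe Degree → Set
  n ≤ˢ nothing = ⊤
  n ≤ˢ just d  = n ≤ bound d

  Ok : ∀ {s} → Ty s → ⟦ s ⟧ → Set
  Ok bool       b       = ⊤
  Ok (nat z)    n       = n ≤ˢ z
  Ok (list z τ) xs      = length xs ≤ˢ z × All (Ok τ) xs
  Ok (pair τ σ) (x , y) = Ok τ x × Ok σ y

  OkEnv : ∀ {Γ} → Env Γ → Set
  OkEnv []                = ⊤
  OkEnv (_∷_ {τ = τ} x γ) = Ok τ x × OkEnv γ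

  -- The claims made by `assume` hold in the evaluation of a term.
  mutual

    Valid : ∀ {Γ s} {τ : Ty s} → Tm Γ τ → Env Γ → Set
    Valid (var v)         γ = ⊤
    Valid true            γ = ⊤
    Valid false           γ = ⊤
    Valid (ifte c t u)    γ = Valid c γ × choice (eval# c γ) (Valid t γ) (Valid u γ)
    Valid zero            γ = ⊤
    Valid (suc t)         γ = Valid t γ
    Valid (dec t)         γ = Valid t γ
    Valid (positive t)    γ = Valid t γ
    Valid []              γ = ⊤
    Valid (single t)      γ = Valid t γ
    Valid (t ∷ u)         γ = Valid t γ × Valid u γ
    Valid (uncons t z u)  γ =
      Valid t γ × Valid z γ × caseList ⊤ (λ x xs → Valid u (x ∷ xs ∷ γ)) (eval# t γ)
    Valid (pair t u)      γ = Valid t γ × Valid u γ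
    Valid (fst t)         γ = Valid t γ
    Valid (snd t)         γ = Valid t γ
    Valid (bind t u)      γ = Valid t γ × Valid u (eval# t γ ∷ γ)
    Valid (call f as)     γ = ValidArgs as γ × Valid f (evalArgs as γ)
    Valid (fold l z b)    γ = Valid l γ × Valid z γ × ValidFold b γ (eval# z γ) (eval# l γ)
    Valid (iterate n z b) γ = Valid n γ × Valid z γ × (∀ acc → Valid b (acc ∷ γ))
    Valid (collect l b)   γ = Valid l γ × (∀ x → Valid b (x ∷ γ))
    Valid (assume {σ = σ} τ t) γ = Valid t γ × (Ok σ (eval# t γ) → Ok τ (eval# t γ))

    ValidArgs : ∀ {Γ Δ} → Args Γ Δ → Env Γ → Set
    ValidArgs []       γ = ⊤
    ValidArgs (t ∷ as) γ = Valid t γ × ValidArgs as γ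

    -- Validity is followed along the actual run: the claim in `extendAll` holds only because of how
    -- many rounds are still to come.
    ValidFold : ∀ {Γ s t} {τ : Ty s} {σ : Ty t} → Tm (τ ▸ σ ▸ Γ) σ → Env Γ → ⟦ t ⟧ → List ⟦ s ⟧ → Set
    ValidFold b γ acc []       = ⊤
    ValidFold b γ acc (x ∷ xs) =
      Valid b (x ∷ acc ∷ γ) × ValidFold b γ (eval# b (x ∷ acc ∷ γ)) xs

    1≤M : 1 ≤ M
    1≤M = ≤-trans (n≤1+n 1) 2≤M

    1≤^ : ∀ {m} → 1 ≤ m → ∀ e → 1 ≤ m ^ e
    1≤^ {m} p e = m^n>0 m {{>-nonZero p}} e

  1≤bound : ∀ d → 1 ≤ bound d
  1≤bound (q , e) = *-mono-≤ (1≤^ 1≤Q q) (1≤^ 1≤M e)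

  bound-mono : ∀ {q q′ e e′} → q ≤ q′ → e ≤ e′ → bound (q , e) ≤ bound (q′ , e′)
  bound-mono p r =
    *-mono-≤ (^-monoʳ-≤ Q {{>-nonZero 1≤Q}} p) (^-monoʳ-≤ M {{>-nonZero 1≤M}} r)

  bound-⊗ : ∀ d d′ → bound (d ⊗ d′) ≡ bound d * bound d′
  bound-⊗ (q , e) (q′ , e′) = trans
    (cong₂ _*_ (^-distribˡ-+-* Q q q′) (^-distribˡ-+-* M e e′))
    ([m*n]*[o*p]≡[m*o]*[n*p] (Q ^ q) (Q ^ q′) (M ^ e) (M ^ e′))

  c≤2^c : ∀ c → c ≤ 2 ^ c
  c≤2^c zero    = z≤n
  c≤2^c (suc c) = begin
    1 + c         ≤⟨ +-mono-≤ (m^n>0 2 c) (c≤2^c c) ⟩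
    2 ^ c + 2 ^ c ≡⟨ cong (2 ^ c +_) (sym (+-identityʳ (2 ^ c))) ⟩
    2 ^ suc c     ∎
    where open ≤-Reasoning

  const≤bound : ∀ c → c ≤ bound (0 , c)
  const≤bound c = begin
    c           ≤⟨ c≤2^c c ⟩
    2 ^ c       ≤⟨ ^-monoˡ-≤ c 2≤M ⟩
    M ^ c       ≡⟨ sym (+-identityʳ (M ^ c)) ⟩
    bound (0 , c) ∎
    where open ≤-Reasoning

  4*bound≤ : ∀ q e → 4 * bound (q , e) ≤ bound (q , 2 + e)
  4*bound≤ q e = begin
    4 * bound (q , e)             ≤⟨ *-monoˡ-≤ (bound (q , e)) (^-monoˡ-≤ 2 2≤M) ⟩
    M ^ 2 * bound (q , e)         ≡⟨ cong (_* bound (q , e)) (sym (+-identityʳ (M ^ 2))) ⟩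
    bound (0 , 2) * bound (q , e) ≡⟨ sym (bound-⊗ (0 , 2) (q , e)) ⟩
    bound (q , 2 + e)             ∎
    where open ≤-Reasoning

  timeBound : Timing → ℕ
  timeBound t = bound (degreeOf t)

  private
    quadruple : ∀ {x y z w b} → x ≤ b → y ≤ b → z ≤ b → w ≤ b → x + (y + (z + w)) ≤ 4 * b
    quadruple {b = b} p q r s =
      +-mono-≤ p (+-mono-≤ q (+-mono-≤ r (≤-trans s (≤-reflexive (sym (+-identityʳ b))))))

  module _ (s t : Timing) where

    private
      q  = proj₁ (degreeOf s)
      e  = proj₂ (degreeOf s)
      q′ = proj₁ (degreeOf t)
      e′ = proj₂ (degreeOf t)

      weakenˡ : ∀ {x} → x ≤ timeBound s → x ≤ bound (q ⊔ q′ , e ⊔ e′)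
      weakenˡ p = ≤-trans p (bound-mono {q} {q ⊔ q′} {e} {e ⊔ e′} (m≤m⊔n q q′) (m≤m⊔n e e′))

      weakenʳ : ∀ {x} → x ≤ timeBound t → x ≤ bound (q ⊔ q′ , e ⊔ e′)
      weakenʳ p = ≤-trans p (bound-mono {q′} {q ⊔ q′} {e′} {e ⊔ e′} (m≤n⊔m q q′) (m≤n⊔m e e′))

      1≤b : 1 ≤ bound (q ⊔ q′ , e ⊔ e′)
      1≤b = 1≤bound (q ⊔ q′ , e ⊔ e′)

    ⟫-bound : ∀ {x y} → x ≤ timeBound s → y ≤ timeBound t → 1 + x + y ≤ timeBound (s ⟫ t)
    ⟫-bound {x} {y} p r = ≤-trans
      (≤-trans (≤-reflexive (cong (λ z → suc (x + z)) (sym (+-identityʳ y))))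
        (quadruple 1≤b (weakenˡ p) (weakenʳ r) z≤n))
      (4*bound≤ (q ⊔ q′) (e ⊔ e′))

    branch-bound : ∀ {x} → x ≤ bound (q ⊔ q′ , e ⊔ e′) → 2 + x ≤ timeBound (branch s t)
    branch-bound {x} p = ≤-trans
      (≤-trans (≤-reflexive (cong (2 +_) (sym (+-identityʳ x)))) (quadruple 1≤b 1≤b p z≤n))
      (4*bound≤ (q ⊔ q′) (e ⊔ e′))

    branch-boundˡ : ∀ {x} → x ≤ timeBound s → 2 + x ≤ timeBound (branch s t)
    branch-boundˡ p = branch-bound (weakenˡ p)

    branch-boundʳ : ∀ {x} → x ≤ timeBound t → 2 + x ≤ timeBound (branch s t)
    branch-boundʳ p = branch-bound (weakenʳ p)

  -- Each test of the loop condition takes two steps, the failing one included. With N rounds and a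
  -- body bounded by B ≥ 1 the total is at most 2N(2 + B) ≤ 8NB, and 8 ≤ M^3.
  repeat-bound : ∀ d t {n} → n ≤ bound d → n * (2 + timeBound t) + 2 ≤ timeBound (repeat d t)
  repeat-bound d t {n} p = begin
    n * (2 + B) + 2             ≤⟨ +-mono-≤ (*-monoˡ-≤ (2 + B) p) (*-mono-≤ (1≤bound d) (s≤s (s≤s z≤n))) ⟩
    N * (2 + B) + N * (2 + B)   ≡⟨ cong (N * (2 + B) +_) (sym (+-identityʳ _)) ⟩
    2 * (N * (2 + B))           ≤⟨ *-monoʳ-≤ 2 (*-monoʳ-≤ N (begin
      2 + B                       ≡⟨ cong (2 +_) (sym (+-identityʳ B)) ⟩
      1 + (1 + (B + 0))           ≤⟨ quadruple (1≤bound b) (1≤bound b) ≤-refl z≤n ⟩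
      4 * B                       ∎)) ⟩
    2 * (N * (4 * B))           ≡⟨ solve-8 N B ⟩
    8 * (N * B)                 ≤⟨ *-monoˡ-≤ (N * B) (^-monoˡ-≤ 3 2≤M) ⟩
    M ^ 3 * (N * B)             ≡⟨ *-comm (M ^ 3) (N * B) ⟩
    N * B * M ^ 3               ≡⟨ cong₂ _*_ (sym (bound-⊗ d b)) (sym (+-identityʳ (M ^ 3))) ⟩
    bound (d ⊗ b) * bound (0 , 3) ≡⟨ sym (bound-⊗ (d ⊗ b) (0 , 3)) ⟩
    timeBound (repeat d t)      ∎
    where
    open ≤-Reasoning
    b = degreeOf t
    N = bound d
    B = bound b
    solve-8 : ∀ n b → 2 * (n * (4 * b)) ≡ 8 * (n * b)
    solve-8 = solve-∀

  ok-var : ∀ {Γ s} {τ : Ty s} (v : Γ ∋ τ) (γ : Env Γ) → OkEnv γ → Ok τ (lookupVar v γ)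
  ok-var here      (x ∷ γ) (o , _) = o
  ok-var (there v) (x ∷ γ) (_ , o) = ok-var v γ o

  iter-preserves : ∀ {A : Set} (P : A → Set) {f : A → A} →
                   (∀ x → P x → P (f x)) → ∀ n {z} → P z → P (iter f z n)
  iter-preserves P h zero    p = p
  iter-preserves P h (suc n) p = iter-preserves P h n (h _ p)

  ≤ˢ-mono : ∀ {m n} z → m ≤ n → n ≤ˢ z → m ≤ˢ z
  ≤ˢ-mono nothing  p q = tt
  ≤ˢ-mono (just _) p q = ≤-trans p q

  0≤ˢ : ∀ z → 0 ≤ˢ z
  0≤ˢ nothing  = tt
  0≤ˢ (just _) = z≤n

  mutual

    ok : ∀ {Γ s} {τ : Ty s} (t : Tm Γ τ) (γ : Env Γ) → OkEnv γ → Valid t γ → Ok τ (eval# t γ)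
    ok (var v) γ o v′ = ok-var v γ o
    ok true γ o v = tt
    ok false γ o v = tt
    ok (ifte c t u) γ o (_ , v) with eval# c γ
    ... | true  = ok t γ o v
    ... | false = ok u γ o v
    ok (zero {z}) γ o v = 0≤ˢ z
    ok (suc t) γ o v = tt
    ok (dec {z} t) γ o v = ≤ˢ-mono z (pred[n]≤n {n = eval# t γ}) (ok t γ o v)
    ok (positive t) γ o v = tt
    ok ([] {z = z}) γ o v = 0≤ˢ z , []
    ok (single t) γ o v = ≤-refl , ok t γ o v ∷ []
    ok (t ∷ u) γ o (v , v′) = tt , ok t γ o v ∷ proj₂ (ok u γ o v′)
    ok (uncons {z = z} t n u) γ o (v , v′ , v″) with eval# t γ | ok t γ o v
    ... | []     | _ = ok n γ o v′
    ... | x ∷ xs | l , p ∷ ps = ok u _ (p , (≤ˢ-mono z (n≤1+n _) l , ps) , o) v″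
    ok (pair t u) γ o (v , v′) = ok t γ o v , ok u γ o v′
    ok (fst t) γ o v = proj₁ (ok t γ o v)
    ok (snd t) γ o v = proj₂ (ok t γ o v)
    ok (bind t u) γ o (v , v′) = ok u _ (ok t γ o v , o) v′
    ok (call f as) γ o (v , v′) = ok f _ (okArgs as γ o v) v′
    ok (fold l z b) γ o (v , v′ , v″) =
      ok-fold b γ o _ _ (ok z γ o v′) (proj₂ (ok l γ o v)) v″
    ok (iterate {σ = σ} n z b) γ o (v , v′ , v″) =
      iter-preserves (Ok σ) (λ acc p → ok b _ (p , o) (v″ acc)) (eval# n γ) (ok z γ o v′)
    ok (collect {d = d} {d′} l b) γ o (v , v′) =
      (begin
        length (collected f xs)    ≤⟨ length-collect f xs (All.map proj₁ oks) [] ⟩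
        length xs * bound d′ + 0   ≡⟨ +-identityʳ _ ⟩
        length xs * bound d′       ≤⟨ *-monoˡ-≤ (bound d′) (proj₁ (ok l γ o v)) ⟩
        bound d * bound d′         ≡⟨ sym (bound-⊗ d d′) ⟩
        bound (d ⊗ d′)             ∎) ,
      All-collect f xs (All.map proj₂ oks) []
      where
      open ≤-Reasoning
      xs  = eval# l γ
      f   = λ x → eval# b (x ∷ γ)
      oks = All.map (λ {x} p → ok b (x ∷ γ) (p , o) (v′ x)) (proj₂ (ok l γ o v))
    ok (assume τ t) γ o (v , v′) = v′ (ok t γ o v)

    ok-fold : ∀ {Γ s t} {τ : Ty s} {σ : Ty t} (b : Tm (τ ▸ σ ▸ Γ) σ) (γ : Env Γ) → OkEnv γ →
              ∀ acc xs → Ok σ acc → All (Ok τ) xs → ValidFold b γ acc xs →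
              Ok σ (foldl (λ acc x → eval# b (x ∷ acc ∷ γ)) acc xs)
    ok-fold b γ o acc []       p []       v = p
    ok-fold b γ o acc (x ∷ xs) p (q ∷ qs) (v , vs) =
      ok-fold b γ o _ xs (ok b _ (q , p , o) v) qs vs

    okArgs : ∀ {Γ Δ} (as : Args Γ Δ) (γ : Env Γ) → OkEnv γ → ValidArgs as γ → OkEnv (evalArgs as γ)
    okArgs []       γ o v        = tt
    okArgs (t ∷ as) γ o (v , vs) = ok t γ o v , okArgs as γ o vs

  -- Correctness of the compiler

  -- The index is a `Timing` and not a number, so unification assembles the bound of a composite
  -- command and `exec` needs no arithmetic on running times.
  record Exec (C : Cmd 3) (σ τ : Store 3) (t : Timing) : Set where
    constructor executed
    field
      count   : ℕ
      halts   : σ ⊢ C ⇓ τ steps count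
      bounded : count ≤ timeBound t

  infixr 4 _⨟_

  _⨟_ : ∀ {C D σ τ υ d d′} → Exec C σ τ d → Exec D τ υ d′ → Exec (C ⨾ D) σ υ (d ⟫ d′)
  _⨟_ {d = d} {d′} (executed s c p) (executed t c′ q) = executed (1 + s + t) (seq c c′) (⟫-bound d d′ p q)

  set : ∀ {x e σ} → Exec (x := e) σ (σ [ x ]≔ eval σ e) (steps (suc (cost e)))
  set {e = e} = executed _ assign (const≤bound (suc (cost e)))

  whenTrue : ∀ {C D E l r S τ d d′} → Exec C (E ∷ (l ∙ r) ∷ S ∷ []) τ d →
             Exec (if var result then C else D) (E ∷ (l ∙ r) ∷ S ∷ []) τ (branch d d′)
  whenTrue {d = d} {d′} (executed t c p) = executed (2 + t) (if-true (λ ()) c) (branch-boundˡ d d′ p)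

  whenFalse : ∀ {C D E S τ d d′} → Exec D (E ∷ nil ∷ S ∷ []) τ d′ →
              Exec (if var result then C else D) (E ∷ nil ∷ S ∷ []) τ (branch d d′)
  whenFalse {d = d} {d′} (executed t c p) = executed (2 + t) (if-false refl c) (branch-boundʳ d d′ p)

  module _ {A Acc : Set} (enc : A → Tree) (P : Acc → Tree) (step : Acc → A → Acc)
           (Inv : Acc → List A → Set) {C : Cmd 3} {E : Tree} (b : Timing)
           (run : ∀ {acc x xs} → Inv acc (x ∷ xs) →
                  Exec C (E ∷ (enc x ∙ encodeList (map enc xs)) ∷ P acc ∷ [])
                         (E ∷ encodeList (map enc xs) ∷ P (step acc x) ∷ []) b
                  × Inv (step acc x) xs)
           where

    -- The common core of `fold`, `iterate`, `collect` and `transfer`. `Inv` may refer to the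
    -- elements still to come, as `ValidFold` does.
    run-loop : ∀ {d} xs {acc} → Inv acc xs → length xs ≤ bound d →
           Exec (while var result loop C)
                (E ∷ encodeList (map enc xs) ∷ P acc ∷ [])
                (E ∷ nil ∷ P (foldl step acc xs) ∷ []) (repeat d b)
    run-loop {d} xs i p = let (t , c , q) = go xs i in executed t c (≤-trans q (repeat-bound d b p))
      where
      go : ∀ xs {acc} → Inv acc xs →
           ∃[ t ] (((E ∷ encodeList (map enc xs) ∷ P acc ∷ []) ⊢ while var result loop C ⇓
                    (E ∷ nil ∷ P (foldl step acc xs) ∷ []) steps t)
                   × t ≤ length xs * (2 + timeBound b) + 2)
      go []       i = 2 , while-false refl , ≤-refl
      go (x ∷ xs) i =
        let (executed s c p , i′) = run i
            (t , c′ , q)       = go xs i′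
        in 2 + s + t , while-true (λ ()) c c′ ,
           ≤-trans (+-mono-≤ (+-monoʳ-≤ 2 p) q) (≤-reflexive (sym (+-assoc (2 + timeBound b) _ 2)))

  module _ {E S : Tree} where

    exec-transfer : ∀ {s d} (ys zs : List ⟦ s ⟧) (r : Tree) → length ys ≤ bound d →
      Exec (while var result loop transfer)
           (E ∷ encode (list s) ys ∷ (r ∙ encode (list s) zs ∙ S) ∷ [])
           (E ∷ nil ∷ (r ∙ encode (list s) (ys ʳ++ zs) ∙ S) ∷ []) (repeat d transferᵗ)
    exec-transfer {s} ys zs r p =
      run-loop (encode s) (λ zs → r ∙ encode (list s) zs ∙ S) (λ zs y → y ∷ zs) (λ _ _ → ⊤)
        transferᵗ (λ _ → (set ⨟ set) , tt) ys tt p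

  -- A unary numeral is at the same time a list of nils, which makes `iterate` an instance of
  -- `run-loop`.
  encodeℕ-replicate : ∀ n → encodeℕ n ≡ encodeList (map (λ _ → nil) (replicate n tt))
  encodeℕ-replicate zero    = refl
  encodeℕ-replicate (suc n) = cong (nil ∙_) (encodeℕ-replicate n)

  foldl-replicate : ∀ {A : Set} (f : A → A) z n → foldl (λ a _ → f a) z (replicate n tt) ≡ iter f z n
  foldl-replicate f z zero    = refl
  foldl-replicate f z (suc n) = foldl-replicate f (f z) n

  exec-var : ∀ {Γ s} {τ : Ty s} (v : Γ ∋ τ) (γ : Env Γ) (σ : Store 3) (e : Expr 3) →
             eval σ e ≡ encodeEnv γ → eval σ (access v e) ≡ encode s (lookupVar v γ)
  exec-var here      (x ∷ γ) σ e eq = cong left eq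
  exec-var (there v) (x ∷ γ) σ e eq = exec-var v γ σ (tl e) (cong right eq)

  mutual

    exec : ∀ {Γ s} {τ : Ty s} (t : Tm Γ τ) (γ : Env Γ) → OkEnv γ → Valid t γ → ∀ {R S} →
           Exec (compile t) (encodeEnv γ ∷ R ∷ S ∷ []) (encodeEnv γ ∷ encode s (eval# t γ) ∷ S ∷ [])
                (time t)
    exec (var v) γ o _ {R} {S} =
      subst (λ r → Exec (compile (var v)) (encodeEnv γ ∷ R ∷ S ∷ []) (encodeEnv γ ∷ r ∷ S ∷ [])
                        (time (var v)))
            (exec-var v γ (encodeEnv γ ∷ R ∷ S ∷ []) (var environment) refl) set
    exec true γ o v = set
    exec false γ o v = set
    exec (ifte c t u) γ o (v , v′) {R} {S} with eval# c γ | exec c γ o v {R} {S} | v′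
    ... | true  | e | w = e ⨟ whenTrue {d′ = time u} (exec t γ o w)
    ... | false | e | w = e ⨟ whenFalse {d = time t} (exec u γ o w)
    exec zero γ o v = set
    exec (suc t) γ o v = exec t γ o v ⨟ set
    exec (dec t) γ o v {R} {S} with eval# t γ | exec t γ o v {R} {S}
    ... | zero  | e = e ⨟ set
    ... | suc n | e = e ⨟ set
    exec (positive t) γ o v {R} {S} with eval# t γ | exec t γ o v {R} {S}
    ... | zero  | e = e ⨟ whenFalse {d = steps 4} set
    ... | suc n | e = e ⨟ whenTrue {d′ = steps 2} set
    exec [] γ o v = set
    exec (single t) γ o v = exec t γ o v ⨟ set
    exec (t ∷ u) γ o (v , v′) = exec t γ o v ⨟ set ⨟ exec u γ o v′ ⨟ set ⨟ set
    exec (uncons {z = z} t n u) γ o (v , v′ , v″) {R} {S}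
      with eval# t γ | ok t γ o v | exec t γ o v {R} {S}
    ... | []     | _ | e =
      e ⨟ whenFalse {d = steps 8 ⟫ time u ⟫ steps 4} (exec n γ o v′)
    ... | x ∷ xs | l , p ∷ ps | e =
      e ⨟ whenTrue {d′ = time n}
            (set ⨟ exec u (x ∷ xs ∷ γ) (p , (≤ˢ-mono z (n≤1+n _) l , ps) , o) v″ ⨟ set)
    exec (pair t u) γ o (v , v′) = exec t γ o v ⨟ set ⨟ exec u γ o v′ ⨟ set ⨟ set
    exec (fst t) γ o v = exec t γ o v ⨟ set
    exec (snd t) γ o v = exec t γ o v ⨟ set
    exec (bind t u) γ o (v , v′) =
      exec t γ o v ⨟ set ⨟ exec u (eval# t γ ∷ γ) (ok t γ o v , o) v′ ⨟ set
    exec (call f as) γ o (v , v′) =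
      execArgs as γ o v ⨟ set ⨟ set ⨟
      exec f (evalArgs as γ) (okArgs as γ o v) v′ ⨟ set ⨟ set
    exec (fold {s = s} {t} {d} {τ} {σ} l z b) γ o (v , v′ , v″) {R} {S} =
      exec z γ o v′ ⨟ set ⨟ exec l γ o v ⨟
      run-loop (encode s) (λ acc → encode t acc ∙ S) (λ acc x → eval# b (x ∷ acc ∷ γ))
        (λ acc xs → Ok σ acc × All (Ok τ) xs × ValidFold b γ acc xs)
        (steps 8 ⟫ steps 6 ⟫ time b ⟫ steps 6 ⟫ exchangeᵗ)
        (λ { (p , q ∷ qs , w , ws) →
             (set ⨟ set ⨟ exec b _ (q , p , o) w ⨟ set ⨟ set ⨟ set ⨟ set) ,
             ok b _ (q , p , o) w , qs , ws })
        {d} (eval# l γ) (ok z γ o v′ , proj₂ (ok l γ o v) , v″) (proj₁ (ok l γ o v)) ⨟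
      set ⨟ set
    exec (iterate {t = t} {d} {σ} n z b) γ o (v , v′ , v″) {R} {S} =
      subst (λ r → Exec (compile (iterate n z b)) (encodeEnv γ ∷ R ∷ S ∷ [])
                        (encodeEnv γ ∷ encode t r ∷ S ∷ []) (time (iterate n z b)))
        (foldl-replicate (λ acc → eval# b (acc ∷ γ)) (eval# z γ) m)
        (exec z γ o v′ ⨟ set ⨟
         subst (λ r → Exec (compile n) _ (encodeEnv γ ∷ r ∷ (encode t (eval# z γ) ∙ S) ∷ []) (time n))
           (encodeℕ-replicate m) (exec n γ o v) ⨟
         run-loop (λ _ → nil) (λ acc → encode t acc ∙ S) (λ acc _ → eval# b (acc ∷ γ))
           (λ acc _ → Ok σ acc)
           (steps 5 ⟫ steps 6 ⟫ time b ⟫ steps 5 ⟫ exchangeᵗ)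
           (λ {acc} p →
             (set ⨟ set ⨟ exec b _ (p , o) (v″ acc) ⨟ set ⨟ set ⨟ set ⨟ set) ,
             ok b _ (p , o) (v″ acc))
           {d} (replicate m tt) (ok z γ o v′)
           (≤-trans (≤-reflexive (length-replicate m)) (ok n γ o v)) ⨟
         set ⨟ set)
      where m = eval# n γ
    exec (collect {s = s} {t} {d} {d′} {τ} {σ} l b) γ o (v , v′) {R} {S} =
      set ⨟ exec l γ o v ⨟
      run-loop (encode s) (λ acc → encode (list t) acc ∙ S)
        (λ acc x → eval# b (x ∷ γ) ʳ++ acc)
        (λ acc xs → All (Ok τ) xs)
        (steps 5 ⟫ steps 5 ⟫ time b ⟫ repeat d′ transferᵗ ⟫ steps 3 ⟫ steps 3 ⟫ popᵗ)
        (λ { {acc} {x} (q ∷ qs) →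
             (set ⨟ set ⨟ exec b _ (q , o) (v′ x) ⨟
              exec-transfer {d = d′} (eval# b (x ∷ γ)) acc _ (proj₁ (ok b _ (q , o) (v′ x))) ⨟
              set ⨟ set ⨟ set) ,
             qs })
        {d} (eval# l γ) (proj₂ (ok l γ o v)) (proj₁ (ok l γ o v)) ⨟
      set ⨟ set
    exec (assume τ t) γ o (v , _) = exec t γ o v

    execArgs : ∀ {Γ Δ} (as : Args Γ Δ) (γ : Env Γ) → OkEnv γ → ValidArgs as γ → ∀ {R S} →
               Exec (compileArgs as) (encodeEnv γ ∷ R ∷ S ∷ [])
                    (encodeEnv γ ∷ encodeEnv (evalArgs as γ) ∷ S ∷ []) (timeArgs as)
    execArgs []       γ o v        = set
    execArgs (t ∷ as) γ o (v , vs) = execArgs as γ o vs ⨟ set ⨟ exec t γ o v ⨟ set ⨟ set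

  mutual

    valid : ∀ {Γ s} {τ : Ty s} (t : Tm Γ τ) → T (pure t) → ∀ γ → Valid t γ
    valid (var v)         p γ = tt
    valid true            p γ = tt
    valid false           p γ = tt
    valid (ifte c t u)    p γ with both p
    ... | p , q with both q
    ... | q , r = valid c p γ , valid-choice (eval# c γ)
      where
      valid-choice : ∀ b → choice b (Valid t γ) (Valid u γ)
      valid-choice true  = valid t q γ
      valid-choice false = valid u r γ
    valid zero            p γ = tt
    valid (suc t)         p γ = valid t p γ
    valid (dec t)         p γ = valid t p γ
    valid (positive t)    p γ = valid t p γ
    valid []              p γ = tt
    valid (single t)      p γ = valid t p γ
    valid (t ∷ u)         p γ = let (p , q) = both p in valid t p γ , valid u q γ
    valid (uncons t z u)  p γ with both p
    ... | p , q with both q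
    ... | q , r = valid t p γ , valid z q γ , valid-case (eval# t γ)
      where
      valid-case : ∀ xs → caseList ⊤ (λ x xs → Valid u (x ∷ xs ∷ γ)) xs
      valid-case []       = tt
      valid-case (x ∷ xs) = valid u r _
    valid (pair t u)      p γ = let (p , q) = both p in valid t p γ , valid u q γ
    valid (fst t)         p γ = valid t p γ
    valid (snd t)         p γ = valid t p γ
    valid (bind t u)      p γ = let (p , q) = both p in valid t p γ , valid u q _
    valid (call f as)     p γ = let (p , q) = both p in validArgs as p γ , valid f q _
    valid (fold l z b)    p γ =
      let (p , q) = both p ; (q , r) = both q
      in valid l p γ , valid z q γ , validFold b r γ (eval# z γ) (eval# l γ)
    valid (iterate n z b) p γ =
      let (p , q) = both p ; (q , r) = both q in valid n p γ , valid z q γ , λ _ → valid b r _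
    valid (collect l b)   p γ = let (p , q) = both p in valid l p γ , λ _ → valid b q _
    valid (assume τ t)    ()

    validArgs : ∀ {Γ Δ} (as : Args Γ Δ) → T (pureArgs as) → ∀ γ → ValidArgs as γ
    validArgs []       p γ = tt
    validArgs (t ∷ as) p γ = let (p , q) = both p in valid t p γ , validArgs as q γ

    validFold : ∀ {Γ s t} {τ : Ty s} {σ : Ty t} (b : Tm (τ ▸ σ ▸ Γ) σ) → T (pure b) →
                ∀ γ acc xs → ValidFold b γ acc xs
    validFold b p γ acc []       = tt
    validFold b p γ acc (x ∷ xs) = valid b p _ , validFold b p γ _ xs

-- The algorithm

N : Ty nat
N = nat (just (0 , 1))

V : ∀ {s} → Ty s → Ty (list s)
V = list (just (0 , 1))

Matrix : Ty (list (list bool))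
Matrix = V (V bool)

Mask : Ty (list (pair nat bool))
Mask = V (pair N bool)

Guess : Ty (list (pair nat nat))
Guess = V (pair N N)

-- The label of a vertex, whether the vertex is known to be supported, which
-- vertices of S are, and a bound on the number of zeros.
State : Ty (pair nat (pair bool (pair (list (pair nat bool)) nat)))
State = pair N (pair bool (pair Mask N))

-- The exponent is that of `universe`, which combines labels, flags, masks and payments, at most `M`
-- of each.
Table : Ty (list (pair nat (pair bool (pair (list (pair nat bool)) nat))))
Table = list (just (0 , 4)) State

Entry : Ty (pair nat (list (pair nat (pair bool (pair (list (pair nat bool)) nat)))))
Entry = pair N Table

size : Ctx → ℕ
size ∅       = 0
size (_ ▸ Γ) = suc (size Γ)

at : (Γ : Ctx) (i : ℕ) → T (i <ᵇ size Γ) → ∃ Ty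
at (τ ▸ Γ) zero    p = _ , τ
at (_ ▸ Γ) (suc i) p = at Γ i p

index : (Γ : Ctx) (i : ℕ) (p : T (i <ᵇ size Γ)) → Γ ∋ proj₂ (at Γ i p)
index (τ ▸ Γ) zero    p = here
index (_ ▸ Γ) (suc i) p = there (index Γ i p)

infix 8 #_

#_ : ∀ {Γ} (i : ℕ) {p : T (i <ᵇ size Γ)} → Tm Γ (proj₂ (at Γ i p))
# i = var (index _ i _)

module _ {Γ : Ctx} where

  infixr 6 _and_
  infixr 5 _or_
  infixr 4 _implies_

  not : Tm Γ bool → Tm Γ bool
  not t = ifte t false true

  _and_ _or_ _implies_ : Tm Γ bool → Tm Γ bool → Tm Γ bool
  t and u     = ifte t u false
  t or u      = ifte t true u
  t implies u = ifte t u true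

  module _ {s d} {τ : Ty s} (l : Tm Γ (list (just d) τ)) where

    -- For a concrete `d` the degree reduces to `d`. What is selected from a table is thus a table
    -- again, and selections can be made inside loops without claims about sizes.
    select : Tm (τ ▸ Γ) bool → Tm Γ (list (just (d ⊗ (0 , 0))) τ)
    select p = collect l (ifte p (single (# 0)) [])

    any : Tm (τ ▸ Γ) bool → Tm Γ bool
    any p = uncons (select p) false true

    all : Tm (τ ▸ Γ) bool → Tm Γ bool
    all p = ifte (uncons (collect l (ifte p [] (single (# 0)))) false true) false true

-- Truncated subtraction. Only the first argument is looped over, so the second may be the unbounded
-- ℓ.
less : ∀ {z} → Tm (N ▸ nat z ▸ ∅) bool
less = positive (iterate (# 0) (# 1) (dec (# 0)))

equal : Tm (N ▸ N ▸ ∅) bool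
equal = not (call less (# 0 ∷ # 1 ∷ [])) and not (call less (# 1 ∷ # 0 ∷ []))

infix 7 _==_

_==_ : ∀ {Γ} → Tm Γ N → Tm Γ N → Tm Γ bool
t == u = call equal (t ∷ u ∷ [])

-- Positions past the end yield the default. Hence the root, which is numbered n, is outside `S` and
-- adjacent to nothing.
nth : ∀ {s} {τ : Ty s} → (∀ {Γ} → Tm Γ τ) → Tm (N ▸ V τ ▸ ∅) τ
nth z = uncons (iterate (# 0) (# 1) (uncons (# 0) [] (# 1))) z (# 0)

bit : Tm (N ▸ V bool ▸ ∅) bool
bit = nth false

adjacent : Tm (N ▸ N ▸ Matrix ▸ ∅) bool
adjacent = call bit (# 1 ∷ call (nth []) (# 0 ∷ # 2 ∷ []) ∷ [])

member : Tm (N ▸ V N ▸ ∅) bool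
member = any (# 1) (# 0 == # 1)

Ball : Ctx
Ball = N ▸ N ▸ V N ▸ Matrix ▸ ∅

center : Tm Ball (V N)
center = select (# 2) (# 0 == # 2)

neighbourhood : Tm (V N ▸ Ball) (V N)
neighbourhood = select (# 3) (any (# 1) (# 0 == # 1 or call adjacent (# 0 ∷ # 1 ∷ # 6 ∷ [])))

-- arguments: the radius, the center, all vertices, the graph
ball : Tm Ball (V N)
ball = iterate (# 0) center neighbourhood

-- Distances are compared without being computed: some ball around `a` contains `u` but not `v`. The
-- vertices 0, ..., n - 1 double as the radii, which suffice since distances are below n.
closer : Tm (N ▸ N ▸ N ▸ V N ▸ Matrix ▸ ∅) bool
closer =
  any (# 3) (call member (# 1 ∷ call ball (# 0 ∷ # 3 ∷ # 4 ∷ # 5 ∷ []) ∷ []) and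
          not (call member (# 2 ∷ call ball (# 0 ∷ # 3 ∷ # 4 ∷ # 5 ∷ []) ∷ [])))

-- arguments: u and its label, v and its label, a, all vertices, the graph
supports : Tm (N ▸ N ▸ N ▸ N ▸ N ▸ V N ▸ Matrix ▸ ∅) bool
supports =
  call adjacent (# 0 ∷ # 2 ∷ # 6 ∷ []) and
  (call less (# 1 ∷ # 3 ∷ []) or
   not (positive (# 1)) and not (positive (# 3)) and call closer (# 0 ∷ # 2 ∷ # 4 ∷ # 5 ∷ # 6 ∷ []))

forestAdjacent : Tm (N ▸ N ▸ V bool ▸ Matrix ▸ ∅) bool
forestAdjacent =
  not (call bit (# 0 ∷ # 2 ∷ [])) and not (call bit (# 1 ∷ # 2 ∷ [])) and
  call adjacent (# 0 ∷ # 1 ∷ # 3 ∷ [])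

-- a, b, the labels on S, the root, S, all vertices, the graph.  The root is not a
-- vertex, but the table with which those of isolated vertices are merged.
Instance : Ctx
Instance = N ▸ N ▸ Guess ▸ N ▸ V bool ▸ V N ▸ Matrix ▸ ∅

marks : Tm (N ▸ Mask ▸ ∅) bool
marks = any (# 1) (# 1 == fst (# 0) and snd (# 0))

-- arguments: v and its label
supportedLocally : Tm (N ▸ N ▸ Instance) bool
supportedLocally =
  call bit (# 0 ∷ # 6 ∷ []) or # 0 == # 2 or # 0 == # 5 or
  any (# 4) (call supports (fst (# 0) ∷ snd (# 0) ∷ # 1 ∷ # 2 ∷ # 3 ∷ # 8 ∷ # 9 ∷ []))

-- arguments: a vertex of S, v and its label
supportsKey : Tm (N ▸ N ▸ N ▸ Instance) bool
supportsKey =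
  any (# 5) (fst (# 0) == # 1 and
             call supports (# 2 ∷ # 3 ∷ fst (# 0) ∷ snd (# 0) ∷ # 4 ∷ # 9 ∷ # 10 ∷ [])) or
  # 1 == # 3 and # 0 == # 3

-- arguments: v and its label
costs : Tm (N ▸ N ▸ Instance) bool
costs = not (positive (# 1)) and not (# 0 == # 2) and not (# 0 == # 5)

-- arguments: v and its state
initial : Tm (N ▸ State ▸ Instance) bool
initial =
  (call bit (# 0 ∷ # 6 ∷ []) implies any (# 4) (fst (# 0) == # 1 and snd (# 0) == fst (# 2))) and
  (# 0 == # 2 or # 0 == # 3 implies not (positive (fst (# 1)))) and
  (fst (snd (# 1)) implies
    call supportedLocally (# 0 ∷ fst (# 1) ∷ # 2 ∷ # 3 ∷ # 4 ∷ # 5 ∷ # 6 ∷ # 7 ∷ # 8 ∷ [])) and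
  all (fst (snd (snd (# 1)))) (snd (# 0) implies
    call supportsKey (fst (# 0) ∷ # 1 ∷ fst (# 2) ∷ # 3 ∷ # 4 ∷ # 5 ∷ # 6 ∷ # 7 ∷ # 8 ∷ # 9 ∷ [])) and
  (call costs (# 0 ∷ fst (# 1) ∷ # 2 ∷ # 3 ∷ # 4 ∷ # 5 ∷ # 6 ∷ # 7 ∷ # 8 ∷ []) implies
   positive (snd (snd (snd (# 1)))))

-- arguments: u, its state, v, its state
inForest : Tm (N ▸ State ▸ N ▸ State ▸ Instance) bool
inForest =
  call forestAdjacent (# 0 ∷ # 2 ∷ # 8 ∷ # 10 ∷ []) and
  call supports (# 0 ∷ fst (# 1) ∷ # 2 ∷ fst (# 3) ∷ # 4 ∷ # 9 ∷ # 10 ∷ [])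

-- arguments: u, v, their states, a state for u after the elimination of v
merges : Tm (N ▸ N ▸ State ▸ State ▸ State ▸ Instance) bool
merges =
  fst (# 4) == fst (# 2) and
  (fst (snd (# 4)) implies (fst (snd (# 2)) or
    call inForest (# 1 ∷ # 3 ∷ # 0 ∷ # 2 ∷ # 5 ∷ # 6 ∷ # 7 ∷ # 8 ∷ # 9 ∷ # 10 ∷ # 11 ∷ []))) and
  (fst (snd (# 3)) or
    call inForest (# 0 ∷ # 2 ∷ # 1 ∷ # 3 ∷ # 5 ∷ # 6 ∷ # 7 ∷ # 8 ∷ # 9 ∷ # 10 ∷ # 11 ∷ [])) and
  all (fst (snd (snd (# 4)))) (snd (# 0) implies
    (call marks (fst (# 0) ∷ fst (snd (snd (# 3))) ∷ []) or
     call marks (fst (# 0) ∷ fst (snd (snd (# 4))) ∷ []))) and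
  positive (iterate (snd (snd (snd (# 3))))
             (iterate (snd (snd (snd (# 2)))) (suc (snd (snd (snd (# 4))))) (dec (# 0)))
             (dec (# 0)))

-- Merged states are looked for in the universe (the last table) and not constructed, so the size
-- bound does not grow from merge to merge.
merge : Tm (N ▸ N ▸ Table ▸ Table ▸ Table ▸ Instance) Table
merge =
  select (# 4) (any (# 3) (any (# 5)
    (call merges (# 3 ∷ # 4 ∷ # 1 ∷ # 0 ∷ # 2 ∷
                  # 8 ∷ # 9 ∷ # 10 ∷ # 11 ∷ # 12 ∷ # 13 ∷ # 14 ∷ []))))

neighbours : Tm (N ▸ V Entry ▸ N ▸ V bool ▸ Matrix ▸ ∅) (V Entry)
neighbours = select (# 1) (call forestAdjacent (fst (# 0) ∷ # 1 ∷ # 4 ∷ # 5 ∷ []))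

-- A vertex without remaining neighbours falls back on the root, so every leaf has a row to be
-- merged into.
parent : Tm (N ▸ V Entry ▸ N ▸ V bool ▸ Matrix ▸ ∅) N
parent = uncons neighbours (# 2) (fst (# 0))

leaf : Tm (N ▸ V Entry ▸ N ▸ V bool ▸ Matrix ▸ ∅) bool
leaf =
  not (# 0 == # 2) and
  all (# 1) (call forestAdjacent (fst (# 0) ∷ # 1 ∷ # 4 ∷ # 5 ∷ []) implies
             fst (# 0) == call parent (# 1 ∷ # 2 ∷ # 3 ∷ # 4 ∷ # 5 ∷ []))

-- arguments: an entry, the table of v, v, its parent, all entries, all states
eliminateRow : Tm (Entry ▸ Table ▸ N ▸ N ▸ V Entry ▸ Table ▸ Instance) (list (just (0 , 0)) Entry)
eliminateRow =
  ifte (fst (# 0) == # 2) []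
    (single (ifte (fst (# 0) == # 3)
      (pair (fst (# 0))
            (call merge (fst (# 0) ∷ # 2 ∷ snd (# 0) ∷ # 1 ∷ # 5 ∷
                         # 6 ∷ # 7 ∷ # 8 ∷ # 9 ∷ # 10 ∷ # 11 ∷ # 12 ∷ [])))
      (# 0)))

eliminate : Tm (Table ▸ N ▸ N ▸ V Entry ▸ Table ▸ Instance) (V Entry)
eliminate = collect (# 3) eliminateRow

leaves : Tm (V Entry ▸ Table ▸ Instance) (V Entry)
leaves = select (# 0) (call leaf (fst (# 0) ∷ # 1 ∷ # 6 ∷ # 7 ∷ # 9 ∷ []))

eliminateLeaf : Tm (V Entry ▸ Table ▸ Instance) (V Entry)
eliminateLeaf =
  uncons leaves (# 0)
    (call eliminate (snd (# 0) ∷ fst (# 0) ∷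
                     call parent (fst (# 0) ∷ # 2 ∷ # 7 ∷ # 8 ∷ # 10 ∷ []) ∷
                     # 2 ∷ # 3 ∷ # 4 ∷ # 5 ∷ # 6 ∷ # 7 ∷ # 8 ∷ # 9 ∷ # 10 ∷ []))

table : Tm (N ▸ Table ▸ Instance) Table
table = select (# 1) (call initial (# 1 ∷ # 0 ∷ # 3 ∷ # 4 ∷ # 5 ∷ # 6 ∷ # 7 ∷ # 8 ∷ # 9 ∷ []))

entries : Tm (V N ▸ Table ▸ Instance) (V Entry)
entries =
  collect (# 0) (single (pair (# 0)
    (call table (# 0 ∷ # 2 ∷ # 3 ∷ # 4 ∷ # 5 ∷ # 6 ∷ # 7 ∷ # 8 ∷ # 9 ∷ []))))

-- The vertices only count the rounds: n eliminations turn the n + 1 rows, that of the root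
-- included, into one.
eliminated : Tm (V N ▸ Table ▸ Instance) (V Entry)
eliminated =
  fold (# 7) (call entries (# 0 ∷ # 1 ∷ # 2 ∷ # 3 ∷ # 4 ∷ # 5 ∷ # 6 ∷ # 7 ∷ # 8 ∷ []))
    (call eliminateLeaf (# 1 ∷ # 3 ∷ # 4 ∷ # 5 ∷ # 6 ∷ # 7 ∷ # 8 ∷ # 9 ∷ # 10 ∷ []))

-- at most the distance from a to b
affordable : Tm (N ▸ Instance) bool
affordable =
  positive (# 0) implies
  not (call member (# 2 ∷ call ball (dec (# 0) ∷ # 1 ∷ # 6 ∷ # 7 ∷ []) ∷ []))

accepts : Tm (V N ▸ Table ▸ Instance) bool
accepts =
  any (call eliminated (# 0 ∷ # 1 ∷ # 2 ∷ # 3 ∷ # 4 ∷ # 5 ∷ # 6 ∷ # 7 ∷ # 8 ∷ [])) (any (snd (# 0))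
    (fst (snd (# 0)) and
     all (# 9) (call bit (# 0 ∷ # 9 ∷ []) implies call marks (# 0 ∷ fst (snd (snd (# 1))) ∷ [])) and
     call affordable (snd (snd (snd (# 0))) ∷ # 4 ∷ # 5 ∷ # 6 ∷ # 7 ∷ # 8 ∷ # 9 ∷ # 10 ∷ [])))

universe : Tm (V N ▸ V bool ▸ V Mask ▸ V N ▸ ∅) Table
universe =
  collect (# 0) (collect (# 2) (collect (# 4) (collect (# 6)
    (single (pair (# 3) (pair (# 2) (pair (# 1) (# 0))))))))

Assignments : ∀ {s} → Ty s → Ty (list (list (pair nat s)))
Assignments τ = list nothing (list nothing (pair N τ))

-- Consing loses bounds, so each round claims anew that there are at most `d` assignments, in order
-- to loop over them, and drops the bound afterwards to keep the type of the accumulator.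
extendAll : ∀ {s} (d : Degree) (τ : Ty s) → Tm (N ▸ Assignments τ ▸ V τ ▸ V N ▸ ∅) (Assignments τ)
extendAll d τ =
  assume (Assignments τ)
    (collect (assume (list (just d) (list nothing (pair N τ))) (# 1))
      (collect (# 3) (single (pair (# 2) (# 0) ∷ # 1))))

-- the functions from keys to options, as lists of pairs
assignments : ∀ {s} (d : Degree) (τ : Ty s) → Tm (V τ ▸ V N ▸ ∅) (Assignments τ)
assignments d τ = fold (# 1) ([] {z = nothing} ∷ [] {z = nothing}) (extendAll d τ)

-- The innermost pair is the encoding of an integer, sign first. Its numeral is unbounded: for k = 0
-- no power of `Q` and `M` limits ℓ.
Input : Ctx
Input = pair Matrix (pair (V bool) (pair bool (nat nothing))) ▸ ∅

-- `S` has one entry per vertex and serves to count. The result n, n - 1, ..., 0 has the root as its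
-- head and the vertices as its tail.
numerals : Tm (V bool ▸ ∅) (list nothing (nat nothing))
numerals = fold (# 0) (zero {z = nothing} ∷ [] {z = nothing}) (uncons (# 1) [] (suc (# 0) ∷ # 3))

search : Tm (Table ▸ list (just (1 , 0)) Guess ▸ V Mask ▸ V bool ▸ V N ▸ V N ▸
             V N ▸ N ▸ V N ▸ Matrix ▸ V bool ▸ nat nothing ▸ ∅) bool
search =
  any (# 8) (any (# 9) (any (# 3)
    (call accepts (# 9 ∷ # 3 ∷ # 2 ∷ # 1 ∷ # 0 ∷ # 10 ∷ # 13 ∷ # 11 ∷ # 12 ∷ []))))

Decision : Ctx
Decision = V N ▸ N ▸ V N ▸ Matrix ▸ V bool ▸ nat nothing ▸ ∅

labelsUpTo : Tm Decision (V N)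
labelsUpTo = select (# 2) (call less (# 0 ∷ suc (# 6) ∷ []))

keysOf : Tm (V N ▸ Decision) (V N)
keysOf = select (# 3) (call bit (# 0 ∷ # 6 ∷ []))

-- The list of vertices doubles as the range of payments: an affordable payment is at most d(a,b),
-- hence below n.
allStates : Tm (list (just (1 , 0)) Guess ▸ V Mask ▸ V bool ▸ V N ▸ V N ▸ Decision) Table
allStates = call universe (# 4 ∷ # 2 ∷ # 1 ∷ # 7 ∷ [])

decide : Tm Decision bool
decide =
  bind labelsUpTo
  (bind keysOf
  (bind (assume (V bool) (true ∷ false ∷ [] {z = nothing}))
  (bind (assume (V Mask) (call (assignments (0 , 1) bool) (# 0 ∷ # 1 ∷ [])))
  (bind (assume (list (just (1 , 0)) Guess) (call (assignments (1 , 0) N) (# 3 ∷ # 2 ∷ [])))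
  (bind allStates
  search)))))

numbering : Tm Input (list nothing (nat nothing))
numbering = call numerals (fst (snd (# 0)) ∷ [])

decideNumbered : Tm (V N ▸ Input) bool
decideNumbered =
  uncons (# 0) false
    (call decide (# 2 ∷ # 0 ∷ # 1 ∷ fst (# 3) ∷ fst (snd (# 3)) ∷ snd (snd (snd (# 3))) ∷ []))

main : Tm Input bool
main =
  ifte (fst (snd (snd (# 0)))) false
    (bind (assume (V N) numbering) decideNumbered)

-- Meaning of the terms

-- Unlike a statement about eval# t γ, this determines t in unification.
record Decides {Γ} (t : Tm Γ bool) (γ : Env Γ) (P : Set) : Set where
  constructor decided
  field
    reflects : Reflects P (eval# t γ)

open Decides

reflects-⇔ : ∀ {P Q : Set} {b} → P ⇔ Q → Reflects P b → Reflects Q b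
reflects-⇔ e (ofʸ p) = ofʸ (to e p)
reflects-⇔ e (ofⁿ p) = ofⁿ (p ∘ from e)

reflects-T : ∀ {P : Set} {b} → Reflects P b → P ⇔ T b
reflects-T (ofʸ p) = mk⇔ (λ _ → tt) (λ _ → p)
reflects-T (ofⁿ n) = mk⇔ (λ p → n p) (λ ())

decides-⇔ : ∀ {Γ} {t : Tm Γ bool} {γ P Q} → P ⇔ Q → Decides t γ P → Decides t γ Q
decides-⇔ e (decided r) = decided (reflects-⇔ e r)

record Members {Γ s z} {τ : Ty s} (t : Tm Γ (list z τ)) (γ : Env Γ) (P : ⟦ s ⟧ → Set) : Set where
  constructor consists
  field
    members : ∀ {x} → x ∈ eval# t γ ⇔ P x

open Members

infix 2 ∃∈ ∀∈

∃∈ ∀∈ : {A : Set} → List A → (A → Set) → Set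
∃∈ xs P = ∃[ x ] (x ∈ xs × P x)
∀∈ xs P = ∀ {x} → x ∈ xs → P x

syntax ∃∈ xs (λ x → P) = ∃[ x ∈ xs ] P
syntax ∀∈ xs (λ x → P) = ∀[ x ∈ xs ] P

∈-ʳ++⁻ : ∀ {A : Set} {y : A} xs {ys} → y ∈ xs ʳ++ ys → y ∈ xs ⊎ y ∈ ys
∈-ʳ++⁻ []       i = inj₂ i
∈-ʳ++⁻ (x ∷ xs) i with ∈-ʳ++⁻ xs i
... | inj₁ j         = inj₁ (there j)
... | inj₂ (here p)  = inj₁ (here p)
... | inj₂ (there j) = inj₂ j

∈-ʳ++⁺ʳ : ∀ {A : Set} {y : A} xs {ys} → y ∈ ys → y ∈ xs ʳ++ ys
∈-ʳ++⁺ʳ []       i = i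
∈-ʳ++⁺ʳ (x ∷ xs) i = ∈-ʳ++⁺ʳ xs (there i)

∈-ʳ++⁺ˡ : ∀ {A : Set} {y : A} {xs ys} → y ∈ xs → y ∈ xs ʳ++ ys
∈-ʳ++⁺ˡ {xs = x ∷ xs} (here refl) = ∈-ʳ++⁺ʳ xs (here refl)
∈-ʳ++⁺ˡ               (there i)   = ∈-ʳ++⁺ˡ i

∈-collected : ∀ {A B : Set} {f : A → List B} {xs y} → y ∈ collected f xs ⇔ (∃[ x ∈ xs ] y ∈ f x)
∈-collected {A} {B} {f} = mk⇔ (λ i → old (split _ i)) (λ { (x , i , j) → join [] i j })
  where
  split : ∀ xs {acc y} → y ∈ foldl (λ acc x → f x ʳ++ acc) acc xs → (∃[ x ∈ xs ] y ∈ f x) ⊎ y ∈ acc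
  split []       i = inj₂ i
  split (x ∷ xs) i with split xs i
  ... | inj₁ (z , j , k) = inj₁ (z , there j , k)
  ... | inj₂ j with ∈-ʳ++⁻ (f x) j
  ...   | inj₁ k = inj₁ (x , here refl , k)
  ...   | inj₂ k = inj₂ k
  old : ∀ {P : Set} {y} → P ⊎ y ∈ [] → P
  old (inj₁ p) = p
  keep : ∀ xs {acc y} → y ∈ acc → y ∈ foldl (λ acc x → f x ʳ++ acc) acc xs
  keep []       i = i
  keep (x ∷ xs) i = keep xs (∈-ʳ++⁺ʳ (f x) i)
  join : ∀ acc {xs x y} → x ∈ xs → y ∈ f x → y ∈ foldl (λ acc x → f x ʳ++ acc) acc xs
  join acc {x ∷ xs} (here refl) j = keep xs (∈-ʳ++⁺ˡ j)
  join acc {x ∷ xs} (there i)   j = join _ i j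

not-reflects : ∀ {P : Set} {b} → Reflects P b → Reflects (¬ P) (choice b false true)
not-reflects (ofʸ p) = ofⁿ λ ¬p → ¬p p
not-reflects (ofⁿ p) = ofʸ p

and-reflects : ∀ {P Q : Set} {b c} → Reflects P b → Reflects Q c → Reflects (P × Q) (choice b c false)
and-reflects (ofⁿ p) r       = ofⁿ (p ∘ proj₁)
and-reflects (ofʸ p) (ofʸ q) = ofʸ (p , q)
and-reflects (ofʸ p) (ofⁿ q) = ofⁿ (q ∘ proj₂)

or-reflects : ∀ {P Q : Set} {b c} → Reflects P b → Reflects Q c → Reflects (P ⊎ Q) (choice b true c)
or-reflects (ofʸ p) r       = ofʸ (inj₁ p)
or-reflects (ofⁿ p) (ofʸ q) = ofʸ (inj₂ q)
or-reflects (ofⁿ p) (ofⁿ q) = ofⁿ λ { (inj₁ x) → p x ; (inj₂ y) → q y }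

implies-reflects : ∀ {P Q : Set} {b c} → Reflects P b → Reflects Q c → Reflects (P → Q) (choice b c true)
implies-reflects (ofⁿ p) r       = ofʸ (⊥-elim ∘ p)
implies-reflects (ofʸ p) (ofʸ q) = ofʸ (λ _ → q)
implies-reflects (ofʸ p) (ofⁿ q) = ofⁿ (λ f → q (f p))

∈-choice : ∀ {A P : Set} {b} {x y : A} → Reflects P b → y ∈ choice b [ x ] [] ⇔ (y ≡ x × P)
∈-choice (ofʸ p) = mk⇔ (λ { (here q) → q , p }) (λ { (q , _) → here q })
∈-choice (ofⁿ p) = mk⇔ (λ ()) (λ { (_ , q) → ⊥-elim (p q) })

nonempty-reflects : ∀ {A : Set} (xs : List A) → Reflects (∃[ x ] x ∈ xs) (caseList false (λ _ _ → true) xs)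
nonempty-reflects []       = ofⁿ λ ()
nonempty-reflects (x ∷ xs) = ofʸ (x , here refl)

isPositive-reflects : ∀ n → Reflects (0 < n) (isPositive n)
isPositive-reflects zero    = ofⁿ λ ()
isPositive-reflects (suc n) = ofʸ (s≤s z≤n)

module _ {Γ : Ctx} {γ : Env Γ} where

  bool-decides : ∀ {t : Tm Γ bool} → Decides t γ (T (eval# t γ))
  bool-decides = decided (T-reflects _)

  not-decides : ∀ {t P} → Decides t γ P → Decides (not t) γ (¬ P)
  not-decides (decided r) = decided (not-reflects r)

  infixr 6 _and-decides_
  infixr 5 _or-decides_
  infixr 4 _implies-decides_

  _and-decides_ : ∀ {t u P Q} → Decides t γ P → Decides u γ Q → Decides (t and u) γ (P × Q)
  decided p and-decides decided q = decided (and-reflects p q)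

  _or-decides_ : ∀ {t u P Q} → Decides t γ P → Decides u γ Q → Decides (t or u) γ (P ⊎ Q)
  decided p or-decides decided q = decided (or-reflects p q)

  _implies-decides_ : ∀ {t u P Q} → Decides t γ P → Decides u γ Q → Decides (t implies u) γ (P → Q)
  decided p implies-decides decided q = decided (implies-reflects p q)

  call-decides : ∀ {Δ} {f : Tm Δ bool} {as : Args Γ Δ} {P} →
                 Decides f (evalArgs as γ) P → Decides (call f as) γ P
  call-decides (decided r) = decided r

  positive-decides : ∀ {z} {t : Tm Γ (nat z)} → Decides (positive t) γ (0 < eval# t γ)
  positive-decides {t = t} = decided (isPositive-reflects (eval# t γ))

  zero-decides : ∀ {z} {t : Tm Γ (nat z)} → Decides (not (positive t)) γ (eval# t γ ≡ 0)
  zero-decides {t = t} = decided (reflects-⇔ (zero-⇔ (eval# t γ)) (reflects (not-decides (positive-decides {t = t}))))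
    where
    zero-⇔ : ∀ n → (¬ 0 < n) ⇔ (n ≡ 0)
    zero-⇔ n = mk⇔ (λ p → n≤0⇒n≡0 (≮⇒≥ p)) (λ { refl () })

  module _ {s d} {τ : Ty s} {l : Tm Γ (list (just d) τ)} {p : Tm (τ ▸ Γ) bool} {P : ⟦ s ⟧ → Set}
           (r : ∀ x → Decides p (x ∷ γ) (P x)) where

    private
      f : ⟦ s ⟧ → List ⟦ s ⟧
      f x = choice (eval# p (x ∷ γ)) [ x ] []

    select-members : Members (select l p) γ (λ x → x ∈ eval# l γ × P x)
    select-members = consists (mk⇔
      (λ i → let (x , j , k) = to (∈-collected {f = f}) i
                 (eq , q)    = to (∈-choice (reflects (r x))) k
             in subst (λ y → y ∈ eval# l γ × P y) (sym eq) (j , q))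
      (λ (i , q) → from (∈-collected {f = f}) (_ , i , from (∈-choice (reflects (r _))) (refl , q))))

    any-decides : Decides (any l p) γ (∃[ x ∈ eval# l γ ] P x)
    any-decides = decided (reflects-⇔
      (mk⇔ (λ (x , i) → x , to (members select-members) i) (λ (x , i) → x , from (members select-members) i))
      (nonempty-reflects (eval# (select l p) γ)))

  all-decides : ∀ {s d} {τ : Ty s} {l : Tm Γ (list (just d) τ)} {p : Tm (τ ▸ Γ) bool} {P : ⟦ s ⟧ → Set} →
                (∀ x → Decides p (x ∷ γ) (P x)) → Decides (all l p) γ (∀[ x ∈ eval# l γ ] P x)
  all-decides {l = l} {p} {P} r = decided (reflects-⇔
    (mk⇔ (λ ¬e {x} i → stable x λ ¬q → ¬e (x , from (∈-collected {f = f}) (x , i , from (∈-choice-not (reflects (r x))) (refl , ¬q))))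
         (λ a (x , i) → let (y , j , k) = to (∈-collected {f = f}) i
                        in proj₂ (to (∈-choice-not (reflects (r y))) k) (a j)))
    (not-reflects (nonempty-reflects (collected f (eval# l γ)))))
    where
    f : ⟦ _ ⟧ → List ⟦ _ ⟧
    f x = choice (eval# p (x ∷ γ)) [] [ x ]
    ∈-choice-not : ∀ {A P : Set} {b} {x y : A} → Reflects P b → y ∈ choice b [] [ x ] ⇔ (y ≡ x × ¬ P)
    ∈-choice-not (ofʸ p) = mk⇔ (λ ()) (λ { (_ , q) → ⊥-elim (q p) })
    ∈-choice-not (ofⁿ p) = mk⇔ (λ { (here q) → q , p }) (λ { (q , _) → here q })
    stable : ∀ x → ¬ ¬ P x → P x
    stable x ¬¬q with eval# p (x ∷ γ) | reflects (r x)
    ... | _ | ofʸ q = q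
    ... | _ | ofⁿ q = ⊥-elim (¬¬q q)

iter-pred : ∀ i j → iter pred j i ≡ j ∸ i
iter-pred zero    j       = refl
iter-pred (suc i) zero    = trans (iter-pred i 0) (0∸n≡0 i)
iter-pred (suc i) (suc j) = iter-pred i j

∸-reflects : ∀ i j → Reflects (i < j) (isPositive (j ∸ i))
∸-reflects i j = reflects-⇔
  (mk⇔ (λ p → m∸n≢0⇒n<m {j} {i} λ eq → <-irrefl (sym eq) p) m<n⇒0<n∸m)
  (isPositive-reflects (j ∸ i))

less-decides : ∀ {z} i j → Decides (less {z}) (i ∷ j ∷ []) (i < j)
less-decides i j =
  decided (subst (λ k → Reflects (i < j) (isPositive k)) (sym (iter-pred i j)) (∸-reflects i j))

equal-decides : ∀ i j → Decides equal (i ∷ j ∷ []) (i ≡ j)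
equal-decides i j = decides-⇔
  (mk⇔ (λ (p , q) → ≤-antisym (≮⇒≥ q) (≮⇒≥ p)) (λ { refl → <-irrefl refl , <-irrefl refl }))
  (not-decides (call-decides (less-decides i j)) and-decides
   not-decides (call-decides (less-decides j i)))

==-decides : ∀ {Γ γ} {t u : Tm Γ N} → Decides (t == u) γ (eval# t γ ≡ eval# u γ)
==-decides = call-decides (equal-decides _ _)

-- The term computes z + 1 - y - x, which is positive exactly when y + x ≤ z. Subtraction loops over
-- the bounded `x` and `y`, and no sum has to be formed.
sum-decides : ∀ {Γ} {γ : Env Γ} {x y z : Tm Γ N} →
  Decides (positive (iterate x (iterate y (suc z) (dec (# 0))) (dec (# 0)))) γ
    (eval# y γ + eval# x γ ≤ eval# z γ)
sum-decides {γ = γ} {x} {y} {z} = decided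
  (subst (λ k → Reflects (j + i ≤ k′) (isPositive k)) (sym (iter-sum i j k′))
    (reflects-⇔ (mk⇔ ≤-pred s≤s) (∸-reflects (j + i) (suc k′))))
  where
  i  = eval# x γ
  j  = eval# y γ
  k′ = eval# z γ
  iter-sum : ∀ i j k → iter pred (iter pred (suc k) j) i ≡ suc k ∸ (j + i)
  iter-sum i j k = trans (iter-pred i (iter pred (suc k) j))
    (trans (cong (_∸ i) (iter-pred j (suc k))) (∸-+-assoc (suc k) j i))

abstract

  Bit : ℕ → List Bool → Set
  Bit i xs = T (eval# bit (i ∷ xs ∷ []))

  bit⇔ : ∀ {i xs} → Bit i xs ⇔ T (eval# bit (i ∷ xs ∷ []))
  bit⇔ = mk⇔ (λ x → x) (λ x → x)

  bit-decides : ∀ i xs → Decides bit (i ∷ xs ∷ []) (Bit i xs)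
  bit-decides i xs = bool-decides

Marked : ℕ → List (ℕ × Bool) → Set
Marked v m = ∃[ e ∈ m ] (v ≡ proj₁ e × T (proj₂ e))

marks-decides : ∀ v m → Decides marks (v ∷ m ∷ []) (Marked v m)
marks-decides v m = any-decides λ e → ==-decides and-decides bool-decides

iter-suc : ∀ {A : Set} (f : A → A) z n → iter f z (suc n) ≡ f (iter f z n)
iter-suc f z zero    = refl
iter-suc f z (suc n) = iter-suc f (f z) n

module Graphs (vertices : List ℕ) (G : List (List Bool)) where

  abstract

    Adjacent : ℕ → ℕ → Set
    Adjacent u v = T (eval# adjacent (u ∷ v ∷ G ∷ []))

    adjacent⇔ : ∀ {u v} → Adjacent u v ⇔ T (eval# adjacent (u ∷ v ∷ G ∷ []))
    adjacent⇔ = mk⇔ (λ x → x) (λ x → x)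

    adjacent-decides : ∀ u v → Decides adjacent (u ∷ v ∷ G ∷ []) (Adjacent u v)
    adjacent-decides u v = bool-decides

  Within : ℕ → ℕ → ℕ → Set
  Within a zero    v = v ∈ vertices × v ≡ a
  Within a (suc t) v = v ∈ vertices × (∃[ u ] (Within a t u × (u ≡ v ⊎ Adjacent u v)))

  within-members : ∀ a (f : List ℕ → List ℕ) z →
    (∀ {v} → v ∈ z ⇔ (v ∈ vertices × v ≡ a)) →
    (∀ acc {v} → v ∈ f acc ⇔ (v ∈ vertices × (∃[ u ∈ acc ] (u ≡ v ⊎ Adjacent u v)))) →
    ∀ t {v} → v ∈ iter f z t ⇔ Within a t v
  within-members a f z c g zero        = c
  within-members a f z c g (suc t) {v} = mk⇔
    (λ i → let (j , u , k , p) = to (g (iter f z t)) (subst (v ∈_) (iter-suc f z t) i)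
           in j , u , to (within-members a f z c g t) k , p)
    (λ (j , u , w , p) → subst (v ∈_) (sym (iter-suc f z t))
      (from (g (iter f z t)) (j , u , from (within-members a f z c g t) w , p)))

  module _ (t a : ℕ) where

    private
      γ : Env Ball
      γ = t ∷ a ∷ vertices ∷ G ∷ []

      neighbourhood-members : ∀ acc →
        Members neighbourhood (acc ∷ γ) (λ v → v ∈ vertices × (∃[ u ∈ acc ] (u ≡ v ⊎ Adjacent u v)))
      neighbourhood-members acc = select-members λ v → any-decides λ u →
        ==-decides or-decides call-decides (adjacent-decides u v)

      center-members : Members center γ (λ v → v ∈ vertices × v ≡ a)
      center-members = select-members λ v → ==-decides

    ball-members : Members ball γ (Within a t)
    ball-members = consists (within-members a (λ acc → eval# neighbourhood (acc ∷ γ)) (eval# center γ)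
      (members center-members) (λ acc → members (neighbourhood-members acc)) t)

  Closer : ℕ → ℕ → ℕ → Set
  Closer a u v = ∃[ t ∈ vertices ] (Within a t u × ¬ Within a t v)

  member-decides : ∀ v xs → Decides member (v ∷ xs ∷ []) (v ∈ xs)
  member-decides v xs = decides-⇔
    (mk⇔ (λ { (u , i , refl) → i }) (λ i → v , i , refl)) (any-decides λ u → ==-decides)

  within-decides : ∀ t a v →
    Decides member (v ∷ eval# ball (t ∷ a ∷ vertices ∷ G ∷ []) ∷ []) (Within a t v)
  within-decides t a v = decides-⇔ (members (ball-members t a)) (member-decides v _)

  closer-decides : ∀ a u v → Decides closer (u ∷ v ∷ a ∷ vertices ∷ G ∷ []) (Closer a u v)
  closer-decides a u v = any-decides λ t →
    call-decides (within-decides t a u) and-decides not-decides (call-decides (within-decides t a v))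

  Supports : ℕ → ℕ → ℕ → ℕ → ℕ → Set
  Supports a u x v y = Adjacent u v × (x < y ⊎ x ≡ 0 × y ≡ 0 × Closer a u v)

  supports-decides : ∀ a u x v y →
    Decides supports (u ∷ x ∷ v ∷ y ∷ a ∷ vertices ∷ G ∷ []) (Supports a u x v y)
  supports-decides a u x v y =
    call-decides (adjacent-decides u v) and-decides
    (call-decides (less-decides x y) or-decides
     zero-decides and-decides zero-decides and-decides call-decides (closer-decides a u v))

Cell : Set
Cell = ℕ × (Bool × (List (ℕ × Bool) × ℕ))

label : Cell → ℕ
label (x , _) = x

supported : Cell → Bool
supported (_ , β , _) = β

mask : Cell → List (ℕ × Bool)
mask (_ , _ , m , _) = m

payment : Cell → ℕ
payment (_ , _ , _ , c) = c

module Instances (vertices : List ℕ) (G : List (List Bool)) (S : List Bool)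
                 (a b root : ℕ) (f : List (ℕ × ℕ)) where

  open Graphs vertices G

  ForestAdjacent : ℕ → ℕ → Set
  ForestAdjacent u v = ¬ Bit u S × ¬ Bit v S × Adjacent u v

  forestAdjacent-decides : ∀ u v →
    Decides forestAdjacent (u ∷ v ∷ S ∷ G ∷ []) (ForestAdjacent u v)
  forestAdjacent-decides u v =
    not-decides (call-decides (bit-decides u S)) and-decides
    not-decides (call-decides (bit-decides v S)) and-decides
    call-decides (adjacent-decides u v)

  env : Env Instance
  env = a ∷ b ∷ f ∷ root ∷ S ∷ vertices ∷ G ∷ []

  -- Whatever settles support without the forest. Vertices of `S` are accounted for by masks
  -- instead, `a` and the root need no support, and guessed labels tell which vertices of `S`
  -- support `v`.
  SupportedLocally : ℕ → ℕ → Set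
  SupportedLocally v x = Bit v S ⊎ v ≡ a ⊎ v ≡ root ⊎
    (∃[ e ∈ f ] Supports a (proj₁ e) (proj₂ e) v x)

  supportedLocally-decides : ∀ v x → Decides supportedLocally (v ∷ x ∷ env) (SupportedLocally v x)
  supportedLocally-decides v x =
    call-decides (bit-decides v S) or-decides ==-decides or-decides ==-decides or-decides
    any-decides λ e → call-decides (supports-decides a _ _ _ _)

  -- Acceptance asks for a mark on every vertex of `S`. The second alternative lets `a`, which has
  -- no supporter, mark itself.
  SupportsKey : ℕ → ℕ → ℕ → Set
  SupportsKey s v x =
    (∃[ e ∈ f ] (proj₁ e ≡ s × Supports a v x (proj₁ e) (proj₂ e))) ⊎ (v ≡ a × s ≡ a)

  supportsKey-decides : ∀ s v x → Decides supportsKey (s ∷ v ∷ x ∷ env) (SupportsKey s v x)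
  supportsKey-decides s v x =
    (any-decides λ e → ==-decides and-decides call-decides (supports-decides a _ _ _ _)) or-decides
    ==-decides and-decides ==-decides

  Costs : ℕ → ℕ → Set
  Costs v x = x ≡ 0 × ¬ v ≡ a × ¬ v ≡ root

  costs-decides : ∀ v x → Decides costs (v ∷ x ∷ env) (Costs v x)
  costs-decides v x =
    zero-decides and-decides not-decides ==-decides and-decides not-decides ==-decides

  -- Flag, marks and payment are constrained on one side only: a state may claim less support than
  -- there is and pay more than it must. This is sound, and for completeness one generous state in
  -- the universe is enough.
  Initial : ℕ → Cell → Set
  Initial v s =
    (Bit v S → ∃[ e ∈ f ] (proj₁ e ≡ v × proj₂ e ≡ label s)) ×
    (v ≡ a ⊎ v ≡ b → label s ≡ 0) ×
    (T (supported s) → SupportedLocally v (label s)) ×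
    (∀[ k ∈ mask s ] (T (proj₂ k) → SupportsKey (proj₁ k) v (label s))) ×
    (Costs v (label s) → 0 < payment s)

  initial-decides : ∀ v s → Decides initial (v ∷ s ∷ env) (Initial v s)
  initial-decides v s =
    (call-decides (bit-decides v S) implies-decides
      any-decides λ e → ==-decides and-decides ==-decides) and-decides
    (==-decides or-decides ==-decides implies-decides zero-decides) and-decides
    (bool-decides implies-decides call-decides (supportedLocally-decides v (label s))) and-decides
    (all-decides λ k → bool-decides implies-decides
      call-decides (supportsKey-decides (proj₁ k) v (label s))) and-decides
    (call-decides (costs-decides v (label s)) implies-decides positive-decides)

  InForest : ℕ → Cell → ℕ → Cell → Set
  InForest u s v t = ForestAdjacent u v × Supports a u (label s) v (label t)

  inForest-decides : ∀ u s v t → Decides inForest (u ∷ s ∷ v ∷ t ∷ env) (InForest u s v t)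
  inForest-decides u s v t =
    call-decides (forestAdjacent-decides u v) and-decides
    call-decides (supports-decides a u _ v _)

  -- The third condition is the last chance of `v`: only `p` remains next to it, so its support is
  -- known already or comes from `p`. If `p` is the root, the latter is impossible.
  Merges : ℕ → ℕ → Cell → Cell → Cell → Set
  Merges p v s t st =
    label st ≡ label s ×
    (T (supported st) → T (supported s) ⊎ InForest v t p s) ×
    (T (supported t) ⊎ InForest p s v t) ×
    (∀[ k ∈ mask st ] (T (proj₂ k) → Marked (proj₁ k) (mask s) ⊎ Marked (proj₁ k) (mask t))) ×
    payment s + payment t ≤ payment st

  merges-decides : ∀ p v s t st → Decides merges (p ∷ v ∷ s ∷ t ∷ st ∷ env) (Merges p v s t st)
  merges-decides p v s t st =
    ==-decides and-decides
    (bool-decides implies-decides (bool-decides or-decides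
     call-decides (inForest-decides v t p s))) and-decides
    (bool-decides or-decides call-decides (inForest-decides p s v t)) and-decides
    (all-decides λ k → bool-decides implies-decides
      (call-decides (marks-decides (proj₁ k) (mask s)) or-decides
       call-decides (marks-decides (proj₁ k) (mask t)))) and-decides
    sum-decides

  Row : Set
  Row = ℕ × List Cell

  private
    rooted : ℕ → List Row → Env (N ▸ V Entry ▸ N ▸ V bool ▸ Matrix ▸ ∅)
    rooted v R = v ∷ R ∷ root ∷ S ∷ G ∷ []

  -- Without `abstract`, comparing types would normalise the terms.
  abstract

    mergeTable : ℕ → ℕ → List Cell → List Cell → List Cell → List Cell
    mergeTable p v Tp Tv U = eval# merge (p ∷ v ∷ Tp ∷ Tv ∷ U ∷ env)

    mergeTable-members : ∀ {p v Tp Tv U st} →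
      st ∈ mergeTable p v Tp Tv U ⇔ (st ∈ U × (∃[ s ∈ Tp ] ∃[ t ∈ Tv ] Merges p v s t st))
    mergeTable-members {p} {v} {Tp} {Tv} {U} = members selected
      where
      selected : Members merge (p ∷ v ∷ Tp ∷ Tv ∷ U ∷ env)
        (λ st → st ∈ U × (∃[ s ∈ Tp ] ∃[ t ∈ Tv ] Merges p v s t st))
      selected = select-members λ st → any-decides λ s → any-decides λ t →
        call-decides (merges-decides p v s t st)

    tableOf : ℕ → List Cell → List Cell
    tableOf v U = eval# table (v ∷ U ∷ env)

    tableOf-members : ∀ {v U st} → st ∈ tableOf v U ⇔ (st ∈ U × Initial v st)
    tableOf-members {v} {U} = members selected
      where
      selected : Members table (v ∷ U ∷ env) (λ st → st ∈ U × Initial v st)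
      selected = select-members λ st → call-decides (initial-decides v st)

    parentOf : ℕ → List Row → ℕ
    parentOf v R = eval# parent (rooted v R)

    parent-spec : ∀ v R → (∃[ e ∈ R ] (proj₁ e ≡ parentOf v R × ForestAdjacent (proj₁ e) v)) ⊎
                          (parentOf v R ≡ root × (∀[ e ∈ R ] ¬ ForestAdjacent (proj₁ e) v))
    parent-spec v R = go (eval# neighbours (rooted v R)) (members neighbours-members)
      where
      neighbours-members : Members neighbours (rooted v R) (λ e → e ∈ R × ForestAdjacent (proj₁ e) v)
      neighbours-members = select-members λ e → call-decides (forestAdjacent-decides (proj₁ e) v)
      none : ∀ {A : Set} {x : A} → ¬ x ∈ []
      none ()
      go : ∀ es → (∀ {e} → e ∈ es ⇔ (e ∈ R × ForestAdjacent (proj₁ e) v)) →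
           (∃[ e ∈ R ] (proj₁ e ≡ caseList root (λ x _ → proj₁ x) es × ForestAdjacent (proj₁ e) v)) ⊎
           (caseList root (λ x _ → proj₁ x) es ≡ root × (∀[ e ∈ R ] ¬ ForestAdjacent (proj₁ e) v))
      go []       m = inj₂ (refl , λ i x → none (from m (i , x)))
      go (e ∷ es) m = let (i , x) = to m (here refl) in inj₁ (e , i , refl , x)

  Leaf : ℕ → List Row → Set
  Leaf v R = ¬ v ≡ root × (∀[ e ∈ R ] (ForestAdjacent (proj₁ e) v → proj₁ e ≡ parentOf v R))

  abstract

    leaf-decides : ∀ v R → Decides leaf (rooted v R) (Leaf v R)
    leaf-decides v R = not-decides ==-decides and-decides
      all-decides λ e → call-decides (forestAdjacent-decides (proj₁ e) v) implies-decides ==-decides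

    leavesOf : List Row → List Cell → List Row
    leavesOf R U = eval# leaves (R ∷ U ∷ env)

    leavesOf-members : ∀ {R U e} → e ∈ leavesOf R U ⇔ (e ∈ R × Leaf (proj₁ e) R)
    leavesOf-members {R} {U} = members selected
      where
      selected : Members leaves (R ∷ U ∷ env) (λ e → e ∈ R × Leaf (proj₁ e) R)
      selected = select-members λ e → call-decides (leaf-decides (proj₁ e) R)

    eliminateFrom : List Cell → ℕ → ℕ → List Row → List Cell → Row → List Row
    eliminateFrom Tv v p R U e = eval# eliminateRow (e ∷ Tv ∷ v ∷ p ∷ R ∷ U ∷ env)

    eliminateFrom≡ : ∀ {Tv v p R U e} → eliminateFrom Tv v p R U e ≡
      choice (eval# equal (proj₁ e ∷ v ∷ [])) []
        [ choice (eval# equal (proj₁ e ∷ p ∷ []))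
            (proj₁ e , mergeTable (proj₁ e) v (proj₂ e) Tv U) e ]
    eliminateFrom≡ = refl

    step : List Cell → List Row → List Row
    step U R = eval# eliminateLeaf (R ∷ U ∷ env)

    step≡ : ∀ {U R} → step U R ≡
      caseList R (λ e _ → collected (eliminateFrom (proj₂ e) (proj₁ e) (parentOf (proj₁ e) R) R U) R)
        (leavesOf R U)
    step≡ = refl

    finalRows : List ℕ → List Cell → List Row
    finalRows nums U = eval# eliminated (nums ∷ U ∷ env)

    finalRows≡ : ∀ {nums U} → finalRows nums U ≡
      foldl (λ R _ → step U R) (collected (λ v → [ v , tableOf v U ]) nums) vertices
    finalRows≡ = refl

  Affordable : ℕ → Set
  Affordable c = 0 < c → ¬ Within a (pred c) b

  affordable-decides : ∀ c → Decides affordable (c ∷ env) (Affordable c)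
  affordable-decides c = positive-decides implies-decides
    not-decides (call-decides (within-decides (pred c) a b))

  Accepting : Cell → Set
  Accepting s =
    T (supported s) ×
    (∀[ v ∈ vertices ] (Bit v S → Marked v (mask s))) ×
    Affordable (payment s)

  Accepts : List ℕ → List Cell → Set
  Accepts nums U = ∃[ e ∈ finalRows nums U ] ∃[ s ∈ proj₂ e ] Accepting s

  abstract

    accepts-decides : ∀ nums U → Decides accepts (nums ∷ U ∷ env) (Accepts nums U)
    accepts-decides nums U = any-decides λ e → any-decides λ s →
      bool-decides and-decides
      (all-decides λ v → call-decides (bit-decides v S) implies-decides
        call-decides (marks-decides v (mask s))) and-decides
      call-decides (affordable-decides (payment s))

  -- All that the elimination uses of the graph and of the universe. `D` will be d(a,b). By
  -- `realise` the flag, the marks on `S` and the payment of a state can be changed at will within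
  -- the universe, as long as the payment stays within `D`.
  record Setting (U : List Cell) (D : ℕ) : Set₁ where
    field
      adjacent-sym    : ∀ {u v} → Adjacent u v → Adjacent v u
      adjacent-irrefl : ∀ {u} → ¬ Adjacent u u
      root-isolated   : ∀ {v} → ¬ Adjacent root v
      acyclic         : (P : ℕ → Set) → ∃ P →
        (∀ {v} → P v → ∃[ u ] ∃[ w ] (u ≢ w × P u × P w × ForestAdjacent u v × ForestAdjacent w v)) → ⊥
      realise         : ∀ {s} → s ∈ U → ∀ β (h : ℕ → Bool) {c} → c ≤ D →
        ∃[ m ] ((label s , β , m , c) ∈ U × (∀[ k ∈ m ] (T (proj₂ k) → T (h (proj₁ k)))) ×
                (∀ {v} → v ∈ vertices → Bit v S → T (h v) → Marked v m))
      affordable⇔     : ∀ c → Affordable c ⇔ c ≤ D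

-- Elimination of leaves

Unique-resp-↭ : ∀ {A : Set} {xs ys : List A} → xs ↭ ys → Unique xs → Unique ys
Unique-resp-↭ ↭-id           u = u
Unique-resp-↭ (prep x p)     (n ∷ u) = All-resp-↭ p n ∷ Unique-resp-↭ p u
Unique-resp-↭ (swap x y p)   ((n ∷ n′) ∷ n″ ∷ u) =
  ((n ∘ sym) ∷ All-resp-↭ p n″) ∷ All-resp-↭ p n′ ∷ Unique-resp-↭ p u
Unique-resp-↭ (↭-comp p q)   u = Unique-resp-↭ q (Unique-resp-↭ p u)

extract : ∀ {A : Set} {x : A} {xs} → x ∈ xs → ∃[ ys ] xs ↭ x ∷ ys
extract i with ∈-∃++ i
... | as , bs , refl = as ++ bs , shift _ as bs

ʳ++-↭ : ∀ {A : Set} (as cs : List A) → as ʳ++ cs ↭ as ++ cs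
ʳ++-↭ []       cs = ↭-id
ʳ++-↭ (z ∷ as) cs = ↭-trans (ʳ++-↭ as (z ∷ cs)) (shift z as cs)

module _ {A B : Set} (f : A → List B) where

  concatMap-↭ : ∀ {xs ys} → xs ↭ ys → concatMap f xs ↭ concatMap f ys
  concatMap-↭ ↭-id         = ↭-id
  concatMap-↭ (prep x p)   = ↭-++⁺ˡ (f x) (concatMap-↭ p)
  concatMap-↭ (swap {xs} x y p) =
    ↭-trans (exchange-++ (f x) (f y) (concatMap f xs))
            (↭-++⁺ˡ (f y) (↭-++⁺ˡ (f x) (concatMap-↭ p)))
    where
    exchange-++ : ∀ as bs (cs : List B) → as ++ bs ++ cs ↭ bs ++ as ++ cs
    exchange-++ []       bs cs = ↭-id
    exchange-++ (z ∷ as) bs cs =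
      ↭-trans (prep z (exchange-++ as bs cs)) (↭-sym (shift z bs (as ++ cs)))
  concatMap-↭ (↭-comp p q) = ↭-trans (concatMap-↭ p) (concatMap-↭ q)

  -- `collected` reverses the order, so rows are treated up to permutation, under which `Good` and
  -- `Invariant` are stable.
  collected-↭ : ∀ xs → collected f xs ↭ concatMap f xs
  collected-↭ xs = ↭-trans (go xs []) (subst (_↭ concatMap f xs) (sym (++-identityʳ _)) ↭-id)
    where
    go : ∀ xs acc → foldl (λ acc x → f x ʳ++ acc) acc xs ↭ concatMap f xs ++ acc
    go []       acc = ↭-id
    go (x ∷ xs) acc = ↭-trans (go xs (f x ʳ++ acc))
      (↭-trans (↭-++⁺ˡ (concatMap f xs) (ʳ++-↭ (f x) acc)) (rotate (f x) (concatMap f xs) acc))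
      where
      rotate : ∀ as bs (cs : List B) → bs ++ as ++ cs ↭ (as ++ bs) ++ cs
      rotate []       bs cs = ↭-id
      rotate (z ∷ as) bs cs = ↭-trans (shift z bs (as ++ cs)) (prep z (rotate as bs cs))

decides? : ∀ {Γ} {t : Tm Γ bool} {γ P} → Decides t γ P → Dec P
decides? {t = t} {γ} (decided r) = eval# t γ because r

choice-yes : ∀ {A P : Set} {β} {x y : A} → Reflects P β → P → choice β x y ≡ x
choice-yes (ofʸ _) p = refl
choice-yes (ofⁿ n) p = ⊥-elim (n p)

choice-no : ∀ {A P : Set} {β} {x y : A} → Reflects P β → ¬ P → choice β x y ≡ y
choice-no (ofʸ p) n = ⊥-elim (n p)
choice-no (ofⁿ _) n = refl

caseList-elim : ∀ {A B : Set} (Q : B → Set) {z} (g : A → List A → B) xs →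
                (xs ≡ [] → Q z) → (∀ {x} ys → x ∈ xs → Q (g x ys)) → Q (caseList z g xs)
caseList-elim Q g []       p q = p refl
caseList-elim Q g (x ∷ xs) p q = q xs (here refl)

module Elimination
  (vertices : List ℕ) (G : List (List Bool)) (S : List Bool) (a b root : ℕ) (f : List (ℕ × ℕ))
  {U : List Cell} {D : ℕ} (setting : Instances.Setting vertices G S a b root f U D) where

  open Graphs vertices G
  open Instances vertices G S a b root f
  open Setting setting

  -- A choice of states from the tables.  Elimination of a leaf preserves its
  -- existence.
  record Good (R : List Row) : Set where
    field
      σ         : ℕ → Cell
      chosen    : ∀[ e ∈ R ] σ (proj₁ e) ∈ proj₂ e
      fulfilled : ∀[ e ∈ R ] (T (supported (σ (proj₁ e))) ⊎
                  (∃[ e′ ∈ R ] InForest (proj₁ e′) (σ (proj₁ e′)) (proj₁ e) (σ (proj₁ e))))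
      marked    : ∀ {v} → v ∈ vertices → Bit v S → ∃[ e ∈ R ] Marked v (mask (σ (proj₁ e)))
      afforded  : sum (map (λ e → payment (σ (proj₁ e))) R) ≤ D

  open Good

  good-↭ : ∀ {R R′} → R ↭ R′ → Good R → Good R′
  good-↭ p g = record
    { σ         = σ g
    ; chosen    = λ i → chosen g (∈-resp-↭ (↭-sym p) i)
    ; fulfilled = λ i → move (fulfilled g (∈-resp-↭ (↭-sym p) i))
    ; marked    = λ i s → let (e , j , m) = marked g i s in e , ∈-resp-↭ p j , m
    ; afforded  = subst (_≤ D) (sum-↭ (↭-map⁺ (λ e → payment (σ g (proj₁ e))) p)) (afforded g)
    }
    where
    move : ∀ {A : Set} {B : Row → Set} → A ⊎ ∃∈ _ B → A ⊎ ∃∈ _ B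
    move (inj₁ x)           = inj₁ x
    move (inj₂ (e , j , x)) = inj₂ (e , ∈-resp-↭ p j , x)

  forest-sym : ∀ {u v} → ForestAdjacent u v → ForestAdjacent v u
  forest-sym (p , q , e) = q , p , adjacent-sym e

  update : (ℕ → Cell) → ℕ → Cell → ℕ → Cell
  update σ u s v with v ≟ u
  ... | yes _ = s
  ... | no _  = σ v

  set-same : ∀ σ u s → update σ u s u ≡ s
  set-same σ u s with u ≟ u
  ... | yes _  = refl
  ... | no u≢u = ⊥-elim (u≢u refl)

  set-other : ∀ σ u s {v} → v ≢ u → update σ u s v ≡ σ v
  set-other σ u s {v} v≢u with v ≟ u
  ... | yes eq = ⊥-elim (v≢u eq)
  ... | no _   = refl

  module Merging {p v : ℕ} {Tp Tv : List Cell} {R : List Row}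
    (unique : Unique (p ∷ v ∷ map proj₁ R)) {merged : List Cell}
    (merged-members : ∀ {st} → st ∈ merged ⇔ (st ∈ U × (∃[ s ∈ Tp ] ∃[ t ∈ Tv ] Merges p v s t st)))
    (Tp⊆U : ∀[ s ∈ Tp ] s ∈ U)
    (separate : ∀[ e ∈ R ] ¬ ForestAdjacent (proj₁ e) v) where

    private
      p≢v : p ≢ v
      p≢v = All.head (AllPairs.head unique)

      ≢p : ∀ {e} → e ∈ R → proj₁ e ≢ p
      ≢p i eq = All.lookup (All.tail (AllPairs.head unique)) (∈-map⁺ proj₁ i) (sym eq)

      ≢v : ∀ {e} → e ∈ R → proj₁ e ≢ v
      ≢v i eq = All.lookup (AllPairs.head (AllPairs.tail unique)) (∈-map⁺ proj₁ i) (sym eq)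

    sum-cong : ∀ {c c′ : Row → ℕ} → (∀[ e ∈ R ] c e ≡ c′ e) → sum (map c R) ≡ sum (map c′ R)
    sum-cong = go R
      where
      go : ∀ R {c c′ : Row → ℕ} → (∀[ e ∈ R ] c e ≡ c′ e) → sum (map c R) ≡ sum (map c′ R)
      go []      h = refl
      go (x ∷ R) h = cong₂ _+_ (h (here refl)) (go R (h ∘ there))

    private

      relabel : ∀ {u v x x′ y y′} → x ≡ x′ → y ≡ y′ →
                ForestAdjacent u v × Supports a u x v y → ForestAdjacent u v × Supports a u x′ v y′
      relabel refl refl i = i

    module _ (g : Good ((p , Tp) ∷ (v , Tv) ∷ R)) where

      private
        s t : Cell
        s = σ g p
        t = σ g v

        abstract

          h : ℕ → Bool
          h u = does (decides? (marks-decides u (mask s)) ⊎-dec decides? (marks-decides u (mask t)))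

          h-proof : ∀ u → Reflects (Marked u (mask s) ⊎ Marked u (mask t)) (h u)
          h-proof u = proof (decides? (marks-decides u (mask s)) ⊎-dec decides? (marks-decides u (mask t)))

          β : Bool
          β = does (T? (supported s) ⊎-dec decides? (inForest-decides v t p s))

          β-proof : Reflects (T (supported s) ⊎ InForest v t p s) β
          β-proof = proof (T? (supported s) ⊎-dec decides? (inForest-decides v t p s))

        total : payment s + (payment t + sum (map (λ e → payment (σ g (proj₁ e))) R)) ≤ D
        total = afforded g

        realised : _
        realised = realise (Tp⊆U (chosen g (here refl))) β h
          {payment s + payment t}
          (≤-trans (≤-trans (m≤m+n _ _) (≤-reflexive (+-assoc (payment s) (payment t) _))) total)

        -- The label of `p`, the strongest flag and marks that `Merges` permits, and the least
        -- payment that it permits.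
        st : Cell
        st = label s , β , proj₁ realised , payment s + payment t

        σ′ : ℕ → Cell
        σ′ = update (σ g) p st

        σ′-p : σ′ p ≡ st
        σ′-p = set-same (σ g) p st

        σ′-R : ∀ {e} → e ∈ R → σ′ (proj₁ e) ≡ σ g (proj₁ e)
        σ′-R i = set-other (σ g) p st (≢p i)

        labels : ∀ {e} → e ∈ R → label (σ g (proj₁ e)) ≡ label (σ′ (proj₁ e))
        labels i = cong label (sym (σ′-R i))

        label-p : label s ≡ label (σ′ p)
        label-p = cong label (sym σ′-p)

        -- A supporter of `v` among the rows must be `p`: `v` is not its own neighbour, and the rows
        -- in `R` are not adjacent to it.
        requirement : T (supported t) ⊎ InForest p s v t
        requirement with fulfilled g (there (here refl))
        ... | inj₁ x = inj₁ x
        ... | inj₂ (_ , here refl , x) = inj₂ x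
        ... | inj₂ (_ , there (here refl) , (_ , _ , e) , _) = ⊥-elim (adjacent-irrefl e)
        ... | inj₂ (_ , there (there i) , e , _) = ⊥-elim (separate i e)

        mergeable : Merges p v s t st
        mergeable = refl , from (reflects-T β-proof) , requirement ,
          (λ i x → from (reflects-T (h-proof _)) (proj₁ (proj₂ (proj₂ realised)) i x)) , ≤-refl

        Fulfilled : Row → Set
        Fulfilled e = T (supported (σ′ (proj₁ e))) ⊎
          (∃[ e′ ∈ (p , merged) ∷ R ] InForest (proj₁ e′) (σ′ (proj₁ e′)) (proj₁ e) (σ′ (proj₁ e)))

        fulfilled-p : Fulfilled (p , merged)
        fulfilled-p with fulfilled g (here refl)
        ... | inj₁ x = inj₁ (subst (T ∘ supported) (sym σ′-p) (to (reflects-T β-proof) (inj₁ x)))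
        ... | inj₂ (_ , here refl , (_ , _ , e) , _) = ⊥-elim (adjacent-irrefl e)
        ... | inj₂ (_ , there (here refl) , x) =
          inj₁ (subst (T ∘ supported) (sym σ′-p) (to (reflects-T β-proof) (inj₂ x)))
        ... | inj₂ (e , there (there i) , x) = inj₂ (e , there i , relabel (labels i) label-p x)

        fulfilled-R : ∀ {e} → e ∈ R → Fulfilled e
        fulfilled-R {e} j with fulfilled g (there (there j))
        ... | inj₁ x = inj₁ (subst (T ∘ supported) (sym (σ′-R j)) x)
        ... | inj₂ (_ , here refl , x) = inj₂ (_ , here refl , relabel label-p (labels j) x)
        ... | inj₂ (_ , there (here refl) , e′ , _) = ⊥-elim (separate j (forest-sym e′))
        ... | inj₂ (e′ , there (there i) , x) = inj₂ (e′ , there i , relabel (labels i) (labels j) x)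

        Marking : ℕ → Set
        Marking u = ∃[ e ∈ (p , merged) ∷ R ] Marked u (mask (σ′ (proj₁ e)))

        marking-p : ∀ {u} → u ∈ vertices → Bit u S → Marked u (mask s) ⊎ Marked u (mask t) → Marking u
        marking-p i x m = _ , here refl , subst (Marked _ ∘ mask) (sym σ′-p)
          (proj₂ (proj₂ (proj₂ realised)) i x (to (reflects-T (h-proof _)) m))

        marking : ∀ {u} → u ∈ vertices → Bit u S → Marking u
        marking {u} i x with marked g i x
        ... | _ , here refl , m = marking-p i x (inj₁ m)
        ... | _ , there (here refl) , m = marking-p i x (inj₂ m)
        ... | e , there (there j) , m = e , there j , subst (Marked u ∘ mask) (sym (σ′-R j)) m

      merge-good : Good ((p , merged) ∷ R)
      merge-good = record
        { σ         = σ′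
        ; chosen    = λ { (here refl) → subst (_∈ merged) (sym σ′-p)
                            (from merged-members
                              (proj₁ (proj₂ realised) , s , chosen g (here refl) ,
                               t , chosen g (there (here refl)) , mergeable))
                        ; {e} (there i) → subst (_∈ proj₂ e) (sym (σ′-R i)) (chosen g (there (there i))) }
        ; fulfilled = λ { (here refl) → fulfilled-p ; (there i) → fulfilled-R i }
        ; marked    = marking
        ; afforded  = ≤-trans (≤-reflexive (trans
            (cong₂ _+_ (cong payment σ′-p) (sum-cong λ i → cong payment (σ′-R i)))
            (+-assoc (payment s) (payment t) _))) total
        }

    module _ (g : Good ((p , merged) ∷ R)) where

      private
        st : Cell
        st = σ g p

        origin = to merged-members (chosen g (here refl))

        s t : Cell
        s = proj₁ (proj₂ origin)
        t = proj₁ (proj₂ (proj₂ (proj₂ origin)))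

        s∈Tp : s ∈ Tp
        s∈Tp = proj₁ (proj₂ (proj₂ origin))

        t∈Tv : t ∈ Tv
        t∈Tv = proj₁ (proj₂ (proj₂ (proj₂ (proj₂ origin))))

        mergeable : Merges p v s t st
        mergeable = proj₂ (proj₂ (proj₂ (proj₂ (proj₂ origin))))

        σ′ : ℕ → Cell
        σ′ = update (update (σ g) v t) p s

        σ′-p : σ′ p ≡ s
        σ′-p = set-same _ p s

        σ′-v : σ′ v ≡ t
        σ′-v = trans (set-other _ p s (p≢v ∘ sym)) (set-same (σ g) v t)

        σ′-R : ∀ {e} → e ∈ R → σ′ (proj₁ e) ≡ σ g (proj₁ e)
        σ′-R i = trans (set-other _ p s (≢p i)) (set-other (σ g) v t (≢v i))

        labels : ∀ {e} → e ∈ R → label (σ g (proj₁ e)) ≡ label (σ′ (proj₁ e))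
        labels i = cong label (sym (σ′-R i))

        label-p : label st ≡ label (σ′ p)
        label-p = trans (proj₁ mergeable) (cong label (sym σ′-p))

        R⁺ : List Row
        R⁺ = (p , Tp) ∷ (v , Tv) ∷ R

        Fulfilled : ℕ → Set
        Fulfilled u = T (supported (σ′ u)) ⊎
          (∃[ e′ ∈ R⁺ ] InForest (proj₁ e′) (σ′ (proj₁ e′)) u (σ′ u))

        fulfilled-p : Fulfilled p
        fulfilled-p with fulfilled g (here refl)
        ... | inj₂ (_ , here refl , (_ , _ , e) , _) = ⊥-elim (adjacent-irrefl e)
        ... | inj₂ (e , there i , x) = inj₂ (e , there (there i) , relabel (labels i) label-p x)
        ... | inj₁ x with proj₁ (proj₂ mergeable) x
        ...   | inj₁ y = inj₁ (subst (T ∘ supported) (sym σ′-p) y)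
        ...   | inj₂ y = inj₂ (_ , there (here refl) ,
                  relabel (cong label (sym σ′-v)) (cong label (sym σ′-p)) y)

        fulfilled-v : Fulfilled v
        fulfilled-v with proj₁ (proj₂ (proj₂ mergeable))
        ... | inj₁ y = inj₁ (subst (T ∘ supported) (sym σ′-v) y)
        ... | inj₂ y = inj₂ (_ , here refl , relabel (cong label (sym σ′-p)) (cong label (sym σ′-v)) y)

        fulfilled-R : ∀ {e} → e ∈ R → Fulfilled (proj₁ e)
        fulfilled-R {e} j with fulfilled g (there j)
        ... | inj₁ x = inj₁ (subst (T ∘ supported) (sym (σ′-R j)) x)
        ... | inj₂ (_ , here refl , x) = inj₂ (_ , here refl , relabel label-p (labels j) x)
        ... | inj₂ (e′ , there i , x) = inj₂ (e′ , there (there i) , relabel (labels i) (labels j) x)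

        marking : ∀ {u} → u ∈ vertices → Bit u S → ∃[ e ∈ R⁺ ] Marked u (mask (σ′ (proj₁ e)))
        marking {u} i x with marked g i x
        ... | e , there j , m = e , there (there j) , subst (Marked u ∘ mask) (sym (σ′-R j)) m
        ... | _ , here refl , (k , j , refl , y) with proj₁ (proj₂ (proj₂ (proj₂ mergeable))) j y
        ...   | inj₁ m = _ , here refl , subst (Marked u ∘ mask) (sym σ′-p) m
        ...   | inj₂ m = _ , there (here refl) , subst (Marked u ∘ mask) (sym σ′-v) m

      -- Membership in the merged table names the states of `p` and `v` from which `st` arose. With
      -- these the total payment does not increase, since `st` pays for both.
      unmerge-good : Good R⁺
      unmerge-good = record
        { σ         = σ′
        ; chosen    = λ { (here refl) → subst (_∈ Tp) (sym σ′-p) s∈Tp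
                        ; (there (here refl)) → subst (_∈ Tv) (sym σ′-v) t∈Tv
                        ; {e} (there (there i)) → subst (_∈ proj₂ e) (sym (σ′-R i)) (chosen g (there i)) }
        ; fulfilled = λ { (here refl) → fulfilled-p ; (there (here refl)) → fulfilled-v
                        ; (there (there i)) → fulfilled-R i }
        ; marked    = marking
        ; afforded  = begin
            payment (σ′ p) + (payment (σ′ v) + sum (map (λ e → payment (σ′ (proj₁ e))) R))
              ≡⟨ cong₂ _+_ (cong payment σ′-p)
                   (cong₂ _+_ (cong payment σ′-v) (sum-cong λ i → cong payment (σ′-R i))) ⟩
            payment s + (payment t + rest)  ≡⟨ sym (+-assoc (payment s) (payment t) rest) ⟩
            payment s + payment t + rest    ≤⟨ +-monoˡ-≤ rest (proj₂ (proj₂ (proj₂ (proj₂ mergeable)))) ⟩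
            payment st + rest               ≤⟨ afforded g ⟩
            D                               ∎
        }
        where
        open ≤-Reasoning
        rest = sum (map (λ e → payment (σ g (proj₁ e))) R)

  -- `rooted` guarantees that the fallback parent of an isolated leaf is a row, and `tables` is what
  -- `realise` asks of the states.
  record Invariant (R : List Row) : Set where
    field
      unique : Unique (map proj₁ R)
      rooted : root ∈ map proj₁ R
      tables : ∀[ e ∈ R ] ∀[ s ∈ proj₂ e ] s ∈ U

  open Invariant

  invariant-↭ : ∀ {R R′} → R ↭ R′ → Invariant R → Invariant R′
  invariant-↭ p I = record
    { unique = Unique-resp-↭ (↭-map⁺ proj₁ p) (unique I)
    ; rooted = ∈-resp-↭ (↭-map⁺ proj₁ p) (rooted I)
    ; tables = λ i → tables I (∈-resp-↭ (↭-sym p) i)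
    }

  module _ {R : List Row} (I : Invariant R) where

    module _ {v Tv} (i : (v , Tv) ∈ R) (leaf : Leaf v R) where

      private
        p : ℕ
        p = parentOf v R

        p∈R : ∃[ Tp ] (p , Tp) ∈ R
        p∈R with parent-spec v R
        ... | inj₁ ((_ , Tp) , j , eq , _) = Tp , subst (λ q → (q , Tp) ∈ R) eq j
        ... | inj₂ (eq , _) with ∈-map⁻ proj₁ (rooted I)
        ...   | (_ , Tp) , j , eq′ = Tp , subst (λ q → (q , Tp) ∈ R) (trans (sym eq′) (sym eq)) j

        p≢v : p ≢ v
        p≢v eq with parent-spec v R
        ... | inj₁ (_ , _ , eq′ , _ , _ , e) =
          adjacent-irrefl (subst (λ u → Adjacent u v) (trans eq′ eq) e)
        ... | inj₂ (eq′ , _) = proj₁ leaf (trans (sym eq) eq′)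

        Tp : List Cell
        Tp = proj₁ p∈R

        split : ∃[ R′ ] R ↭ (p , Tp) ∷ (v , Tv) ∷ R′
        split with extract (proj₂ p∈R)
        ... | R₁ , q with extract (other (∈-resp-↭ q i))
          where
          other : ∀ {R₁} → (v , Tv) ∈ (p , Tp) ∷ R₁ → (v , Tv) ∈ R₁
          other (here eq) = ⊥-elim (p≢v (cong proj₁ (sym eq)))
          other (there j) = j
        ...   | R₂ , q′ = R₂ , ↭-trans q (prep _ q′)

        R′ : List Row
        R′ = proj₁ split

        merged : List Cell
        merged = mergeTable p v Tp Tv U

        unique-split : Unique (p ∷ v ∷ map proj₁ R′)
        unique-split = Unique-resp-↭ (↭-map⁺ proj₁ (proj₂ split)) (unique I)

        from-split : ∀ {e} → e ∈ (p , Tp) ∷ (v , Tv) ∷ R′ → e ∈ R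
        from-split = ∈-resp-↭ (↭-sym (proj₂ split))

        R′≢p : ∀ {e} → e ∈ R′ → proj₁ e ≢ p
        R′≢p j eq = All.lookup (All.tail (AllPairs.head unique-split)) (∈-map⁺ proj₁ j) (sym eq)

        R′≢v : ∀ {e} → e ∈ R′ → proj₁ e ≢ v
        R′≢v j eq = All.lookup (AllPairs.head (AllPairs.tail unique-split)) (∈-map⁺ proj₁ j) (sym eq)

        separate : ∀[ e ∈ R′ ] ¬ ForestAdjacent (proj₁ e) v
        separate j x = R′≢p j (proj₂ leaf (from-split (there (there j))) x)

        row : Row → List Row
        row = eliminateFrom Tv v p R U

        row-v : row (v , Tv) ≡ []
        row-v = trans eliminateFrom≡ (choice-yes (reflects (equal-decides v v)) refl)

        row-p : row (p , Tp) ≡ [ p , merged ]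
        row-p = trans eliminateFrom≡ (trans (choice-no (reflects (equal-decides p v)) p≢v)
                      (cong [_] (choice-yes (reflects (equal-decides p p)) refl)))

        row-R′ : ∀ {e} → e ∈ R′ → row e ≡ [ e ]
        row-R′ {e} j = trans eliminateFrom≡
          (trans (choice-no (reflects (equal-decides (proj₁ e) v)) (R′≢v j))
                 (cong [_] (choice-no (reflects (equal-decides (proj₁ e) p)) (R′≢p j))))

        rows : ∀ R″ → (∀ {e} → e ∈ R″ → row e ≡ [ e ]) → concatMap row R″ ≡ R″
        rows []       h = refl
        rows (e ∷ R″) h = cong₂ _++_ (h (here refl)) (rows R″ (h ∘ there))

      eliminatedList : List Row
      eliminatedList = collected (eliminateFrom Tv v (parentOf v R) R U) R

      eliminate-↭ : eliminatedList ↭ (p , merged) ∷ R′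
      eliminate-↭ = ↭-trans (collected-↭ row R) (↭-trans (concatMap-↭ row (proj₂ split))
        (subst (_↭ (p , merged) ∷ R′)
          (sym (cong₂ _++_ row-p (cong₂ _++_ row-v (rows R′ row-R′)))) ↭-id))

      private
        module Merge = Merging {Tp = Tp} {Tv} unique-split
          mergeTable-members (tables I (from-split (here refl))) separate

      eliminate-length : length R ≡ suc (length (eliminatedList))
      eliminate-length = trans (↭-length (proj₂ split)) (cong suc (sym (↭-length eliminate-↭)))

      eliminate-good : Good R ⇔ Good (eliminatedList)
      eliminate-good = mk⇔
        (λ g → good-↭ (↭-sym eliminate-↭) (Merge.merge-good (good-↭ (proj₂ split) g)))
        (λ g → good-↭ (↭-sym (proj₂ split)) (Merge.unmerge-good (good-↭ eliminate-↭ g)))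

      eliminate-invariant : Invariant (eliminatedList)
      eliminate-invariant = invariant-↭ (↭-sym eliminate-↭) record
        { unique = All.tail (AllPairs.head unique-split) ∷ AllPairs.tail (AllPairs.tail unique-split)
        ; rooted = drop-v (∈-resp-↭ (↭-map⁺ proj₁ (proj₂ split)) (rooted I))
        ; tables = λ { (here refl) j → proj₁ (to mergeTable-members j)
                     ; (there j) → tables I (from-split (there (there j))) }
        }
        where
        drop-v : root ∈ p ∷ v ∷ map proj₁ R′ → root ∈ p ∷ map proj₁ R′
        drop-v (here eq)         = here eq
        drop-v (there (here eq)) = ⊥-elim (proj₁ leaf (sym eq))
        drop-v (there (there j)) = there j

    -- Otherwise every remaining vertex other than the root has a remaining neighbour besides its
    -- parent, and the parent is then a neighbour too. The root is isolated and so never among them,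
    -- which contradicts `acyclic`. Two rows ensure that some vertex is not the root.
    leaf-exists : 2 ≤ length R → (∀[ e ∈ R ] ¬ Leaf (proj₁ e) R) → ⊥
    leaf-exists l none = acyclic P (nonroot R l (unique I)) twoNeighbours
      where
      P : ℕ → Set
      P v = v ∈ map proj₁ R × v ≢ root

      nonroot : ∀ R → 2 ≤ length R → Unique (map proj₁ R) → ∃[ v ] (v ∈ map proj₁ R × v ≢ root)
      nonroot (x ∷ [])     (s≤s ()) _
      nonroot (x ∷ y ∷ R) _ ((n ∷ _) ∷ _) with proj₁ x ≟ root
      ... | no x≢root = proj₁ x , here refl , x≢root
      ... | yes eq    = proj₁ y , there (here refl) , λ eq′ → n (trans eq (sym eq′))

      inP : ∀ {v e} → e ∈ R → ForestAdjacent (proj₁ e) v → P (proj₁ e)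
      inP {v} j (_ , _ , x) = ∈-map⁺ proj₁ j , λ eq → root-isolated (subst (λ u → Adjacent u v) eq x)

      another? : ∀ v → Dec (∃[ e ∈ R ] (ForestAdjacent (proj₁ e) v × proj₁ e ≢ parentOf v R))
      another? v = map′ (λ k → find k) (λ (e , j , x) → lose j x)
        (Any.any? (λ e → decides? (forestAdjacent-decides (proj₁ e) v) ×-dec ¬? (proj₁ e ≟ parentOf v R)) R)

      twoNeighbours : ∀ {v} → P v →
               ∃[ u ] ∃[ w ] (u ≢ w × P u × P w × ForestAdjacent u v × ForestAdjacent w v)
      twoNeighbours {v} (j , v≢root) with another? v
      ... | no ¬x =
        let (e , k , eq) = ∈-map⁻ proj₁ j
        in ⊥-elim (none k (subst (λ v → Leaf v R) eq
             (v≢root , λ {e} m x → stable e m x)))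
        where
        stable : ∀ e → e ∈ R → ForestAdjacent (proj₁ e) v → proj₁ e ≡ parentOf v R
        stable e m x with proj₁ e ≟ parentOf v R
        ... | yes eq = eq
        ... | no neq = ⊥-elim (¬x (e , m , x , neq))
      ... | yes (e , k , x , neq) with parent-spec v R
      ...   | inj₂ (_ , isolated) = ⊥-elim (isolated k x)
      ...   | inj₁ (e′ , k′ , eq , x′) =
        proj₁ e , proj₁ e′ , (λ eq′ → neq (trans eq′ eq)) , inP k x , inP k′ x′ , x , x′

    step-correct : 2 ≤ length R →
      Invariant (step U R) × length R ≡ suc (length (step U R)) × (Good R ⇔ Good (step U R))
    step-correct l = subst Q (sym step≡) (caseList-elim Q
      (λ e _ → collected (eliminateFrom (proj₂ e) (proj₁ e) (parentOf (proj₁ e) R) R U) R)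
      (leavesOf R U)
      (λ eq → ⊥-elim (leaf-exists l λ {e} i leaf →
        nothing∈[] (subst (e ∈_) eq (from leavesOf-members (i , leaf)))))
      (λ {e} _ i → let (j , leaf) = to leavesOf-members i
                   in eliminate-invariant j leaf , eliminate-length j leaf , eliminate-good j leaf))
      where
      Q : List Row → Set
      Q R′ = Invariant R′ × length R ≡ suc (length R′) × (Good R ⇔ Good R′)
      nothing∈[] : ∀ {A : Set} {x : A} → ¬ x ∈ []
      nothing∈[] ()

  steps-correct : ∀ (ids : List ℕ) {R} → Invariant R → length R ≡ suc (length ids) →
    let R′ = foldl (λ R _ → step U R) R ids in
    Invariant R′ × length R′ ≡ 1 × (Good R ⇔ Good R′)
  steps-correct []        I eq = I , eq , mk⇔ (λ g → g) (λ g → g)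
  steps-correct (_ ∷ ids) I eq =
    let (I′ , eq′ , e) = step-correct I (≤-trans (s≤s (s≤s z≤n)) (≤-reflexive (sym eq)))
        (I″ , l , e′)  = steps-correct ids I′ (suc-injective (trans (sym eq′) eq))
    in I″ , l , mk⇔ (to e′ ∘ to e) (from e ∘ from e′)

  -- A single row cannot be supported by another one, so `fulfilled` comes down to the flag.
  final-good : ∀ {R} → Invariant R → length R ≡ 1 →
               (∃[ e ∈ R ] ∃[ s ∈ proj₂ e ] Accepting s) ⇔ Good R
  final-good {(r , Tr) ∷ []} I eq = mk⇔ forward backward
    where
    forward : (∃[ e ∈ (r , Tr) ∷ [] ] ∃[ s ∈ proj₂ e ] Accepting s) → Good ((r , Tr) ∷ [])
    forward (_ , here refl , s , i , x , m , c) = record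
      { σ         = λ _ → s
      ; chosen    = λ { (here refl) → i }
      ; fulfilled = λ _ → inj₁ x
      ; marked    = λ j y → _ , here refl , m j y
      ; afforded  = subst (_≤ D) (sym (+-identityʳ _)) (to (affordable⇔ _) c)
      }
    backward : Good ((r , Tr) ∷ []) → ∃[ e ∈ (r , Tr) ∷ [] ] ∃[ s ∈ proj₂ e ] Accepting s
    backward g = _ , here refl , σ g r , chosen g (here refl) , sat (fulfilled g (here refl)) ,
      (λ i y → mark (marked g i y)) ,
      from (affordable⇔ _) (subst (_≤ D) (+-identityʳ _) (afforded g))
      where
      sat : T (supported (σ g r)) ⊎
            (∃[ e′ ∈ (r , Tr) ∷ [] ] InForest (proj₁ e′) (σ g (proj₁ e′)) r (σ g r)) →
            T (supported (σ g r))
      sat (inj₁ x) = x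
      sat (inj₂ (_ , here refl , (_ , _ , x) , _)) = ⊥-elim (adjacent-irrefl x)
      mark : ∀ {v} → ∃[ e ∈ (r , Tr) ∷ [] ] Marked v (mask (σ g (proj₁ e))) → Marked v (mask (σ g r))
      mark (_ , here refl , m) = m

  initialRows : List ℕ → List Row
  initialRows nums = map (λ v → v , tableOf v U) nums

  module _ (nums : List ℕ) (uniqueNums : Unique nums) (root∈nums : root ∈ nums)
           (length-nums : length nums ≡ suc (length vertices)) where

    private
      ids-initialRows : ∀ xs → map proj₁ (initialRows xs) ≡ xs
      ids-initialRows []       = refl
      ids-initialRows (x ∷ xs) = cong (x ∷_) (ids-initialRows xs)

      entry : ℕ → List Row
      entry v = [ v , tableOf v U ]

      concatMap-entry : ∀ xs → concatMap entry xs ≡ initialRows xs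
      concatMap-entry []       = refl
      concatMap-entry (x ∷ xs) = cong (_ ∷_) (concatMap-entry xs)

      entries-↭ : collected entry nums ↭ initialRows nums
      entries-↭ = subst (collected entry nums ↭_) (concatMap-entry nums) (collected-↭ entry nums)

      initial-invariant : Invariant (initialRows nums)
      initial-invariant = record
        { unique = subst Unique (sym (ids-initialRows nums)) uniqueNums
        ; rooted = subst (root ∈_) (sym (ids-initialRows nums)) root∈nums
        ; tables = λ i j → tables-⊆ i j
        }
        where
        tables-⊆ : ∀ {e s} → e ∈ initialRows nums → s ∈ proj₂ e → s ∈ U
        tables-⊆ i j with ∈-map⁻ (λ v → v , tableOf v U) i
        ... | v , _ , refl = proj₁ (to tableOf-members j)

    accepts⇔good : Accepts nums U ⇔ Good (initialRows nums)
    accepts⇔good =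
      let (I , l , e) = steps-correct vertices (invariant-↭ (↭-sym entries-↭) initial-invariant)
                          (trans (↭-length entries-↭) (trans (length-map _ nums) length-nums))
      in mk⇔ (λ x → good-↭ entries-↭ (from e (to (final-good I l) (subst Found finalRows≡ x))))
             (λ g → subst Found (sym finalRows≡)
                      (from (final-good I l) (to e (good-↭ (↭-sym entries-↭) g))))
      where
      Found : List Row → Set
      Found R = ∃[ e ∈ R ] ∃[ s ∈ proj₂ e ] Accepting s

-- States and labellings

nthIn : {A : Set} → A → List A → ℕ → A
nthIn z xs i = caseList z (λ x _ → x) (iter (caseList [] (λ _ ys → ys)) xs i)

nthIn-tabulate : ∀ {A : Set} (z : A) {n} (g : Fin n → A) i →
  (∃[ j ] (toℕ j ≡ i × nthIn z (tabulate g) i ≡ g j)) ⊎ nthIn z (tabulate g) i ≡ z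
nthIn-tabulate z {zero}  g i = inj₂ (nthIn-[] i)
  where
  nthIn-[] : ∀ i → nthIn z [] i ≡ z
  nthIn-[] zero    = refl
  nthIn-[] (suc i) = nthIn-[] i
nthIn-tabulate z {suc n} g zero = inj₁ (zero , refl , refl)
nthIn-tabulate z {suc n} g (suc i) with nthIn-tabulate z (g ∘ suc) i
... | inj₁ (j , eq , eq′) = inj₁ (suc j , cong suc eq , eq′)
... | inj₂ eq             = inj₂ eq

nthIn-toℕ : ∀ {A : Set} (z : A) {n} (g : Fin n → A) j → nthIn z (tabulate g) (toℕ j) ≡ g j
nthIn-toℕ z g zero    = refl
nthIn-toℕ z g (suc j) = nthIn-toℕ z (g ∘ suc) j

unique⇒length≤sum : ∀ (c : ℕ → ℕ) {xs ys} → Unique xs → (∀ {x} → x ∈ xs → x ∈ ys × 0 < c x) →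
                    length xs ≤ sum (map c ys)
unique⇒length≤sum c {xs} {ys} u h = ≤-trans
  (unique⇒length≤ u λ i → let (j , p) = h i in ∈-filter⁺ (λ y → 0 <? c y) j p) (count (λ y → 0 <? c y) (λ p → p) ys)
  where
  count : ∀ {P : ℕ → Set} (P? : ∀ x → Dec (P x)) → (∀ {x} → P x → 0 < c x) →
          ∀ ys → length (filter P? ys) ≤ sum (map c ys)
  count P? h []       = z≤n
  count P? h (y ∷ ys) with P? y
  ... | yes p = +-mono-≤ (h p) (count P? h ys)
  ... | no  p = ≤-trans (count P? h ys) (m≤n+m _ (c y))

sum≡length-filter : ∀ {P : ℕ → Set} (P? : ∀ x → Dec (P x)) xs →
                    sum (map (λ x → choice (does (P? x)) 1 0) xs) ≡ length (filter P? xs)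
sum≡length-filter P? [] = refl
sum≡length-filter P? (x ∷ xs) with P? x
... | yes _ = cong suc (sum≡length-filter P? xs)
... | no _  = sum≡length-filter P? xs

tabulateOn : {A : Set} → (ℕ → A) → List ℕ → List (ℕ × A)
tabulateOn h = map (λ v → v , h v)

-- The tests on numbers and the notions of the graph

module Correctness {n : ℕ} (graph : Graph (Fin n)) (separator : Subset n)
  (connected : Connected graph) (forest : Forest (graph − separator)) where

  vertices : List ℕ
  vertices = downFrom n

  G : List (List Bool)
  G = tabulate λ u → tabulate λ v → adj graph u v

  S : List Bool
  S = tabulate (lookup separator)

  open Graphs vertices G
  open Distances graph connected

  bit-toℕ : ∀ {i} → Bit (toℕ i) S ⇔ T (lookup separator i)
  bit-toℕ {i} = mk⇔ (λ x → subst T eq (to bit⇔ x)) (λ x → from bit⇔ (subst T (sym eq) x))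
    where eq = nthIn-toℕ false (lookup separator) i

  bit-inv : ∀ {v} → Bit v S → ∃[ i ] (toℕ i ≡ v × T (lookup separator i))
  bit-inv {v} x with nthIn-tabulate false (lookup separator) v
  ... | inj₁ (i , eq , eq′) = i , eq , subst T eq′ (to bit⇔ x)
  ... | inj₂ eq             = ⊥-elim (subst T eq (to bit⇔ x))

  adjacent-toℕ : ∀ {i j} → Adjacent (toℕ i) (toℕ j) ⇔ Adj graph i j
  adjacent-toℕ {i} {j} = mk⇔ (λ x → subst T eq (to adjacent⇔ x)) (λ x → from adjacent⇔ (subst T (sym eq) x))
    where
    eq : nthIn false (nthIn [] G (toℕ i)) (toℕ j) ≡ adj graph i j
    eq = trans (cong (λ row → nthIn false row (toℕ j)) (nthIn-toℕ [] (λ u → tabulate λ v → adj graph u v) i))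
               (nthIn-toℕ false (adj graph i) j)

  adjacent-inv : ∀ {u v} → Adjacent u v → ∃[ i ] ∃[ j ] (toℕ i ≡ u × toℕ j ≡ v × Adj graph i j)
  adjacent-inv {u} {v} x = row (nthIn-tabulate [] (λ u → tabulate λ v → adj graph u v) u)
    where
    x′ : T (nthIn false (nthIn [] G u) v)
    x′ = to adjacent⇔ x
    no-row : ∀ v → nthIn false [] v ≡ false
    no-row zero    = refl
    no-row (suc v) = no-row v
    row : _ → ∃[ i ] ∃[ j ] (toℕ i ≡ u × toℕ j ≡ v × Adj graph i j)
    row (inj₂ eq) = ⊥-elim (subst T (trans (cong (λ row → nthIn false row v) eq) (no-row v)) x′)
    row (inj₁ (i , eq , eq′)) with nthIn-tabulate false (adj graph i) v
    ... | inj₂ eq″ = ⊥-elim (subst T (trans (cong (λ row → nthIn false row v) eq′) eq″) x′)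
    ... | inj₁ (j , eq″ , eq‴) =
      i , j , eq , eq″ , subst T (trans (cong (λ row → nthIn false row v) eq′) eq‴) x′

  toℕ∈vertices : ∀ {i : Fin n} → toℕ i ∈ vertices
  toℕ∈vertices = ∈-downFrom⁺ (toℕ<n _)

  vertex : ∀ {v} → v ∈ vertices → ∃[ i ] toℕ i ≡ v
  vertex j = let l = ∈-downFrom⁻ j in fromℕ< l , toℕ-fromℕ< l

  module _ (a : Fin n) where

    within⇒dist : ∀ t {v : Fin n} → Within (toℕ a) t (toℕ v) → dist a v ≤ t
    within⇒dist zero    (_ , eq) = ≤-reflexive (trans (cong (dist a) (toℕ-injective eq)) (dist-refl a))
    within⇒dist (suc t) (_ , u , w , inj₁ refl) = m≤n⇒m≤1+n (within⇒dist t w)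
    within⇒dist (suc t) {v} (_ , u , w , inj₂ x) with adjacent-inv x
    ... | i , j , refl , eq , e = begin
      dist a v                 ≡⟨ cong (dist a) (sym (toℕ-injective eq)) ⟩
      dist a j                 ≤⟨ dist≤ (walk Q ◅◅ e ◅ ε) ⟩
      len (walk Q ◅◅ e ◅ ε)    ≡⟨ len-◅◅ (walk Q) (e ◅ ε) ⟩
      lengthᴾ Q + 1            ≡⟨ +-comm (lengthᴾ Q) 1 ⟩
      suc (lengthᴾ Q)          ≡⟨ cong suc (proj₂ (geodesic a i)) ⟩
      suc (dist a i)           ≤⟨ s≤s (within⇒dist t w) ⟩
      suc t                    ∎
      where
      open ≤-Reasoning
      Q = proj₁ (geodesic a i)

    walk⇒within : ∀ t {u v} (p : Walk graph u v) → Within (toℕ a) t (toℕ u) →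
                  Within (toℕ a) (t + len {G = graph} p) (toℕ v)
    walk⇒within t {u} ε w = subst (λ t → Within (toℕ a) t (toℕ u)) (sym (+-identityʳ t)) w
    walk⇒within t {v = v} (e ◅ p) w =
      subst (λ t → Within (toℕ a) t (toℕ v)) (sym (+-suc t (len {G = graph} p)))
        (walk⇒within (suc t) p (toℕ∈vertices , _ , w , inj₂ (from adjacent-toℕ e)))

    within-mono : ∀ {s t} {v : Fin n} → s ≤ t → Within (toℕ a) s (toℕ v) → Within (toℕ a) t (toℕ v)
    within-mono {t = zero}  z≤n w = w
    within-mono {s} {suc t} l w with m≤n⇒m<n∨m≡n l
    ... | inj₁ (s≤s l′) = toℕ∈vertices , _ , within-mono l′ w , inj₁ refl
    ... | inj₂ refl     = w

    within⇔ : ∀ {t} {v : Fin n} → Within (toℕ a) t (toℕ v) ⇔ dist a v ≤ t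
    within⇔ {t} {v} = mk⇔ (within⇒dist t) λ l →
      let (P , eq) = geodesic a v in
      within-mono (≤-trans (≤-reflexive eq) l) (walk⇒within 0 (walk P) (toℕ∈vertices , refl))

    closer⇔ : ∀ {u v : Fin n} → Closer (toℕ a) (toℕ u) (toℕ v) ⇔ dist a u < dist a v
    closer⇔ {u} {v} = mk⇔
      (λ (t , _ , w , ¬w) → ≤-trans (s≤s (to within⇔ w)) (≰⇒> (¬w ∘ from within⇔)))
      -- The separating radius is the distance of `u`, which is below n and therefore among the
      -- vertices.
      (λ l → dist a u , ∈-downFrom⁺ (dist<n a u) , from within⇔ ≤-refl ,
             λ w → <-irrefl refl (≤-trans l (to within⇔ w)))

  InSupport : Fin n → Fin n → ℕ → Fin n → ℕ → Set
  InSupport a u x v y = Adj graph u v × (x < y ⊎ x ≡ 0 × y ≡ 0 × dist a u < dist a v)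

  supports⇒ : ∀ {a u x v y} → Supports (toℕ a) u x (toℕ v) y →
              ∃[ i ] (toℕ i ≡ u × InSupport a i x v y)
  supports⇒ {a} {v = v} (e , s) with adjacent-inv e
  ... | i , j , refl , eq , e′ = i , refl , subst (Adj graph i) (toℕ-injective eq) e′ , nearer s
    where
    nearer : ∀ {x y} → x < y ⊎ x ≡ 0 × y ≡ 0 × Closer (toℕ a) (toℕ i) (toℕ v) →
             x < y ⊎ x ≡ 0 × y ≡ 0 × dist a i < dist a v
    nearer (inj₁ l) = inj₁ l
    nearer (inj₂ (p , q , c)) = inj₂ (p , q , to (closer⇔ a) c)

  ⇒supports : ∀ {a u x v y} → InSupport a u x v y → Supports (toℕ a) (toℕ u) x (toℕ v) y
  ⇒supports {a} (e , inj₁ l)           = from adjacent-toℕ e , inj₁ l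
  ⇒supports {a} (e , inj₂ (p , q , l)) = from adjacent-toℕ e , inj₂ (p , q , from (closer⇔ a) l)

  adjacent-sym : ∀ {u v} → Adjacent u v → Adjacent v u
  adjacent-sym x with adjacent-inv x
  ... | i , j , refl , refl , e = from adjacent-toℕ (Adj-sym {G = graph} e)

  adjacent-irrefl : ∀ {u} → ¬ Adjacent u u
  adjacent-irrefl x with adjacent-inv x
  ... | i , j , refl , eq , e = Adj-irrefl {G = graph} (subst (Adj graph i) (toℕ-injective eq) e)

  root-isolated : ∀ {v} → ¬ Adjacent n v
  root-isolated x with adjacent-inv x
  ... | i , _ , eq , _ = <-irrefl eq (toℕ<n i)

  Forested : ℕ → ℕ → Set
  Forested u v = ¬ Bit u S × ¬ Bit v S × Adjacent u v

  private
    X : Set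
    X = ∃[ v ] v ∈ₛ ∁ separator

    X-injective : ∀ {x y : X} → proj₁ x ≡ proj₁ y → x ≡ y
    X-injective {_ , p} {_ , q} refl = cong (_ ,_) ([]=-irrelevant p q)

    _≟ˣ_ : (x y : X) → Dec (x ≡ y)
    x ≟ˣ y = map′ X-injective (cong proj₁) (proj₁ x ≟ᶠ proj₁ y)

    outsideS : ∀ {i} → ¬ Bit (toℕ i) S → i ∈ₛ ∁ separator
    outsideS {i} ¬x = x∉p⇒x∈∁p λ p → ¬x (from bit-toℕ (subst T (sym ([]=⇒lookup p)) tt))

    forested : ∀ {u v} → Forested u v → ∃[ x ] ∃[ y ] (toℕ (proj₁ {B = _∈ₛ ∁ separator} x) ≡ u ×
               toℕ (proj₁ {B = _∈ₛ ∁ separator} y) ≡ v × Adj (graph − separator) x y)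
    forested (p , q , e) with adjacent-inv e
    ... | i , j , refl , refl , e′ = (i , outsideS p) , (j , outsideS q) , refl , refl , e′

  acyclic : (P : ℕ → Set) → ∃ P →
    (∀ {v} → P v → ∃[ u ] ∃[ w ] (u ≢ w × P u × P w × Forested u v × Forested w v)) → ⊥
  acyclic P (v , Pv) twoNeighbours = forest
    (minDegree2⇒cycle {G = graph − separator} _≟ˣ_ small (λ x → P (toℕ (proj₁ x))) start (λ {x} → step′ {x}))
    where
    small : ∀ {xs : List X} → Unique xs → length xs ≤ n
    small {xs} u = ≤-trans (≤-reflexive (sym (length-map proj₁ xs))) (unique-length (Unique.map⁺ X-injective u))
    start : ∃[ x ] P (toℕ (proj₁ {B = _∈ₛ ∁ separator} x))
    -- `v` is just a number; having a neighbour in the forest makes it a vertex of G - S.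
    start with twoNeighbours Pv
    ... | _ , _ , _ , _ , _ , e , _ with forested e
    ...   | x , y , _ , refl , _ = y , Pv
    step′ : ∀ {x : X} → P (toℕ (proj₁ x)) → ∃[ u ] ∃[ w ] (u ≢ w × P (toℕ (proj₁ u)) × P (toℕ (proj₁ w)) ×
            Adj (graph − separator) u x × Adj (graph − separator) w x)
    step′ {x} Px with twoNeighbours Px
    ... | u , w , u≢w , Pu , Pw , e , e′ with forested e | forested e′
    ...   | i , j , refl , eq , d | i′ , j′ , refl , eq′ , d′ =
      i , i′ , (λ { refl → u≢w refl }) , Pu , Pw ,
      subst (Adj (graph − separator) i) (X-injective {j} {x} (toℕ-injective eq)) d ,
      subst (Adj (graph − separator) i′) (X-injective {j′} {x} (toℕ-injective eq′)) d′

  finite : ∀ ys → All (_< n) ys → ∃[ xs ] map (toℕ {n}) xs ≡ ys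
  finite []       []       = [] , refl
  finite (y ∷ ys) (l ∷ ls) =
    let (xs , eq) = finite ys ls in fromℕ< l ∷ xs , cong₂ _∷_ (toℕ-fromℕ< l) eq

  nums : List ℕ
  nums = n ∷ vertices

  vertices⊆nums : ∀ {i : Fin n} → toℕ i ∈ nums
  vertices⊆nums = there toℕ∈vertices

  -- Labellings correspond to good choices of states

  module Search (ℓ : ℕ) (0<n : 0 < n)
    (labels : List ℕ) (labels⇔ : ∀ {x} → x ∈ labels ⇔ (x ∈ vertices × x ≤ ℓ))
    (keys : List ℕ) (keys⇔ : ∀ {v} → v ∈ keys ⇔ (v ∈ vertices × Bit v S))
    (masks : List (List (ℕ × Bool))) (masks-complete : (h : ℕ → Bool) → tabulateOn h keys ∈ masks)
    (guesses : List (List (ℕ × ℕ)))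
    (guesses-complete : (x : ℕ → ℕ) → (∀ {v} → v ∈ keys → x v ∈ labels) → tabulateOn x keys ∈ guesses)
    (guesses-sound : ∀ {f} → f ∈ guesses → (∀ {e} → e ∈ f → proj₁ e ∈ keys) ×
      (∀ {e e′} → e ∈ f → e′ ∈ f → proj₁ e ≡ proj₁ e′ → proj₂ e ≡ proj₂ e′))
    (U : List Cell)
    (U⇔ : ∀ {x β m c} → (x , β , m , c) ∈ U ⇔ (x ∈ labels × m ∈ masks × c ∈ vertices))
    where

    module _ (a b : Fin n) (f : List (ℕ × ℕ)) where

      open Instances vertices G S (toℕ a) (toℕ b) n f

      realise : ∀ {s} → s ∈ U → ∀ β (h : ℕ → Bool) {c} → c ≤ dist a b →
        ∃[ m ] ((label s , β , m , c) ∈ U × (∀[ k ∈ m ] (T (proj₂ k) → T (h (proj₁ k)))) ×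
                (∀ {v} → v ∈ vertices → Bit v S → T (h v) → Marked v m))
      realise i β h l = tabulateOn h keys ,
        from U⇔ (proj₁ (to U⇔ i) , masks-complete h , ∈-downFrom⁺ (≤-<-trans l (dist<n a b))) ,
        sound , λ j x t → _ , ∈-map⁺ (λ v → v , h v) (from keys⇔ (j , x)) , refl , t
        where
        sound : ∀[ k ∈ tabulateOn h keys ] (T (proj₂ k) → T (h (proj₁ k)))
        sound j with ∈-map⁻ (λ v → v , h v) j
        ... | v , _ , refl = λ t → t

      -- A positive `c` is at most d(a,b) when the ball of radius `c - 1` misses `b`. Zero is
      -- treated apart, since the ball of radius `pred 0` contains `b` if a = b.
      affordable⇔ : ∀ c → Affordable c ⇔ c ≤ dist a b
      affordable⇔ zero    = mk⇔ (λ _ → z≤n) (λ _ ())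
      affordable⇔ (suc c) = mk⇔
        (λ h → ≰⇒> (h (s≤s z≤n) ∘ from (within⇔ a)))
        (λ l _ w → <-irrefl refl (≤-trans l (to (within⇔ a) w)))

      setting : Setting U (dist a b)
      setting = record
        { adjacent-sym    = adjacent-sym
        ; adjacent-irrefl = adjacent-irrefl
        ; root-isolated   = root-isolated
        ; acyclic         = acyclic
        ; realise         = realise
        ; affordable⇔     = affordable⇔
        }

      open Elimination vertices G S (toℕ a) (toℕ b) n f setting public

      accepts⇔goodRows : Accepts nums U ⇔ Good (initialRows nums)
      accepts⇔goodRows = accepts⇔good nums (Unique.downFrom⁺ (suc n)) (here refl) refl

      row∈ : ∀ {v} → v ∈ nums → (v , tableOf v U) ∈ initialRows nums
      row∈ i = ∈-map⁺ (λ v → v , tableOf v U) i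

      row∈⁻ : ∀ {e} → e ∈ initialRows nums → proj₁ e ∈ nums × proj₂ e ≡ tableOf (proj₁ e) U
      row∈⁻ i with ∈-map⁻ (λ v → v , tableOf v U) i
      ... | v , j , refl = j , refl

      sum-rows : ∀ (c : ℕ → ℕ) xs → sum (map (λ e → c (proj₁ e)) (initialRows xs)) ≡ sum (map c xs)
      sum-rows c []       = refl
      sum-rows c (x ∷ xs) = cong (c x +_) (sum-rows c xs)

      module _ (f∈guesses : f ∈ guesses) (g : Good (initialRows nums)) where

        open Good g

        private
          x : Fin n → ℕ
          x i = label (σ (toℕ i))

          initially : ∀ {v} → v ∈ nums → σ v ∈ U × Initial v (σ v)
          initially i = to tableOf-members (chosen (row∈ i))

          -- Entries of a guess concern vertices of `S`, whose states have to agree with some entry.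
          -- Guesses are functional, so it is this entry.
          guessed : ∀ {e i} → e ∈ f → proj₁ e ≡ toℕ i → proj₂ e ≡ x i
          guessed {e} {i} j eq =
            let bit = proj₂ (to keys⇔ (subst (_∈ keys) eq (proj₁ (guesses-sound f∈guesses) j)))
                (e′ , j′ , eq′ , eq″) = proj₁ (proj₂ (initially (vertices⊆nums {i}))) bit
            in trans (proj₂ (guesses-sound f∈guesses) j j′ (trans eq (sym eq′))) eq″

          SupportOf : Fin n → Set
          SupportOf v = ∃[ u ] (Adj graph u v ×
                          (x u < x v ⊎ x u ≡ 0 × x v ≡ 0 × dist a u < dist a v))

          supportFrom : ∀ {u y v} → Supports (toℕ a) u y (toℕ v) (x v) →
                        (∀ i → toℕ i ≡ u → y ≡ x i) → SupportOf v
          supportFrom {v = v} s h with supports⇒ s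
          ... | i , eq , t = i , subst (λ y → InSupport a i y v (x v)) (h i eq) t

          -- Nothing has been merged in the initial rows, so a mark on `v` comes directly from a
          -- supporting row; that `a` marks itself is excluded by `v≢a`.
          supportS : ∀ {v} → v ≢ a → Bit (toℕ v) S → SupportOf v
          supportS {v} v≢a bit with marked toℕ∈vertices bit
          ... | e , i , k , j , eq , t with row∈⁻ i
          ...   | i′ , _ with proj₁ (proj₂ (proj₂ (proj₂ (proj₂ (initially i′))))) j t
          ...     | inj₂ (_ , eq′) = ⊥-elim (v≢a (toℕ-injective (trans eq eq′)))
          ...     | inj₁ (e′ , j′ , eq′ , s) = supportFrom
            (subst (λ y → Supports (toℕ a) (proj₁ e) (label (σ (proj₁ e))) (toℕ v) y)
              (guessed {i = v} j′ (trans eq′ (sym eq)))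
              (subst (λ w → Supports (toℕ a) (proj₁ e) (label (σ (proj₁ e))) w (proj₂ e′))
                (trans eq′ (sym eq)) s))
            (λ i eq → cong (label ∘ σ) (sym eq))

          supportF : ∀ {v} → v ≢ a → ¬ Bit (toℕ v) S → SupportOf v
          supportF {v} v≢a ¬bit with fulfilled (row∈ (vertices⊆nums {v}))
          ... | inj₂ (e , i , _ , s) = supportFrom s (λ i eq → cong (label ∘ σ) (sym eq))
          ... | inj₁ t with proj₁ (proj₂ (proj₂ (proj₂ (initially (vertices⊆nums {v}))))) t
          ...   | inj₁ bit = ⊥-elim (¬bit bit)
          ...   | inj₂ (inj₁ eq) = ⊥-elim (v≢a (toℕ-injective eq))
          ...   | inj₂ (inj₂ (inj₁ eq)) = ⊥-elim (<-irrefl eq (toℕ<n v))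
          ...   | inj₂ (inj₂ (inj₂ (e , j , s))) = supportFrom s (λ i eq → guessed {i = i} j (sym eq))

        good⇒labelling : Labelling ℓ a b
        good⇒labelling = record
          { label   = x
          ; label≤ℓ = λ v → proj₂ (range v)
          ; label<n = λ v → ∈-downFrom⁻ (proj₁ (range v))
          ; label-a = proj₁ (proj₂ (proj₂ (initially (vertices⊆nums {a})))) (inj₁ refl)
          ; label-b = proj₁ (proj₂ (proj₂ (initially (vertices⊆nums {b})))) (inj₂ refl)
          ; support = λ v v≢a → support v v≢a (T? (lookup separator v))
          ; budget  = budget
          }
          where
          range : ∀ v → x v ∈ vertices × x v ≤ ℓ
          range v = to labels⇔ (proj₁ (to U⇔ (proj₁ (initially (vertices⊆nums {v})))))
          support : ∀ v → v ≢ a → Dec (T (lookup separator v)) → SupportOf v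
          support v v≢a (yes t) = supportS v≢a (from bit-toℕ t)
          support v v≢a (no ¬t) = supportF v≢a (¬t ∘ to bit-toℕ)
          budget : ∀ {xs} → Unique xs → All (λ v → x v ≡ 0 × v ≢ a) xs → length xs ≤ dist a b
          -- Each zero other than `a` pays at least 1 in its own row, so there are at most as many
          -- as the total payment.
          budget {xs} u zs = begin
            length xs                  ≡⟨ sym (length-map toℕ xs) ⟩
            length (map toℕ xs)        ≤⟨ unique⇒length≤sum c (Unique.map⁺ toℕ-injective u) pays ⟩
            sum (map c nums)           ≡⟨ sym (sum-rows c nums) ⟩
            sum (map (λ e → c (proj₁ e)) (initialRows nums)) ≤⟨ afforded ⟩
            dist a b                   ∎
            where
            open ≤-Reasoning
            c : ℕ → ℕ
            c v = payment (σ v)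
            pays : ∀ {y} → y ∈ map toℕ xs → y ∈ nums × 0 < c y
            pays i with ∈-map⁻ toℕ i
            ... | v , j , refl =
              let (z , v≢a) = All.lookup zs j in
              vertices⊆nums {v} ,
              proj₂ (proj₂ (proj₂ (proj₂ (proj₂ (initially (vertices⊆nums {v}))))))
                (z , v≢a ∘ toℕ-injective , λ eq → <-irrefl eq (toℕ<n v))

    module _ {a b : Fin n} (L : Labelling ℓ a b) where

      open Labelling L renaming (label to labelᶠ)

      private
        -- The root needs a label as well. The default 0 is an admissible label because n is
        -- positive.
        x : ℕ → ℕ
        x v with v <? n
        ... | yes l = labelᶠ (fromℕ< l)
        ... | no _  = 0

        x-toℕ : ∀ i → x (toℕ i) ≡ labelᶠ i
        x-toℕ i with toℕ i <? n
        ... | yes l = cong labelᶠ (toℕ-injective (toℕ-fromℕ< l))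
        ... | no ¬l = ⊥-elim (¬l (toℕ<n i))

        x∈labels : ∀ v → x v ∈ labels
        x∈labels v with v <? n
        ... | yes l = from labels⇔ (∈-downFrom⁺ (label<n _) , label≤ℓ _)
        ... | no _  = from labels⇔ (∈-downFrom⁺ 0<n , z≤n)

        f : List (ℕ × ℕ)
        f = tabulateOn x keys

      open Instances vertices G S (toℕ a) (toℕ b) n f

      private

        abstract

          β : ℕ → Bool
          β v = does (decides? (supportedLocally-decides v (x v)))

          β-proof : ∀ v → Reflects (SupportedLocally v (x v)) (β v)
          β-proof v = proof (decides? (supportedLocally-decides v (x v)))

          h : ℕ → ℕ → Bool
          h v w = does (decides? (supportsKey-decides w v (x v)))

          h-proof : ∀ v w → Reflects (SupportsKey w v (x v)) (h v w)
          h-proof v w = proof (decides? (supportsKey-decides w v (x v)))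

          costs? : ∀ v → Dec (Costs v (x v))
          costs? v = decides? (costs-decides v (x v))

        c : ℕ → ℕ
        c v = choice (does (costs? v)) 1 0

        m : ℕ → List (ℕ × Bool)
        m v = tabulateOn (h v) keys

        σ : ℕ → Cell
        σ v = x v , β v , m v , c v

        -- The payers are distinct zeros other than `a`. `Costs` excludes the root, so all of them
        -- are elements of `Fin n` and `budget` applies.
        sum≤dist : sum (map c nums) ≤ dist a b
        sum≤dist = begin
          sum (map c nums)     ≡⟨ sum≡length-filter costs? nums ⟩
          length ys            ≡⟨ cong length (sym eq) ⟩
          length (map toℕ xs)  ≡⟨ length-map toℕ xs ⟩
          length xs            ≤⟨ budget unique (All.tabulate zero-label) ⟩
          dist a b             ∎
          where
          open ≤-Reasoning
          ys = filter costs? nums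
          below : ∀ {y} → y ∈ ys → y < n
          below i with ∈-filter⁻ costs? {xs = nums} i
          ... | here refl , _ , _ , ¬root = ⊥-elim (¬root refl)
          ... | there j , _               = ∈-downFrom⁻ j
          fin = finite ys (All.tabulate below)
          xs = proj₁ fin
          eq = proj₂ fin
          unique : Unique xs
          unique = Unique.map⁻ (subst Unique (sym eq) (Unique.filter⁺ costs? (Unique.downFrom⁺ (suc n))))
          zero-label : ∀ {v} → v ∈ xs → labelᶠ v ≡ 0 × v ≢ a
          zero-label {v} i with ∈-filter⁻ costs? {xs = nums} (subst (toℕ v ∈_) eq (∈-map⁺ toℕ i))
          ... | _ , z , v≢a , _ = trans (sym (x-toℕ v)) z , λ eq → v≢a (cong toℕ eq)

        c∈vertices : ∀ {v} → v ∈ nums → c v ∈ vertices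
        c∈vertices i = ∈-downFrom⁺ (≤-<-trans (≤-trans (summand i) sum≤dist) (dist<n a b))
          where
          summand : ∀ {v xs} → v ∈ xs → c v ≤ sum (map c xs)
          summand (here refl) = m≤m+n _ _
          summand (there i)   = ≤-trans (summand i) (m≤n+m _ _)

        entry∈f : ∀ {i} → Bit (toℕ i) S → (toℕ i , x (toℕ i)) ∈ f
        entry∈f bit = ∈-map⁺ (λ v → v , x v) (from keys⇔ (toℕ∈vertices , bit))

        initially : ∀ v → Initial v (σ v)
        initially v =
          (λ bit → guess (bit-inv bit)) ,
          (λ { (inj₁ refl) → trans (x-toℕ a) label-a ; (inj₂ refl) → trans (x-toℕ b) label-b }) ,
          from (reflects-T (β-proof v)) ,
          marks-sound ,
          λ k → pays (costs? v) k
          where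
          guess : ∃[ i ] (toℕ i ≡ v × T (lookup separator i)) → ∃[ e ∈ f ] (proj₁ e ≡ v × proj₂ e ≡ x v)
          guess (i , refl , t) = _ , entry∈f (from bit-toℕ t) , refl , refl
          marks-sound : ∀[ k ∈ m v ] (T (proj₂ k) → SupportsKey (proj₁ k) v (x v))
          marks-sound j with ∈-map⁻ (λ w → w , h v w) j
          ... | w , _ , refl = from (reflects-T (h-proof v w))
          pays : (d : Dec (Costs v (x v))) → Costs v (x v) → 0 < choice (does d) 1 0
          pays (yes _) k = s≤s z≤n
          pays (no ¬k) k = ⊥-elim (¬k k)

        supported-by : ∀ v → v ≢ a →
          ∃[ u ] (Adj graph u v × Supports (toℕ a) (toℕ u) (x (toℕ u)) (toℕ v) (x (toℕ v)))
        supported-by v v≢a =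
          let (u , e , s) = support v v≢a in u , e ,
          ⇒supports (e , subst (λ y → y < x (toℕ v) ⊎ y ≡ 0 × x (toℕ v) ≡ 0 × dist a u < dist a v)
            (sym (x-toℕ u))
            (subst (λ y → labelᶠ u < y ⊎ labelᶠ u ≡ 0 × y ≡ 0 × dist a u < dist a v) (sym (x-toℕ v)) s))

        Rows : Set
        Rows = List Row

        rows : Rows
        rows = initialRows a b f nums

        marking : ∀ {v w} → v ∈ nums → w ∈ keys → SupportsKey w v (x v) →
                  ∃[ e ∈ rows ] Marked w (mask (σ (proj₁ e)))
        marking {v} {w} i j s =
          _ , row∈ a b f i , _ , ∈-map⁺ (λ w → w , h v w) j , refl , to (reflects-T (h-proof v w)) s

        -- If `a` belongs to `S`, it marks itself; every other vertex of `S` is marked in the row of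
        -- its supporter.
        marked : ∀ {w} → w ∈ vertices → Bit w S → ∃[ e ∈ rows ] Marked w (mask (σ (proj₁ e)))
        marked {w} j bit with bit-inv bit
        ... | i , refl , _ with i ≟ᶠ a
        ...   | yes refl = marking (vertices⊆nums {a}) (from keys⇔ (j , bit)) (inj₂ (refl , refl))
        ...   | no i≢a   =
          let (u , _ , s) = supported-by i i≢a
          in marking (vertices⊆nums {u}) (from keys⇔ (j , bit)) (inj₁ (_ , entry∈f bit , refl , s))

        Fulfilled : ℕ → Set
        Fulfilled v = T (β v) ⊎ (∃[ e ∈ rows ] InForest (proj₁ e) (σ (proj₁ e)) v (σ v))

        fulfilledF : ∀ i → Fulfilled (toℕ i)
        fulfilledF i with β (toℕ i) | β-proof (toℕ i)
        ... | true  | _      = inj₁ tt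
        ... | false | ofⁿ ¬s with i ≟ᶠ a
        ...   | yes refl = ⊥-elim (¬s (inj₂ (inj₁ refl)))
        ...   | no i≢a with supported-by i i≢a
        -- A supporter in `S` occurs in the guess and would have set the flag, so the supporter lies
        -- in the forest.
        ...     | u , e , s with T? (lookup separator u)
        ...       | yes t = ⊥-elim (¬s (inj₂ (inj₂ (inj₂ (_ , entry∈f (from bit-toℕ t) , s)))))
        ...       | no ¬t = inj₂ (_ , row∈ a b f (vertices⊆nums {u}) ,
                              (¬t ∘ to bit-toℕ , ¬s ∘ inj₁ , from adjacent-toℕ e) , s)

        fulfilled : ∀ {v} → v ∈ nums → Fulfilled v
        fulfilled (here refl) = inj₁ (to (reflects-T (β-proof n)) (inj₂ (inj₂ (inj₁ refl))))
        fulfilled (there j) with vertex j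
        ... | i , refl = fulfilledF i

      labelling⇒good : ∃[ f ∈ guesses ] Good a b f (initialRows a b f nums)
      labelling⇒good = f , guesses-complete x (λ {v} _ → x∈labels v) , record
        { σ         = σ
        ; chosen    = λ {e} i → let (j , eq) = row∈⁻ a b f i in subst (σ (proj₁ e) ∈_) (sym eq)
                        (from tableOf-members
                          (from U⇔ (x∈labels (proj₁ e) , masks-complete (h (proj₁ e)) , c∈vertices j) ,
                           initially (proj₁ e)))
        ; fulfilled = λ i → fulfilled (proj₁ (row∈⁻ a b f i))
        ; marked    = marked
        ; afforded  = ≤-trans (≤-reflexive (sum-rows a b f c nums)) sum≤dist
        }

    found⇔ : (∃[ a ∈ vertices ] ∃[ b ∈ vertices ] ∃[ f ∈ guesses ] Instances.Accepts vertices G S a b n f nums U) ⇔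
             HasEccentricityShortestPath graph (ℤ.+ ℓ)
    found⇔ = mk⇔ sound complete
      where
      sound : _ → _
      sound (_ , i , _ , j , f , k , x) with vertex i | vertex j
      ... | a , refl | b , refl =
        hasEccentricityShortestPath (good⇒labelling a b f k (to (accepts⇔goodRows a b f) x))
      complete : _ → _
      complete h =
        let (a , b , L) = labelling h
            (f , k , g) = labelling⇒good L
        in _ , toℕ∈vertices {a} , _ , toℕ∈vertices {b} , f , k , from (accepts⇔goodRows a b f) g

    search-decides : ∀ labels′ keys′ bits →
      Decides search (U ∷ guesses ∷ masks ∷ bits ∷ keys′ ∷ labels′ ∷ nums ∷ n ∷ vertices ∷ G ∷ S ∷ ℓ ∷ [])
        (HasEccentricityShortestPath graph (ℤ.+ ℓ))
    search-decides labels′ keys′ bits = decides-⇔ found⇔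
      (any-decides λ a → any-decides λ b → any-decides λ f →
        call-decides (Instances.accepts-decides vertices G S a b n f nums U))

-- Enumerations

numerals-downFrom : ∀ {A : Set} (S : List A) k →
  foldl (λ acc _ → caseList [] (λ x _ → suc x ∷ acc) acc) (downFrom (suc k)) S ≡ downFrom (suc (length S + k))
numerals-downFrom []      k = refl
numerals-downFrom (_ ∷ S) k =
  trans (numerals-downFrom S (suc k)) (cong (downFrom ∘ suc) (+-suc (length S) k))

select-unique : ∀ {A : Set} (p : A → Bool) {xs} → Unique xs →
                Unique (collected (λ x → choice (p x) [ x ] []) xs)
select-unique {A} p {xs} u = Unique-resp-↭ (↭-sym (collected-↭ f xs)) (unique xs u)
  where
  f : A → List A
  f x = choice (p x) [ x ] []
  among : ∀ xs {y} → y ∈ concatMap f xs → y ∈ xs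
  among (x ∷ xs) i with p x | i
  ... | true  | here eq = here eq
  ... | true  | there j = there (among xs j)
  ... | false | j       = there (among xs j)
  unique : ∀ xs → Unique xs → Unique (concatMap f xs)
  unique []       []      = []
  unique (x ∷ xs) (n ∷ u) with p x
  ... | true  = All.tabulate (λ i → All.lookup n (among xs i)) ∷ unique xs u
  ... | false = unique xs u

module _ {A : Set} (options : List A) where

  extend : List (List (ℕ × A)) → ℕ → List (List (ℕ × A))
  extend acc s = collected (λ g → collected (λ o → [ (s , o) ∷ g ]) options) acc

  ∈-extend : ∀ {acc s g} → g ∈ extend acc s ⇔ (∃[ g′ ∈ acc ] ∃[ o ∈ options ] g ≡ (s , o) ∷ g′)
  ∈-extend {acc} {s} = mk⇔
    (λ i → let (g′ , j , k) = to (∈-collected {f = λ g → collected (λ o → [ (s , o) ∷ g ]) options}) i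
               (o , l , m)  = to (∈-collected {f = λ o → [ (s , o) ∷ g′ ]}) k
           in g′ , j , o , l , only m)
    (λ { (g′ , j , o , l , refl) →
      from (∈-collected {f = λ g → collected (λ o → [ (s , o) ∷ g ]) options})
        (g′ , j , from (∈-collected {f = λ o → [ (s , o) ∷ g′ ]}) (o , l , here refl)) })
    where
    only : ∀ {B : Set} {x y : B} → x ∈ [ y ] → x ≡ y
    only (here eq) = eq

  extend-keys : ∀ keys {done acc} → (∀ {g} → g ∈ acc → map proj₁ g ≡ done) →
                ∀ {g} → g ∈ foldl extend acc keys → map proj₁ g ≡ keys ʳ++ done
  extend-keys []         h i = h i
  extend-keys (s ∷ keys) {done} {acc} h i = extend-keys keys step-keys i
    where
    step-keys : ∀ {g} → g ∈ extend acc s → map proj₁ g ≡ s ∷ done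
    step-keys j with to (∈-extend {acc} {s}) j
    ... | g′ , k , o , _ , refl = cong (s ∷_) (h k)

  extend-complete : ∀ (x : ℕ → A) keys {done acc} → (∀ {v} → v ∈ keys → x v ∈ options) →
                    map (λ v → v , x v) done ∈ acc →
                    map (λ v → v , x v) (keys ʳ++ done) ∈ foldl extend acc keys
  extend-complete x []         h i = i
  extend-complete x (s ∷ keys) h i = extend-complete x keys (h ∘ there)
    (from (∈-extend {_} {s}) (_ , i , x s , h (here refl) , refl))

  length-extend : ∀ acc s → length (extend acc s) ≤ length acc * length options
  length-extend acc s = ≤-trans
    (length-collect (λ g → collected (λ o → [ (s , o) ∷ g ]) options) {length options} acc
      (All.universal (λ g → ≤-trans
        (length-collect (λ o → [ (s , o) ∷ g ]) {1} options (All.universal (λ _ → ≤-refl) options) [])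
        (≤-reflexive (trans (+-identityʳ _) (*-identityʳ _)))) acc) [])
    (≤-reflexive (+-identityʳ _))

  assigned : List ℕ → List (List (ℕ × A))
  assigned keys = foldl extend ([] ∷ []) keys

  assigned-keys : ∀ keys {g} → g ∈ assigned keys → map proj₁ g ≡ keys ʳ++ []
  assigned-keys keys = extend-keys keys λ { (here refl) → refl }

  length-assigned : ∀ keys {acc} → length (foldl extend acc keys) ≤ length acc * length options ^ length keys
  length-assigned []         {acc} = ≤-reflexive (sym (*-identityʳ _))
  length-assigned (s ∷ keys) {acc} = begin
    length (foldl extend (extend acc s) keys)                   ≤⟨ length-assigned keys ⟩
    length (extend acc s) * length options ^ length keys        ≤⟨ *-monoˡ-≤ _ (length-extend acc s) ⟩
    length acc * length options * length options ^ length keys  ≡⟨ *-assoc (length acc) _ _ ⟩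
    length acc * (length options * length options ^ length keys) ∎
    where open ≤-Reasoning

  unique-functional : ∀ {g : List (ℕ × A)} → Unique (map proj₁ g) → ∀ {e e′} → e ∈ g → e′ ∈ g →
                      proj₁ e ≡ proj₁ e′ → proj₂ e ≡ proj₂ e′
  unique-functional (n ∷ u) (here refl) (here refl) eq = refl
  unique-functional (n ∷ u) (here refl) (there j)   eq = ⊥-elim (All.lookup n (∈-map⁺ proj₁ j) eq)
  unique-functional (n ∷ u) (there i)   (here refl) eq = ⊥-elim (All.lookup n (∈-map⁺ proj₁ i) (sym eq))
  unique-functional (n ∷ u) (there i)   (there j)   eq = unique-functional u i j eq

elements : ∀ {n} → Subset n → List (Fin n)
elements []            = []
elements (inside ∷ S)  = zero ∷ map suc (elements S)
elements (outside ∷ S) = map suc (elements S)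

length-elements : ∀ {n} (S : Subset n) → length (elements S) ≡ ∣ S ∣
length-elements []            = refl
length-elements (inside ∷ S)  = cong suc (trans (length-map suc (elements S)) (length-elements S))
length-elements (outside ∷ S) = trans (length-map suc (elements S)) (length-elements S)

∈-elements : ∀ {n} (S : Subset n) i → T (lookup S i) → i ∈ elements S
∈-elements (inside ∷ S)  zero    t = here refl
∈-elements (inside ∷ S)  (suc i) t = there (∈-map⁺ suc (∈-elements S i t))
∈-elements (outside ∷ S) (suc i) t = ∈-map⁺ suc (∈-elements S i t)

toList-lookup : ∀ {n} {A : Set} (xs : Data.Vec.Vec A n) → toList xs ≡ tabulate (lookup xs)
toList-lookup []       = refl
toList-lookup (x ∷ xs) = cong (x ∷_) (toList-lookup xs)

states : List ℕ → List Bool → List (List (ℕ × Bool)) → List ℕ → List Cell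
states xs βs ms cs = eval# universe (xs ∷ βs ∷ ms ∷ cs ∷ [])

∈-states : ∀ xs βs ms cs {x β m c} → (x , β , m , c) ∈ states xs βs ms cs ⇔ (x ∈ xs × β ∈ βs × m ∈ ms × c ∈ cs)
∈-states xs βs ms cs {x} {β} {m} {c} = mk⇔ forward
  (λ (i , j , k , l) → from (∈-collected {f = f₁}) (x , i , from (∈-collected {f = f₂ x})
    (β , j , from (∈-collected {f = f₃ x β}) (m , k , from (∈-collected {f = f₄ x β m}) (c , l , here refl)))))
  where
  f₄ : ℕ → Bool → List (ℕ × Bool) → ℕ → List Cell
  f₄ x β m c = [ x , β , m , c ]
  f₃ : ℕ → Bool → List (ℕ × Bool) → List Cell
  f₃ x β m = collected (f₄ x β m) cs
  f₂ : ℕ → Bool → List Cell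
  f₂ x β = collected (f₃ x β) ms
  f₁ : ℕ → List Cell
  f₁ x = collected (f₂ x) βs
  forward : (x , β , m , c) ∈ states xs βs ms cs → x ∈ xs × β ∈ βs × m ∈ ms × c ∈ cs
  forward i with to (∈-collected {f = f₁} {xs}) i
  ... | x′ , i₁ , i with to (∈-collected {f = f₂ x′} {βs}) i
  ...   | β′ , i₂ , i with to (∈-collected {f = f₃ x′ β′} {ms}) i
  ...     | m′ , i₃ , i with to (∈-collected {f = f₄ x′ β′ m′} {cs}) i
  ...       | c′ , i₄ , here refl = i₁ , i₂ , i₃ , i₄

bind-decides : ∀ {Γ s} {τ : Ty s} {t : Tm Γ τ} {u : Tm (τ ▸ Γ) bool} {γ P} →
               Decides u (eval# t γ ∷ γ) P → Decides (bind t u) γ P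
bind-decides (decided r) = decided r

ifte-decides : ∀ {Γ} {c t u : Tm Γ bool} {γ P} → eval# c γ ≡ false → Decides u γ P → Decides (ifte c t u) γ P
ifte-decides {t = t} {u} {γ} {P} eq (decided r) =
  decided (subst (λ b → Reflects P (choice b (eval# t γ) (eval# u γ))) (sym eq) r)

uncons-decides : ∀ {Γ s z} {τ : Ty s} {t : Tm Γ (list z τ)} {e : Tm Γ bool} {u γ x xs P} → eval# t γ ≡ x ∷ xs →
                 Decides u (x ∷ xs ∷ γ) P → Decides (uncons t e u) γ P
uncons-decides {e = e} {u} {γ} {P = P} eq (decided r) =
  decided (subst (λ l → Reflects P (caseList (eval# e γ) (λ x xs → eval# u (x ∷ xs ∷ γ)) l)) (sym eq) r)

-- Correctness of the program

module DecisionCorrectness {n : ℕ} (0<n : 0 < n) (graph : Graph (Fin n)) (separator : Subset n) (ℓ : ℕ)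
  (connected : Connected graph) (forest : Forest (graph − separator)) where

  open Correctness graph separator connected forest
  open Graphs vertices G

  γ : Env Decision
  γ = nums ∷ n ∷ vertices ∷ G ∷ S ∷ ℓ ∷ []

  labels : List ℕ
  labels = eval# labelsUpTo γ

  labels-members : Members labelsUpTo γ (λ x → x ∈ vertices × x < suc ℓ)
  labels-members = select-members λ x → call-decides (less-decides x (suc ℓ))

  labels⇔ : ∀ {x} → x ∈ labels ⇔ (x ∈ vertices × x ≤ ℓ)
  labels⇔ = mk⇔ (λ i → let (j , l) = to (members labels-members) i in j , ≤-pred l)
                (λ (j , l) → from (members labels-members) (j , s≤s l))

  labels-unique : Unique labels
  labels-unique = select-unique (λ x → eval# {N ▸ Decision} (call less (# 0 ∷ suc (# 6) ∷ [])) (x ∷ γ)) (Unique.downFrom⁺ n)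

  -- This bound, and not n, is the base of the number of guesses. It rests on `labels` having no
  -- repetitions.
  length-labels : length labels ≤ suc ℓ
  length-labels = ≤-trans
    (unique⇒length≤ labels-unique (λ i → ∈-upTo⁺ (s≤s (proj₂ (to labels⇔ i)))))
    (≤-reflexive (length-upTo (suc ℓ)))

  1≤length-labels : 1 ≤ length labels
  1≤length-labels = nonempty (from labels⇔ (∈-downFrom⁺ 0<n , z≤n))
    where
    nonempty : ∀ {x} {xs : List ℕ} → x ∈ xs → 1 ≤ length xs
    nonempty (here _)  = s≤s z≤n
    nonempty (there _) = s≤s z≤n

  keys : List ℕ
  keys = eval# keysOf (labels ∷ γ)

  keys-members : Members keysOf (labels ∷ γ) (λ v → v ∈ vertices × Bit v S)
  keys-members = select-members λ v → call-decides (bit-decides v S)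

  keys-unique : Unique keys
  keys-unique = select-unique (λ v → eval# {N ▸ V N ▸ Decision} (call bit (# 0 ∷ # 6 ∷ [])) (v ∷ labels ∷ γ)) (Unique.downFrom⁺ n)

  length-keys : length keys ≤ ∣ separator ∣
  length-keys = ≤-trans (unique⇒length≤ keys-unique element)
    (≤-reflexive (trans (length-map toℕ (elements separator)) (length-elements separator)))
    where
    element : ∀ {v} → v ∈ keys → v ∈ map toℕ (elements separator)
    element i with bit-inv (proj₂ (to (members keys-members) i))
    ... | j , refl , t = ∈-map⁺ toℕ (∈-elements separator j t)

  -- The order in which assignments list the keys: each key is put in front of those treated before.
  keys′ : List ℕ
  keys′ = keys ʳ++ []

  keys′⇔ : ∀ {v} → v ∈ keys′ ⇔ (v ∈ vertices × Bit v S)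
  keys′⇔ = mk⇔ (λ i → to (members keys-members) (unreversed (∈-ʳ++⁻ keys i)))
                (λ x → ∈-ʳ++⁺ˡ (from (members keys-members) x))
    where
    unreversed : ∀ {v} → v ∈ keys ⊎ v ∈ [] → v ∈ keys
    unreversed (inj₁ i) = i

  keys′-unique : Unique keys′
  keys′-unique = Unique-resp-↭ (↭-sym (ʳ++-↭ keys [])) (subst Unique (sym (++-identityʳ keys)) keys-unique)

  bits : List Bool
  bits = true ∷ false ∷ []

  masks : List (List (ℕ × Bool))
  masks = assigned bits keys

  guesses : List (List (ℕ × ℕ))
  guesses = assigned labels keys

  U : List Cell
  U = states labels bits masks vertices

  ∈bits : ∀ β → β ∈ bits
  ∈bits true  = here refl
  ∈bits false = there (here refl)

  U⇔ : ∀ {x β m c} → (x , β , m , c) ∈ U ⇔ (x ∈ labels × m ∈ masks × c ∈ vertices)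
  U⇔ {β = β} = drop (∈bits β) (∈-states labels bits masks vertices)
    where
    drop : ∀ {A B C D E : Set} → C → A ⇔ (B × C × D × E) → A ⇔ (B × D × E)
    drop y e = mk⇔ (λ i → let (j , _ , k , l) = to e i in j , k , l) (λ (j , k , l) → from e (j , y , k , l))

  private
    module Searching = Search ℓ 0<n labels labels⇔ keys′ keys′⇔ masks
      (λ h → extend-complete bits h keys {[]} (λ {v} _ → ∈bits (h v)) (here refl))
      guesses
      (λ x h → extend-complete labels x keys {[]} (λ i → h (∈-ʳ++⁺ˡ i)) (here refl))
      (λ {f} i → (λ j → subst (_ ∈_) (assigned-keys labels keys i) (∈-map⁺ proj₁ j)) ,
                 unique-functional labels (subst Unique (sym (assigned-keys labels keys i)) keys′-unique))
      U U⇔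

  decide-decides : Decides decide γ (HasEccentricityShortestPath graph (ℤ.+ ℓ))
  decide-decides = bind-decides (bind-decides (bind-decides (bind-decides (bind-decides (bind-decides
    (Searching.search-decides labels keys bits))))))

  input : ⟦ pair (list (list bool)) (pair (list bool) (pair bool nat)) ⟧
  input = G , S , false , ℓ

  numerals-nums : eval# numerals (S ∷ []) ≡ nums
  numerals-nums = trans (numerals-downFrom S 0)
    (cong (downFrom ∘ suc) (trans (+-identityʳ _) (length-tabulate (lookup separator))))

  main-decides : Decides main (input ∷ []) (HasEccentricityShortestPath graph (ℤ.+ ℓ))
  main-decides = ifte-decides refl (bind-decides (branches _ numerals-nums))
    where
    branches : ∀ xs → xs ≡ nums →
      Decides decideNumbered (xs ∷ input ∷ []) (HasEccentricityShortestPath graph (ℤ.+ ℓ))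
    branches _ refl = uncons-decides refl (call-decides decide-decides)

-- Validity of the claimed sizes

module Sizes (Q M : ℕ) (1≤Q : 1 ≤ Q) (2≤M : 2 ≤ M) where

  open Bounds Q M 1≤Q 2≤M

  -- Like Decides, this determines the term in unification.
  record Validity {Γ s} {τ : Ty s} (t : Tm Γ τ) (γ : Env Γ) : Set where
    constructor validity
    field
      isValid : Valid t γ

  module _ {Γ : Ctx} {γ : Env Γ} where

    pure-valid : ∀ {s} {τ : Ty s} {t : Tm Γ τ} → T (pure t) → Validity t γ
    pure-valid {t = t} p = validity (valid t p γ)

    bind-valid : ∀ {s s′} {τ : Ty s} {σ : Ty s′} {t : Tm Γ τ} {u : Tm (τ ▸ Γ) σ} →
                 Validity t γ → Validity u (eval# t γ ∷ γ) → Validity (bind t u) γ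
    bind-valid (validity v) (validity w) = validity (v , w)

    assume-valid : ∀ {s} {τ σ : Ty s} {t : Tm Γ σ} → Validity t γ →
                   (Ok σ (eval# t γ) → Ok τ (eval# t γ)) → Validity (assume τ t) γ
    assume-valid (validity v) o = validity (v , o)

    call-valid : ∀ {s Δ} {τ : Ty s} {f : Tm Δ τ} {as : Args Γ Δ} → T (pureArgs as) →
                 Validity f (evalArgs as γ) → Validity (call f as) γ
    call-valid {as = as} p (validity v) = validity (validArgs as p γ , v)

    ifte-valid : ∀ {s} {τ : Ty s} {c : Tm Γ bool} {t u : Tm Γ τ} → T (pure c) → eval# c γ ≡ false →
                 Validity u γ → Validity (ifte c t u) γ
    ifte-valid {c = c} {t} {u} p eq (validity v) =
      validity (valid c p γ , subst (λ b → choice b (Valid t γ) (Valid u γ)) (sym eq) v)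

    uncons-valid : ∀ {s s′ z} {τ : Ty s} {σ : Ty s′} {t : Tm Γ (list z τ)} {e : Tm Γ σ} {u x xs} →
                   T (pure t) → T (pure e) → eval# t γ ≡ x ∷ xs →
                   Validity u (x ∷ xs ∷ γ) → Validity (uncons t e u) γ
    uncons-valid {t = t} {e} {u} p q eq (validity v) = validity (valid t p γ , valid e q γ ,
      subst (caseList ⊤ (λ x xs → Valid u (x ∷ xs ∷ γ))) (sym eq) v)

  bound-M : bound (0 , 1) ≡ M
  bound-M = trans (+-identityʳ (M * 1)) (*-identityʳ M)

  bound-Q : bound (1 , 0) ≡ Q
  bound-Q = trans (*-identityʳ (Q * 1)) (*-identityʳ Q)

  ≤M : ∀ {m} → m ≤ M → m ≤ bound (0 , 1)
  ≤M p = ≤-trans p (≤-reflexive (sym bound-M))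

  module _ {s} (d : Degree) (τ : Ty s) (options : List ⟦ s ⟧) where

    -- As there is at least one option, the possible final number |acc| · |options|^|keys| bounds
    -- the present number of assignments too. This quantity does not increase from round to round.
    valid-extendAll : ∀ keys₀ → 1 ≤ length options → ∀ keys acc →
      length acc * length options ^ length keys ≤ bound d →
      ValidFold (extendAll d τ) (options ∷ keys₀ ∷ []) acc keys
    valid-extendAll keys₀ p []         acc b = tt
    valid-extendAll keys₀ p (x ∷ keys) acc b =
      (((tt , λ (_ , os) → few , os) , λ g → tt , λ o → (tt , tt) , tt) , λ (_ , os) → tt , os) ,
      valid-extendAll keys₀ p keys (extend options acc x) (begin
        length (extend options acc x) * length options ^ length keys     ≤⟨ *-monoˡ-≤ _ (length-extend options acc x) ⟩
        length acc * length options * length options ^ length keys       ≡⟨ *-assoc (length acc) _ _ ⟩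
        length acc * length options ^ suc (length keys)                  ≤⟨ b ⟩
        bound d                                                          ∎)
      where
      open ≤-Reasoning
      few : length acc ≤ bound d
      few = begin
        length acc                                       ≡⟨ sym (*-identityʳ _) ⟩
        length acc * 1                                   ≤⟨ *-monoʳ-≤ (length acc) (m^n>0 (length options) {{>-nonZero p}} (suc (length keys))) ⟩
        length acc * length options ^ suc (length keys)  ≤⟨ b ⟩
        bound d                                          ∎

    module _ (keys : List ℕ) (b : length options ^ length keys ≤ bound d) where

      private
        b′ : 1 * length options ^ length keys ≤ bound d
        b′ = ≤-trans (≤-reflexive (+-identityʳ _)) b

      valid-assignments : 1 ≤ length options → Validity (assignments d τ) (options ∷ keys ∷ [])
      valid-assignments p = validity (tt , (tt , tt) , valid-extendAll keys p keys ([] ∷ []) b′)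

      ok-assignments : length keys ≤ bound (0 , 1) →
        Ok (Assignments τ) (assigned options keys) → Ok (list (just d) (V (pair N τ))) (assigned options keys)
      ok-assignments l (_ , os) =
        ≤-trans (length-assigned options keys) b′ ,
        All.tabulate λ {g} i → ≤-trans (≤-reflexive (length-assignment i)) l , proj₂ (All.lookup os i)
        where
        length-assignment : ∀ {g} → g ∈ assigned options keys → length g ≡ length keys
        length-assignment {g} i = trans (sym (length-map proj₁ g))
          (trans (cong length (assigned-keys options keys i))
                 (trans (length-ʳ++ keys) (+-identityʳ _)))

  module _ {n : ℕ} (0<n : 0 < n) (graph : Graph (Fin n)) (separator : Subset n) (ℓ : ℕ)
    (connected : Connected graph) (forest : Forest (graph − separator))
    (n<M : n < M) (2^k≤M : 2 ^ ∣ separator ∣ ≤ M) (ℓ^k≤Q : suc ℓ ^ ∣ separator ∣ ≤ Q) where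

    open DecisionCorrectness 0<n graph separator ℓ connected forest
    open Correctness graph separator connected forest using (nums; G; S)

    private

      length-keys≤M : length keys ≤ bound (0 , 1)
      length-keys≤M = ≤M (≤-trans length-keys (≤-trans (c≤2^c ∣ separator ∣) 2^k≤M))

      few-masks : length bits ^ length keys ≤ bound (0 , 1)
      few-masks = ≤M (≤-trans (^-monoʳ-≤ 2 length-keys) 2^k≤M)

      -- The one place where ℓ enters a size: everything else is bounded in terms of `M`.
      few-guesses : length labels ^ length keys ≤ bound (1 , 0)
      few-guesses = begin
        length labels ^ length keys  ≤⟨ ^-monoˡ-≤ (length keys) length-labels ⟩
        suc ℓ ^ length keys          ≤⟨ ^-monoʳ-≤ (suc ℓ) length-keys ⟩
        suc ℓ ^ ∣ separator ∣        ≤⟨ ℓ^k≤Q ⟩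
        Q                            ≡⟨ sym bound-Q ⟩
        bound (1 , 0)                ∎
        where open ≤-Reasoning

    valid-decide : Validity decide γ
    valid-decide =
      bind-valid (pure-valid tt) (bind-valid (pure-valid tt)
      (bind-valid (assume-valid (pure-valid tt) λ _ → ≤M 2≤M , tt ∷ tt ∷ [])
      (bind-valid (assume-valid (call-valid tt
                     (valid-assignments (0 , 1) bool bits keys few-masks (s≤s z≤n)))
                   (ok-assignments (0 , 1) bool bits keys few-masks length-keys≤M))
      (bind-valid (assume-valid (call-valid tt
                     (valid-assignments (1 , 0) N labels keys few-guesses 1≤length-labels))
                   (ok-assignments (1 , 0) N labels keys few-guesses length-keys≤M))
      (bind-valid (pure-valid tt) (pure-valid tt))))))

    ok-nums : Ok (V N) nums
    ok-nums = ≤M (≤-trans (≤-reflexive (length-downFrom (suc n))) n<M) ,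
              All.tabulate λ i → ≤M (≤-trans (<⇒≤ (∈-downFrom⁻ {suc n} i)) n<M)

    valid-main : Validity main (input ∷ [])
    valid-main = ifte-valid tt refl (bind-valid
      (assume-valid (pure-valid tt) λ _ → subst (Ok (V N)) (sym numerals-nums) ok-nums)
      (branches _ numerals-nums))
      where
      branches : ∀ xs → xs ≡ nums → Validity decideNumbered (xs ∷ input ∷ [])
      branches _ refl = uncons-valid tt tt refl (call-valid tt valid-decide)

  ok-input : ∀ {n} (g : Fin n → Fin n → Bool) (h : Fin n → Bool) β ℓ → n ≤ M →
    OkEnv {Input} (((tabulate λ u → tabulate (g u)) , tabulate h , β , ℓ) ∷ [])
  ok-input {n} g h β ℓ p =
    ((fits _ , All.tabulate⁺ {f = λ u → tabulate (g u)} λ u → fits (g u) , All.universal (λ _ → tt) _) ,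
     (fits h , All.universal (λ _ → tt) _) , tt , tt) , tt
    where
    fits : ∀ {A : Set} (f : Fin n → A) → length (tabulate f) ≤ bound (0 , 1)
    fits f = ≤M (≤-trans (≤-reflexive (length-tabulate f)) p)

-- Running time

program : Program
program = record
  { extraVars = 2
  ; body      = environment := cons (var environment) nil ⨾ compile main ⨾ environment := var result
  }

timing : Timing
timing = steps 4 ⟫ time main ⟫ steps 2

abstract

  -- Opaque, because any fixed exponent will do and powers with it should not be unfolded.
  exponent : ℕ
  exponent = proj₂ (degreeOf timing)

  -- Evaluation of the term confirms that `Q` enters to the first power, as the factor ℓ^k demands.
  degree-timing : degreeOf timing ≡ (1 , exponent)
  degree-timing = refl

encode-input : ∀ {n} (graph : Graph (Fin n)) (separator : Subset n) β ℓ →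
  encode (pair (list (list bool)) (pair (list bool) (pair bool nat)))
    ((tabulate λ u → tabulate λ v → adj graph u v) , tabulate (lookup separator) , β , ℓ) ≡
  encodeGraph graph ∙ encodeSubset separator ∙ encodeBool β ∙ encodeℕ ℓ
encode-input graph separator β ℓ = cong₂ _∙_
  (cong encodeList (trans (map-tabulate (λ u → tabulate (adj graph u)) (encode (list bool)))
    (tabulate-cong λ u → cong encodeList (map-tabulate (adj graph u) encodeBool))))
  (cong (λ xs → encodeList (map encodeBool xs) ∙ encodeBool β ∙ encodeℕ ℓ) (sym (toList-lookup separator)))

^-distribʳ-* : ∀ e m n → (m * n) ^ e ≡ m ^ e * n ^ e
^-distribʳ-* zero    m n = refl
^-distribʳ-* (suc e) m n = trans (cong (m * n *_) (^-distribʳ-* e m n)) ([m*n]*[o*p]≡[m*o]*[n*p] m n (m ^ e) (n ^ e))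

-- The summand 1 covers k = 1, whose logarithm is 0. It ends up in the constant factor.
k≤1+k*log : ∀ k → k ≤ 1 + k * ⌈log₂ k ⌉
k≤1+k*log zero          = z≤n
k≤1+k*log (suc zero)    = s≤s z≤n
k≤1+k*log k@(suc (suc j)) = m≤n⇒m≤1+n (≤-trans (≤-reflexive (sym (*-identityʳ k)))
  (*-monoʳ-≤ k (⌈log₂⌉-mono-≤ {2} {k} (s≤s (s≤s z≤n)))))

-- `L` is max(1, ℓ), and ℓ + 1 ≤ 2L gives the assumption on `Q`. The resulting 2^k joins the powers
-- of 2^k from `M`, which makes the exponent k(e + 1) and explains `suc e`.
time-bound : ∀ e {Q k L n} → Q ≤ 2 ^ k * L ^ k →
  Q ^ 1 * (2 ^ k * (2 * n)) ^ e ≤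
  2 ^ suc e * 2 ^ e * 2 ^ (suc e * (k * ⌈log₂ k ⌉)) * L ^ k * n ^ e
time-bound e {Q} {k} {L} {n} q = begin
  Q ^ 1 * (2 ^ k * (2 * n)) ^ e
    ≡⟨ cong₂ _*_ (*-identityʳ Q) (trans (^-distribʳ-* e (2 ^ k) (2 * n))
         (cong₂ _*_ (^-*-assoc 2 k e) (^-distribʳ-* e 2 n))) ⟩
  Q * (2 ^ (k * e) * (2 ^ e * n ^ e))
    ≤⟨ *-monoˡ-≤ _ q ⟩
  2 ^ k * L ^ k * (2 ^ (k * e) * (2 ^ e * n ^ e))
    ≡⟨ collect-powers (2 ^ k) (L ^ k) (2 ^ (k * e)) (2 ^ e) (n ^ e) ⟩
  2 ^ k * 2 ^ (k * e) * (2 ^ e * L ^ k * n ^ e)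
    ≡⟨ cong (_* (2 ^ e * L ^ k * n ^ e)) (sym (^-distribˡ-+-* 2 k (k * e))) ⟩
  2 ^ (k + k * e) * (2 ^ e * L ^ k * n ^ e)
    ≤⟨ *-monoˡ-≤ _ (^-monoʳ-≤ 2 (begin
         k + k * e                         ≡⟨ sym (*-suc k e) ⟩
         k * suc e                         ≡⟨ *-comm k (suc e) ⟩
         suc e * k                         ≤⟨ *-monoʳ-≤ (suc e) (k≤1+k*log k) ⟩
         suc e * (1 + k * ⌈log₂ k ⌉)       ≡⟨ *-suc (suc e) _ ⟩
         suc e + suc e * (k * ⌈log₂ k ⌉)   ∎)) ⟩
  2 ^ (suc e + suc e * (k * ⌈log₂ k ⌉)) * (2 ^ e * L ^ k * n ^ e)
    ≡⟨ cong (_* (2 ^ e * L ^ k * n ^ e)) (^-distribˡ-+-* 2 (suc e) (suc e * (k * ⌈log₂ k ⌉))) ⟩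
  2 ^ suc e * 2 ^ (suc e * (k * ⌈log₂ k ⌉)) * (2 ^ e * L ^ k * n ^ e)
    ≡⟨ distribute (2 ^ suc e) (2 ^ (suc e * (k * ⌈log₂ k ⌉))) (2 ^ e) (L ^ k) (n ^ e) ⟩
  2 ^ suc e * 2 ^ e * 2 ^ (suc e * (k * ⌈log₂ k ⌉)) * L ^ k * n ^ e ∎
  where
  open ≤-Reasoning
  collect-powers : ∀ a b c d f → a * b * (c * (d * f)) ≡ a * c * (d * b * f)
  collect-powers = solve-∀
  distribute : ∀ a b c d f → a * b * (c * d * f) ≡ a * c * b * d * f
  distribute = solve-∀

module Run {n : ℕ} (0<n : 0 < n) (graph : Graph (Fin n)) (separator : Subset n) (Q : ℕ) (1≤Q : 1 ≤ Q) where

  -- The factor 2 makes `M` exceed n, as the n + 1 rows require, and makes it at least 2 even if n =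
  -- 1 and k = 0.
  M : ℕ
  M = 2 ^ ∣ separator ∣ * (2 * n)

  2n≤M : 2 * n ≤ M
  2n≤M = ≤-trans (≤-reflexive (sym (+-identityʳ _))) (*-monoˡ-≤ (2 * n) (m^n>0 2 ∣ separator ∣))

  n<M : n < M
  n<M = ≤-trans (+-mono-≤ 0<n (≤-reflexive (sym (+-identityʳ n)))) 2n≤M

  2≤M : 2 ≤ M
  2≤M = ≤-trans (s≤s 0<n) n<M

  2^k≤M : 2 ^ ∣ separator ∣ ≤ M
  2^k≤M = ≤-trans (≤-reflexive (sym (*-identityʳ _)))
    (*-monoʳ-≤ (2 ^ ∣ separator ∣) (≤-trans 0<n (m≤m+n n _)))

  open Bounds Q M 1≤Q 2≤M
  open Sizes Q M 1≤Q 2≤M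

  data-of : Bool → ℕ → ⟦ pair (list (list bool)) (pair (list bool) (pair bool nat)) ⟧
  data-of β ℓ = (tabulate λ u → tabulate λ v → adj graph u v) , tabulate (lookup separator) , β , ℓ

  decides : ∀ {A : Set} {β ℓ b} → Validity main (data-of β ℓ ∷ []) → Decides main (data-of β ℓ ∷ []) A →
            Q ^ 1 * M ^ exponent ≤ b →
            DecidesInTime program (encodeGraph graph ∙ encodeSubset separator ∙ encodeBool β ∙ encodeℕ ℓ) A b
  decides {A} {β} {ℓ} {b} v r p = conclude
    (set ⨟ exec main (data-of β ℓ ∷ []) (ok-input (adj graph) (lookup separator) β ℓ (<⇒≤ n<M)) (Validity.isValid v) ⨟ set)
    where
    answer : Bool
    answer = eval# main (data-of β ℓ ∷ [])
    conclude : ∀ {i j} → Exec (Program.body program) (encode _ (data-of β ℓ) ∷ nil ∷ nil ∷ [])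
                              (encodeBool answer ∷ i ∷ j ∷ []) timing →
      DecidesInTime program (encodeGraph graph ∙ encodeSubset separator ∙ encodeBool β ∙ encodeℕ ℓ) A b
    conclude {i} {j} (executed t run l) = answer , t ,
      (i ∷ j ∷ [] ,
       subst (λ input → (input ∷ nil ∷ nil ∷ []) ⊢ Program.body program ⇓ encodeBool answer ∷ i ∷ j ∷ [] steps t)
         (encode-input graph separator β ℓ) run) ,
      Decides.reflects r , ≤-trans (subst (λ d → t ≤ bound d) degree-timing l) p

theorem1 : ∃[ program ] ∃[ a ] ∃[ b ] ∃[ c ]
    (∀ (n : ℕ) .{{_ : NonZero n}} (G : Graph (Fin n)) (S : Subset n) (k : ℕ) (ℓ : ℤ) →
    Connected G →
    ∣ S ∣ ≡ k →
    Forest (G − S) →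
    DecidesInTime program (encodeInput G S ℓ)
    (HasEccentricityShortestPath G ℓ)
    (a * 2 ^ (b * (k * ⌈log₂ k ⌉)) * abs (1ℤ ⊔ᶻ ℓ) ^ k * n ^ c))
theorem1 = program , 2 ^ suc exponent * 2 ^ exponent , suc exponent , exponent , decision
  where
  decision : ∀ (n : ℕ) .{{_ : NonZero n}} (G : Graph (Fin n)) (S : Subset n) (k : ℕ) (ℓ : ℤ) →
    Connected G → ∣ S ∣ ≡ k → Forest (G − S) →
    DecidesInTime program (encodeInput G S ℓ) (HasEccentricityShortestPath G ℓ)
      (2 ^ suc exponent * 2 ^ exponent * 2 ^ (suc exponent * (k * ⌈log₂ k ⌉)) *
       abs (1ℤ ⊔ᶻ ℓ) ^ k * n ^ exponent)
  decision n G S _ (ℤ.+ ℓ) connected refl forest =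
    Run.decides 0<n G S Q 1≤Q {β = false} {ℓ}
      (Sizes.valid-main Q _ 1≤Q _ 0<n G S ℓ connected forest (Run.n<M 0<n G S Q 1≤Q) (Run.2^k≤M 0<n G S Q 1≤Q) ≤-refl)
      (DecisionCorrectness.main-decides 0<n G S ℓ connected forest)
      (time-bound exponent {k = ∣ S ∣} {1 ⊔ ℓ}
        (≤-trans (^-monoˡ-≤ ∣ S ∣ suc≤) (≤-reflexive (^-distribʳ-* ∣ S ∣ 2 (1 ⊔ ℓ)))))
    where
    0<n = >-nonZero⁻¹ n
    Q = suc ℓ ^ ∣ S ∣
    1≤Q = m^n>0 (suc ℓ) ∣ S ∣
    suc≤ : suc ℓ ≤ 2 * (1 ⊔ ℓ)
    suc≤ = +-mono-≤ (m≤m⊔n 1 ℓ) (≤-trans (m≤n⊔m 1 ℓ) (≤-reflexive (sym (+-identityʳ _))))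
  decision n G S _ -[1+ ℓ ] connected refl forest =
    -- For a negative ℓ the program stops at the sign and no claim about sizes is evaluated, so `Q`
    -- can be 1.
    Run.decides 0<n G S 1 ≤-refl {β = true} {ℓ} (Sizes.validity (tt , tt)) (decided (ofⁿ none))
      (time-bound exponent {k = ∣ S ∣} {1}
        (*-mono-≤ (m^n>0 2 ∣ S ∣) (≤-reflexive (sym (^-zeroˡ ∣ S ∣)))))
    where
    0<n = >-nonZero⁻¹ n
    none : ¬ HasEccentricityShortestPath G -[1+ ℓ ]
    none (a , _ , _ , _ , cover) with cover a
    ... | _ , _ , ()
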